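{- Let $\Sigma$ be a signed graph. Write $X_\Sigma$ as a polynomial with rational coefficients in the elements of $\{\xi_n : n\ge 1\}\cup\{q_{a,b}: a,b\ge 1\}\cup\{z\}$. Then for every $k\ge0$, the number of acyclic orientations of $\Sigma$ with exactly $k$ sinks equals the sum of the coefficients of those monomials for which the sum of the indices $n$ of its $\xi_n$ factors (counted with multiplicity) equals $k$.
   Context: A signed graph $\Sigma$ is a finite graph (loops and multiple edges allowed) together with a sign function $\mathrm{sgn}:E(\Sigma)\to\{+,-\}$; write $e:uv$ if $e$ has endpoints $u,v$ ($u=v$ for a loop). A coloring is a map $\kappa:V(\Sigma)\to\mathbb{Z}$; it is proper if $\kappa(u)\neq \mathrm{sgn}(e)\kappa(v)$ for every edge $e:uv$. The chromatic $B$-symmetric function is $X_\Sigma=\sum_{\kappa\text{ proper}}\prod_{v\in V(\Sigma)}x_{\kappa(v)}$, a formal power series in commuting variables $x_i$, $i\in\mathbb{Z}$. An orientation of $\Sigma$ assigns to each incidence of an edge with an endpoint (each half-edge; a loop has two) an arrow pointing toward or away from that vertex, such that on a positive edge exactly one of the two arrows points toward its vertex, and on a negative edge the two arrows either both point toward their vertices or both point away. A cycle is a closed walk such that, considering only the edges of the walk, every vertex of the walk has at least one arrow pointing into it and at least one pointing out of it; an orientation is acyclic if it has no cycle. A sink is a vertex all of whose incident arrows point toward it (an isolated vertex is a sink). Notation: $p_{a,b}=\sum_{i\in\mathbb{Z}}x_i^a x_{ -i}^b$; $q_{a,b}=(-1)^{a+b+1}p_{a,b}$; $z=-x_0$; $\xi_n=\sum_{a=1}^n\binom{n}{a}p_{a,0}$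 for $n\ge1$ (equivalently $p_{n,0}=\sum_{i=1}^n\binom{n}{i}(-1)^{n-i}\xi_i$). -}

module Defs where

open import Data.Bool.Base using (if_then_else_)
open import Data.Fin.Base using (Fin; zero; suc; toℕ; fromℕ; opposite; _↑ˡ_)
import Data.Fin.Properties as Fin
open import Data.Integer.Base as ℤ using (ℤ; +_; -1ℤ; _⊖_)
import Data.Integer.Properties as ℤ
open import Data.List.Base using (List; []; _∷_; map; foldr; filter; length; upTo; allFin; cartesianProductWith)
open import Data.List.Membership.Propositional using (_∈_)
open import Data.List.Relation.Unary.Unique.Propositional using (Unique)
open import Data.Nat.Base as ℕ using (ℕ; zero; suc; NonZero)
open import Data.Nat.Combinatorics using (_C_)
import Data.Nat.Properties as ℕ
open import Data.Product using (Σ-syntax; ∃-syntax; _×_; _,_; proj₁; proj₂)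
open import Data.Rational.Base using (ℚ; 0ℚ; 1ℚ; _+_; _*_; -_; _/_)
open import Data.Sign.Base using (Sign)
open import Data.Vec.Base using (Vec; []; _∷_; lookup; replicate; zipWith; _[_]≔_)
open import Data.Vec.Properties using (≡-dec)
open import Function.Base using (_∘_)
open import Function.Bundles using (_⇔_)
open import Relation.Binary.PropositionalEquality using (_≡_; _≢_)
open import Relation.Nullary using (¬_; Dec; does; ¬?)

-- Exactly n elements satisfy P: a duplicate-free list of them has length n.
HasCardinality : ∀ {A : Set} → (A → Set) → ℕ → Set
HasCardinality P n = ∃[ xs ] Unique xs × (∀ x → x ∈ xs ⇔ P x) × length xs ≡ n

fromℤ : ℤ → ℚ
fromℤ i = i / 1

∑ : ∀ {A : Set} → List A → (A → ℚ) → ℚ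
∑ xs f = foldr (λ x s → f x + s) 0ℚ xs

allVecs : ∀ {A : Set} → List A → (n : ℕ) → List (Vec A n)
allVecs xs zero    = [] ∷ []
allVecs xs (suc n) = cartesianProductWith _∷_ xs (allVecs xs n)

-- Monomials in n variables are vectors of exponents.

1ᵐ : ∀ {n} → Vec ℕ n
1ᵐ = replicate _ 0

_*ᵐ_ : ∀ {n} → Vec ℕ n → Vec ℕ n → Vec ℕ n
_*ᵐ_ = zipWith ℕ._+_

_/ᵐ_ : ∀ {n} → Vec ℕ n → Vec ℕ n → Vec ℕ n
_/ᵐ_ = zipWith ℕ._∸_

x[_]^_ : ∀ {n} → Fin n → ℕ → Vec ℕ n
x[ i ]^ a = 1ᵐ [ i ]≔ a

divisors : ∀ {n} → Vec ℕ n → List (Vec ℕ n)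
divisors []      = [] ∷ []
divisors (a ∷ α) = cartesianProductWith _∷_ (upTo (suc a)) (divisors α)

-- Formal power series in x_i, i ∈ ℤ.  A monomial involves finitely many
-- variables, so it is given by some N and its exponents at -N, …, N.  The
-- element i of Index N stands for the integer i - N; under this reading
-- `opposite` is negation.

Index : ℕ → Set
Index N = Fin (suc (N ℕ.+ N))

value : ∀ N → Index N → ℤ
value N i = toℕ i ⊖ N

index0 : ∀ N → Index N
index0 N = fromℕ N ↑ˡ N

Monomial : ℕ → Set
Monomial N = Vec ℕ (suc (N ℕ.+ N))

-- A series is its coefficient function.  The same monomial is represented for
-- every sufficiently large N; all series below give these representations the
-- same coefficient.
PowerSeries : Set
PowerSeries = ∀ N → Monomial N → ℚ

infix 4 _≈_
_≈_ : PowerSeries → PowerSeries → Set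
f ≈ g = ∀ N (α : Monomial N) → f N α ≡ g N α

-- The coefficient of α in the series consisting of the single monomial β.
δ : ∀ {n} → Vec ℕ n → Vec ℕ n → ℚ
δ β α = if does (≡-dec ℕ._≟_ α β) then 1ℚ else 0ℚ

1ˢ : PowerSeries
1ˢ N α = δ 1ᵐ α

_*ˢ_ : PowerSeries → PowerSeries → PowerSeries
(f *ˢ g) N α = ∑ (divisors α) λ β → f N β * g N (α /ᵐ β)

-- p a b = Σ_{i ∈ ℤ} x_i^a x_{-i}^b, for (a , b) ≠ (0 , 0): then the terms with
-- ∣i∣ > N do not contribute to a monomial supported on [-N , N].
p : ℕ → ℕ → PowerSeries
p a b N α = ∑ (allFin _) λ (i : Index N) → δ ((x[ i ]^ a) *ᵐ (x[ opposite i ]^ b)) α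

data Generator : Set where
  ξ : (n : ℕ) → .{{NonZero n}} → Generator
  q : (a b : ℕ) → .{{NonZero a}} → .{{NonZero b}} → Generator
  z : Generator

series : Generator → PowerSeries
series (ξ n)   N α = ∑ (map suc (upTo n)) λ a → fromℤ (+ (n C a)) * p a 0 N α
series (q a b) N α = fromℤ (-1ℤ ℤ.^ (a ℕ.+ b ℕ.+ 1)) * p a b N α
series z       N α = - δ (x[ index0 N ]^ 1) α

-- A polynomial is a formal sum of terms; like terms need not be collected.
-- Although q_{a,b} = q_{b,a} as series, both symbols are allowed.
Polynomial : Set
Polynomial = List (ℚ × List Generator)

⟦_⟧ᵐ : List Generator → PowerSeries
⟦ []     ⟧ᵐ = 1ˢ
⟦ g ∷ gs ⟧ᵐ = series g *ˢ ⟦ gs ⟧ᵐ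

⟦_⟧ : Polynomial → PowerSeries
⟦ P ⟧ N α = ∑ P λ (c , gs) → c * ⟦ gs ⟧ᵐ N α

ξ-weight : List Generator → ℕ
ξ-weight []           = 0
ξ-weight (ξ n   ∷ gs) = n ℕ.+ ξ-weight gs
ξ-weight (q _ _ ∷ gs) = ξ-weight gs
ξ-weight (z     ∷ gs) = ξ-weight gs

coefficientSum : ℕ → Polynomial → ℚ
coefficientSum k P = ∑ (filter (λ t → ξ-weight (proj₂ t) ℕ.≟ k) P) proj₁

-- The two half-edges of an edge are numbered arbitrarily by Fin 2; `opposite`
-- exchanges them.
record SignedGraph : Set where
  field
    #V   : ℕ
    #E   : ℕ
    end  : Fin #E → Fin 2 → Fin #V
    sgn  : Fin #E → Sign

  Vertex Edge HalfEdge : Set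
  Vertex   = Fin #V
  Edge     = Fin #E
  HalfEdge = Edge × Fin 2

  endpoint : HalfEdge → Vertex
  endpoint (e , h) = end e h

signed : Sign → ℤ → ℤ
signed Sign.+ i = i
signed Sign.- i = ℤ.- i

∏x : ∀ {n k} → Vec (Fin n) k → Vec ℕ n
∏x []      = 1ᵐ
∏x (i ∷ κ) = (x[ i ]^ 1) *ᵐ ∏x κ

module _ (G : SignedGraph) where
  open SignedGraph G

  Proper : (Vertex → ℤ) → Set
  Proper κ = ∀ e → κ (end e zero) ≢ signed (sgn e) (κ (end e (suc zero)))

  proper? : ∀ κ → Dec (Proper κ)
  proper? κ = Fin.all? λ e → ¬? (κ (end e zero) ℤ.≟ signed (sgn e) (κ (end e (suc zero))))

  properColorings : ∀ N → List (Vec (Index N) #V)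
  properColorings N = filter (λ κ → proper? (value N ∘ lookup κ)) (allVecs (allFin _) _)

  -- Only colorings with values in [-N , N] contribute to a monomial supported
  -- there.
  X : PowerSeries
  X N α = ∑ (properColorings N) λ κ → δ (∏x κ) α

data Arrow : Set where
  toward away : Arrow

Compatible : Sign → Arrow → Arrow → Set
Compatible Sign.+ s t = s ≢ t
Compatible Sign.- s t = s ≡ t

module _ (G : SignedGraph) where
  open SignedGraph G

  Arrows : Set
  Arrows = Vec (Vec Arrow 2) #E

  arrow : Arrows → HalfEdge → Arrow
  arrow o (e , h) = lookup (lookup o e) h

  IsOrientation : Arrows → Set
  IsOrientation o = ∀ e → Compatible (sgn e) (arrow o (e , zero)) (arrow o (e , suc zero))

  data Walk : Vertex → Vertex → Set where
    stop : ∀ u → Walk u u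
    step : ∀ {v w} u (e : Edge) (h : Fin 2) →
           end e h ≡ u → end e (opposite h) ≡ v → Walk v w → Walk u w

  vertices : ∀ {u w} → Walk u w → List Vertex
  vertices (stop u)              = u ∷ []
  vertices (step u e h _ _ rest) = u ∷ vertices rest

  edges : ∀ {u w} → Walk u w → List Edge
  edges (stop u)              = []
  edges (step u e h _ _ rest) = e ∷ edges rest

  HasArrow : Arrows → List Edge → Vertex → Arrow → Set
  HasArrow o es v d = Σ[ (e , h) ∈ HalfEdge ] e ∈ es × end e h ≡ v × arrow o (e , h) ≡ d

  -- The walk of length 0 is never a cycle: its vertex meets no edge of the walk.
  IsCycle : ∀ {u} → Arrows → Walk u u → Set
  IsCycle o w = ∀ v → v ∈ vertices w →
    HasArrow o (edges w) v toward × HasArrow o (edges w) v away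

  Acyclic : Arrows → Set
  Acyclic o = ∀ {u} (w : Walk u u) → ¬ IsCycle o w

  IsSink : Arrows → Vertex → Set
  IsSink o v = ∀ h → endpoint h ≡ v → arrow o h ≡ toward

  AcyclicOrientationWithSinks : ℕ → Arrows → Set
  AcyclicOrientationWithSinks k o =
    IsOrientation o × Acyclic o × HasCardinality (IsSink o) k

{-# OPTIONS --safe #-}
module Submission where

-- Evaluate a series at x_N = t - 1, x_{-N} = 0 and x_i = -1 for the other |i| ≤ N.  Then p_{a,b} becomes
--   (2N - 1)(-1)^(a+b) + [b = 0] (t - 1)^a + [a = 0] (t - 1)^b,
-- a polynomial in N.  Put N = 0: by the binomial theorem ξ_n becomes t^n, and every q_{a,b} and z become 1.
-- So a polynomial P in the generators becomes Σ c t^(ξ-weight).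
--
-- On the other side X becomes Σ_B (t - 1)^|B| (-1)^|V - B| χ_{V - B}(N - 1), where B is the set of vertices with
-- colour N, without positive edges inside, and χ_U(m) counts the proper colourings of U with values in [-m , m].
-- This is again polynomial in N, and at N = 0 it involves (-1)^|U| χ_U(-1), the number a(U) of acyclic orientations
-- of U (Zaslavsky): peeling off the two extreme colours gives the recursion that expresses χ_U(m + 1) through the
-- χ_{U'}(m), and continuing it to m = -1 is inclusion-exclusion over the sinks and sources of acyclic orientations.
-- In the same way Σ_B (t - 1)^|B| a(V - B) = Σ_o t^(number of sinks of o), because a set B without positive edges
-- inside and an acyclic orientation of V - B amount to an acyclic orientation with a set B of sinks.  Comparing the
-- coefficients of t^k proves the claim, and no algebraic independence is needed.
--
-- That X is a polynomial in the generators follows by deletion and contraction, for systems of inequalities between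
-- signed variables: without inequalities the series is a product of the p_{a,b} and a power of x_0.

-- The evaluation point is dictated by the claim. If every q_{a,b} and z are to become 1 and ξ_n is
-- to become t^n, then p_{a,b} with a, b ≥ 1 must become -(-1)^(a+b), x_0 must become -1, and
-- p_{a,0} must become (t - 1)^a - (-1)^a. This asks for one variable t - 1, with partner 0 so that
-- the mixed sums do not see it, and for "minus one" many variables with the value -1. No index set
-- has -1 elements, so the number 2N - 1 of these variables becomes the argument of a polynomial,
-- and forward differences carry the extrapolation.
--
-- On the graph side one operator on functions of vertex sets, `transfer`, does all the work. With
-- weights -1 and -1 it adds a pair of extreme colours, with weights t - 1 and 0 it adds the colours
-- ±N; applied to the numbers a(U), the same two choices give inclusion-exclusion and the count of
-- sinks. All vertex subsets are treated at once, because each application passes to the vertices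
-- that remain.

module CommutativeRings where

  open import Algebra.Core using (Op₁; Op₂)
  open import Algebra.Structures using (IsCommutativeRing)
  open import Algebra.Bundles using (CommutativeRing)

  open import Level using (0ℓ)
  import Algebra.Solver.Ring.NaturalCoefficients.Default as Solver
  open import Data.List.Base using (List; []; _∷_; map; foldr; filter; _++_; cartesianProductWith)
  open import Data.Product using (_×_; _,_; proj₁; proj₂)
  open import Data.Empty using (⊥-elim)
  open import Data.Bool.Base using (if_then_else_)
  open import Function.Base using (_∘_)
  open import Relation.Binary.PropositionalEquality
  open import Relation.Nullary

  -- Counting and evaluation use the ring laws only. The rationals enter with the series themselves
  -- and with the cancellation of positive integers in `Cancellative`.
  record Ring≡ : Set₁ where
    infixl 6 _+_
    infixl 7 _*_
    infix  8 -_
    field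
      Carrier : Set
      _+_ _*_ : Op₂ Carrier
      -_      : Op₁ Carrier
      0# 1#   : Carrier
      isCommutativeRing : IsCommutativeRing _≡_ _+_ _*_ -_ 0# 1#

    open IsCommutativeRing isCommutativeRing public
      using (+-assoc; +-comm; +-identityˡ; +-identityʳ; *-assoc; *-comm; *-identityˡ; *-identityʳ;
             zeroˡ; zeroʳ; distribˡ; distribʳ; -‿inverseˡ; -‿inverseʳ)

    bundle : CommutativeRing 0ℓ 0ℓ
    bundle = record { isCommutativeRing = isCommutativeRing }

    infixl 6 _-_
    _-_ : Op₂ Carrier
    x - y = x + - y

    open import Algebra.Properties.Ring (CommutativeRing.ring bundle) public
      using (-‿distribˡ-*; -‿distribʳ-*; -‿involutive; -‿+-comm)

    module SemiringSolver = Solver (CommutativeRing.commutativeSemiring bundle)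

  -- Finite sums and indicators in a commutative ring.

  module Sums (R : Ring≡) where
    open Ring≡ R
    open SemiringSolver using (solve; _:+_; _:=_)

    ∑ : ∀ {A : Set} → List A → (A → Carrier) → Carrier
    ∑ xs f = foldr (λ x s → f x + s) 0# xs

    interchange : ∀ a b c d → (a + b) + (c + d) ≡ (a + c) + (b + d)
    interchange = solve 4 (λ a b c d → (a :+ b) :+ (c :+ d) := (a :+ c) :+ (b :+ d)) refl

    module _ {A : Set} where

      ∑-cong : ∀ (xs : List A) {f g : A → Carrier} → (∀ x → f x ≡ g x) → ∑ xs f ≡ ∑ xs g
      ∑-cong []       h = refl
      ∑-cong (x ∷ xs) h = cong₂ _+_ (h x) (∑-cong xs h)

      ∑-0 : ∀ (xs : List A) → ∑ xs (λ _ → 0#) ≡ 0#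
      ∑-0 []       = refl
      ∑-0 (x ∷ xs) = trans (+-identityˡ _) (∑-0 xs)

      ∑-++ : ∀ (xs ys : List A) (f : A → Carrier) → ∑ (xs ++ ys) f ≡ ∑ xs f + ∑ ys f
      ∑-++ []       ys f = sym (+-identityˡ _)
      ∑-++ (x ∷ xs) ys f = trans (cong (f x +_) (∑-++ xs ys f)) (sym (+-assoc (f x) _ _))

      ∑-+ : ∀ (xs : List A) (f g : A → Carrier) → ∑ xs (λ x → f x + g x) ≡ ∑ xs f + ∑ xs g
      ∑-+ []       f g = sym (+-identityˡ 0#)
      ∑-+ (x ∷ xs) f g = trans (cong (f x + g x +_) (∑-+ xs f g)) (interchange (f x) (g x) _ _)

      ∑-*ˡ : ∀ (xs : List A) c (f : A → Carrier) → ∑ xs (λ x → c * f x) ≡ c * ∑ xs f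
      ∑-*ˡ []       c f = sym (zeroʳ c)
      ∑-*ˡ (x ∷ xs) c f = trans (cong (c * f x +_) (∑-*ˡ xs c f)) (sym (distribˡ c (f x) _))

      ∑-*ʳ : ∀ (xs : List A) c (f : A → Carrier) → ∑ xs (λ x → f x * c) ≡ ∑ xs f * c
      ∑-*ʳ xs c f = trans (∑-cong xs (λ x → *-comm (f x) c)) (trans (∑-*ˡ xs c f) (*-comm c _))

    ∑-map : ∀ {A B : Set} (h : A → B) (xs : List A) (f : B → Carrier) → ∑ (map h xs) f ≡ ∑ xs (f ∘ h)
    ∑-map h []       f = refl
    ∑-map h (x ∷ xs) f = cong (f (h x) +_) (∑-map h xs f)

    ∑-cartesianProductWith : ∀ {A B C : Set} (h : A → B → C) xs ys (f : C → Carrier) →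
      ∑ (cartesianProductWith h xs ys) f ≡ ∑ xs (λ x → ∑ ys (λ y → f (h x y)))
    ∑-cartesianProductWith h []       ys f = refl
    ∑-cartesianProductWith h (x ∷ xs) ys f =
      trans (∑-++ (map (h x) ys) _ f)
            (cong₂ _+_ (∑-map (h x) ys f) (∑-cartesianProductWith h xs ys f))

    ∑-swap : ∀ {A B : Set} (xs : List A) (ys : List B) (f : A → B → Carrier) →
      ∑ xs (λ x → ∑ ys (f x)) ≡ ∑ ys (λ y → ∑ xs (λ x → f x y))
    ∑-swap []       ys f = sym (∑-0 ys)
    ∑-swap (x ∷ xs) ys f =
      trans (cong (∑ ys (f x) +_) (∑-swap xs ys f)) (sym (∑-+ ys (f x) _))

    𝟙 : ∀ {p} {P : Set p} → Dec P → Carrier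
    𝟙 P? = if does P? then 1# else 0#

    𝟙-true : ∀ {p} {P : Set p} (P? : Dec P) → P → 𝟙 P? ≡ 1#
    𝟙-true (yes _) _ = refl
    𝟙-true (no ¬p) p = ⊥-elim (¬p p)

    𝟙-false : ∀ {p} {P : Set p} (P? : Dec P) → ¬ P → 𝟙 P? ≡ 0#
    𝟙-false (no _)  _  = refl
    𝟙-false (yes p) ¬p = ⊥-elim (¬p p)

    𝟙-⇔ : ∀ {p q} {P : Set p} {Q : Set q} (P? : Dec P) (Q? : Dec Q) → (P → Q) → (Q → P) → 𝟙 P? ≡ 𝟙 Q?
    𝟙-⇔ (yes p) Q? f g = sym (𝟙-true Q? (f p))
    𝟙-⇔ (no ¬p) Q? f g = sym (𝟙-false Q? (¬p ∘ g))

    𝟙-× : ∀ {p q r} {P : Set p} {Q : Set q} {R : Set r} (P? : Dec P) (Q? : Dec Q) (R? : Dec R) →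
      (R → P × Q) → (P → Q → R) → 𝟙 R? ≡ 𝟙 P? * 𝟙 Q?
    𝟙-× (yes p) Q? R? f g = trans (𝟙-⇔ R? Q? (proj₂ ∘ f) (g p)) (sym (*-identityˡ _))
    𝟙-× (no ¬p) Q? R? f g = trans (𝟙-false R? (¬p ∘ proj₁ ∘ f)) (sym (zeroˡ (𝟙 Q?)))

    ∑-filter : ∀ {A : Set} {P : A → Set} (P? : ∀ x → Dec (P x)) (xs : List A) (f : A → Carrier) →
      ∑ (filter P? xs) f ≡ ∑ xs (λ x → 𝟙 (P? x) * f x)
    ∑-filter P? []       f = refl
    ∑-filter P? (x ∷ xs) f with P? x
    ... | yes _ = cong₂ _+_ (sym (*-identityˡ (f x))) (∑-filter P? xs f)
    ... | no  _ = trans (∑-filter P? xs f) (sym (trans (cong₂ _+_ (zeroˡ (f x)) refl) (+-identityˡ _)))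

-- Weighted sums over maps on a vertex set, and polynomial sequences.

module WeightedSums where

  open import Data.List.Base using (List; []; _∷_)
  open import Data.Product using (_,_; proj₁; proj₂; ∃-syntax)
  open import Data.Empty using (⊥-elim)
  open import Data.Bool.Base using (if_then_else_)
  open import Data.Nat.Base as ℕ using (ℕ; zero; suc)
  import Data.Nat.Properties as ℕ
  open import Data.Fin.Base using (Fin; zero; suc)
  import Data.Fin.Properties as Fin
  open import Data.Fin.Subset using (Subset; inside; outside; ⊤; _∉_)
  open import Data.List.Membership.Propositional using () renaming (_∈_ to _∈_)
  open import Data.List.Relation.Unary.Any using (here; there)
  open import Data.Vec.Base using (Vec; []; _∷_; lookup; replicate; here; there)
  open import Function.Base using (_∘_)
  open import Relation.Binary.PropositionalEquality
  open import Relation.Nullary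


  open CommutativeRings
  open import Defs using (allVecs)

  module _ {A : Set} (d : A) (cs : List A) where

    -- Exactly the vectors over which `∑on` sums, so that `∑on-cong` has to compare the summands
    -- only there.
    data On : ∀ {n} → Subset n → Vec A n → Set where
      []   : On [] []
      _∷_  : ∀ {n} {U : Subset n} {κ c} → c ∈ cs → On U κ → On (inside ∷ U) (c ∷ κ)
      skip : ∀ {n} {U : Subset n} {κ} → On U κ → On (outside ∷ U) (d ∷ κ)

    On-outside : ∀ {n} {U : Subset n} {κ} → On U κ → ∀ v → v ∉ U → lookup κ v ≡ d
    On-outside (c∈ ∷ on) zero    v∉ = ⊥-elim (v∉ here)
    On-outside (c∈ ∷ on) (suc v) v∉ = On-outside on v (v∉ ∘ there)
    On-outside (skip on) zero    v∉ = refl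
    On-outside (skip on) (suc v) v∉ = On-outside on v (v∉ ∘ there)

    On-lookup : ∀ {P : A → Set} → (∀ {c} → c ∈ cs → P c) → P d →
      ∀ {n} {U : Subset n} {κ} → On U κ → ∀ v → P (lookup κ v)
    On-lookup h hd (c∈ ∷ on) zero    = h c∈
    On-lookup h hd (c∈ ∷ on) (suc v) = On-lookup h hd on v
    On-lookup h hd (skip on) zero    = hd
    On-lookup h hd (skip on) (suc v) = On-lookup h hd on v

  module SubsetSums (R : Ring≡) where
    open Ring≡ R
    open SemiringSolver using (solve; _:+_; _:*_; _:=_)
    open Sums R

    ∏ : ∀ n → (Fin n → Carrier) → Carrier
    ∏ zero    f = 1#
    ∏ (suc n) f = f zero * ∏ n (f ∘ suc)

    ∏-cong : ∀ n {f g : Fin n → Carrier} → (∀ i → f i ≡ g i) → ∏ n f ≡ ∏ n g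
    ∏-cong zero    h = refl
    ∏-cong (suc n) h = cong₂ _*_ (h zero) (∏-cong n (h ∘ suc))

    *-interchange : ∀ a b c d → (a * b) * (c * d) ≡ (a * c) * (b * d)
    *-interchange = solve 4 (λ a b c d → (a :* b) :* (c :* d) := (a :* c) :* (b :* d)) refl

    ∏-* : ∀ n (f g : Fin n → Carrier) → ∏ n (λ i → f i * g i) ≡ ∏ n f * ∏ n g
    ∏-* zero    f g = sym (*-identityˡ 1#)
    ∏-* (suc n) f g =
      trans (cong (f zero * g zero *_) (∏-* n (f ∘ suc) (g ∘ suc)))
            (*-interchange (f zero) (g zero) _ _)

    ∏-1 : ∀ n {f : Fin n → Carrier} → (∀ i → f i ≡ 1#) → ∏ n f ≡ 1#
    ∏-1 zero    h = refl
    ∏-1 (suc n) h = trans (cong₂ _*_ (h zero) (∏-1 n (h ∘ suc))) (*-identityˡ 1#)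

    ∏-0 : ∀ {n} {f : Fin n → Carrier} i → f i ≡ 0# → ∏ n f ≡ 0#
    ∏-0 {suc n} {f} zero    h = trans (cong (_* ∏ n (f ∘ suc)) h) (zeroˡ (∏ n (f ∘ suc)))
    ∏-0 {suc n} {f} (suc i) h = trans (cong (f zero *_) (∏-0 i h)) (zeroʳ (f zero))

    ∏-𝟙 : ∀ {n} {P : Fin n → Set} (P? : ∀ i → Dec (P i)) → ∏ n (λ i → 𝟙 (P? i)) ≡ 𝟙 (Fin.all? P?)
    ∏-𝟙 {zero}  P? = refl
    ∏-𝟙 {suc n} P? =
      trans (cong (𝟙 (P? zero) *_) (∏-𝟙 (P? ∘ suc)))
            (sym (𝟙-× (P? zero) (Fin.all? (P? ∘ suc)) (Fin.all? P?)
                   (λ h → h zero , h ∘ suc) λ { p ps zero → p ; p ps (suc i) → ps i }))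

    -- A map U → A is encoded by its extension by d to all of Fin n.
    ∑on : ∀ {A : Set} {n} (d : A) (w : A → Carrier) (cs : List A) → Subset n → (Vec A n → Carrier) → Carrier
    ∑on d w cs []            F = F []
    ∑on d w cs (inside ∷ U)  F = ∑ cs λ c → w c * ∑on d w cs U (F ∘ (c ∷_))
    ∑on d w cs (outside ∷ U) F = ∑on d w cs U (F ∘ (d ∷_))

    ∑-cong-∈ : ∀ {A : Set} (cs : List A) {f g : A → Carrier} → (∀ {x} → x ∈ cs → f x ≡ g x) → ∑ cs f ≡ ∑ cs g
    ∑-cong-∈ []       h = refl
    ∑-cong-∈ (x ∷ cs) h = cong₂ _+_ (h (here refl)) (∑-cong-∈ cs (h ∘ there))

    module _ {A : Set} (d : A) where

      ∑on-cong : ∀ {n} {w w′ : A → Carrier} (cs : List A) (U : Subset n) {F G : Vec A n → Carrier} →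
        (∀ {c} → c ∈ cs → w c ≡ w′ c) → (∀ {κ} → On d cs U κ → F κ ≡ G κ) →
        ∑on d w cs U F ≡ ∑on d w′ cs U G
      ∑on-cong cs []            hw h = h []
      ∑on-cong cs (inside ∷ U)  hw h = ∑-cong-∈ cs λ c∈ → cong₂ _*_ (hw c∈) (∑on-cong cs U hw (h ∘ (c∈ ∷_)))
      ∑on-cong cs (outside ∷ U) hw h = ∑on-cong cs U hw (h ∘ skip)

      module _ (w : A → Carrier) (cs : List A) where

        ∑on-*ˡ : ∀ {n} (U : Subset n) k (F : Vec A n → Carrier) →
          ∑on d w cs U (λ κ → k * F κ) ≡ k * ∑on d w cs U F
        ∑on-*ˡ []            k F = refl
        ∑on-*ˡ (inside ∷ U)  k F =
          trans (∑-cong cs λ c → trans (cong (w c *_) (∑on-*ˡ U k (F ∘ (c ∷_)))) (comm3 (w c) k _)) (∑-*ˡ cs k _)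
          where
          comm3 : ∀ x y z → x * (y * z) ≡ y * (x * z)
          comm3 = solve 3 (λ x y z → x :* (y :* z) := y :* (x :* z)) refl
        ∑on-*ˡ (outside ∷ U) k F = ∑on-*ˡ U k (F ∘ (d ∷_))

        ∑on-∑ : ∀ {n} (U : Subset n) {B : Set} (xs : List B) (F : B → Vec A n → Carrier) →
          ∑on d w cs U (λ κ → ∑ xs (λ x → F x κ)) ≡ ∑ xs (λ x → ∑on d w cs U (F x))
        ∑on-∑ []            xs F = refl
        ∑on-∑ (inside ∷ U)  xs F =
          trans (∑-cong cs λ c → trans (cong (w c *_) (∑on-∑ U xs (λ x → F x ∘ (c ∷_)))) (sym (∑-*ˡ xs (w c) _)))
                (∑-swap cs xs _)
        ∑on-∑ (outside ∷ U) xs F = ∑on-∑ U xs (λ x → F x ∘ (d ∷_))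

        -- The distributive law. It turns a sum over labellings into a product over vertices, where
        -- a cancellation can be seen at a single vertex.
        ∑on-∏ : ∀ {n} (U : Subset n) (g : Fin n → A → Carrier) →
          ∑on d w cs U (λ κ → ∏ n (λ v → g v (lookup κ v))) ≡
          ∏ n (λ v → if lookup U v then ∑ cs (λ c → w c * g v c) else g v d)
        ∑on-∏ []            g = refl
        ∑on-∏ (inside ∷ U)  g =
          trans (∑-cong cs λ c →
            trans (cong (w c *_) (trans (∑on-*ˡ U (g zero c) _) (cong (g zero c *_) (∑on-∏ U (g ∘ suc)))))
                  (sym (*-assoc (w c) _ _)))
            (∑-*ʳ cs _ _)
        ∑on-∏ (outside ∷ U) g = trans (∑on-*ˡ U (g zero d) _) (cong (g zero d *_) (∑on-∏ U (g ∘ suc)))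

        ∑-allVecs : ∀ {n} (F : Vec A n → Carrier) →
          ∑ (allVecs cs n) (λ κ → ∏ n (λ v → w (lookup κ v)) * F κ) ≡ ∑on d w cs ⊤ F
        ∑-allVecs {zero}  F = trans (+-identityʳ _) (*-identityˡ _)
        ∑-allVecs {suc n} F =
          trans (∑-cartesianProductWith _∷_ cs (allVecs cs n) _)
                (∑-cong cs λ c →
                  trans (∑-cong (allVecs cs n) λ κ → *-assoc (w c) _ (F (c ∷ κ)))
                    (trans (∑-*ˡ (allVecs cs n) (w c) _)
                           (cong (w c *_) (∑-allVecs (F ∘ (c ∷_))))))

    ∑-∏ : ∀ {A : Set} (cs : List A) n (w : Fin n → A → Carrier) →
      ∑ (allVecs cs n) (λ κ → ∏ n (λ i → w i (lookup κ i))) ≡ ∏ n (λ i → ∑ cs (w i))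
    ∑-∏ cs zero    w = +-identityʳ 1#
    ∑-∏ cs (suc n) w =
      trans (∑-cartesianProductWith _∷_ cs (allVecs cs n) _)
      (trans (∑-cong cs λ c → trans (∑-*ˡ (allVecs cs n) (w zero c) _) (cong (w zero c *_) (∑-∏ cs n (w ∘ suc))))
             (∑-*ʳ cs _ _))

    ∑on-singleton : ∀ {A : Set} {n} (d : A) w (U : Subset n) F →
      ∑on d w (d ∷ []) U F ≡ ∏ n (λ v → if lookup U v then w d else 1#) * F (replicate n d)
    ∑on-singleton d w []            F = sym (*-identityˡ _)
    ∑on-singleton d w (inside ∷ U)  F =
      trans (+-identityʳ _) (trans (cong (w d *_) (∑on-singleton d w U (F ∘ (d ∷_)))) (sym (*-assoc (w d) _ _)))
    ∑on-singleton d w (outside ∷ U) F =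
      trans (∑on-singleton d w U (F ∘ (d ∷_))) (cong (_* _) (sym (*-identityˡ _)))

    -- H depends on the coordinates in D only, so the others can be summed out.
    ∑-localise : ∀ {A : Set} (cs : List A) (a₀ : A) {n} (D : Fin n → Set) (D? : ∀ i → Dec (D i))
      (w w′ : Fin n → A → Carrier) (k : Fin n → Carrier) (H : Vec A n → Carrier) →
      (∀ o o′ → (∀ i → D i → lookup o i ≡ lookup o′ i) → H o ≡ H o′) →
      (∀ i → D i → ∀ x → w i x ≡ k i * w′ i x) →
      (∀ i → ¬ D i → ∑ cs (w i) ≡ k i * ∑ cs (w′ i)) →
      ∑ (allVecs cs n) (λ o → ∏ n (λ i → w i (lookup o i)) * H o) ≡
      ∏ n k * ∑ (allVecs cs n) (λ o → ∏ n (λ i → w′ i (lookup o i)) * H o)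
    ∑-localise cs a₀ {zero}  D D? w w′ k H ext h₁ h₂ = sym (*-identityˡ _)
    ∑-localise cs a₀ {suc n} D D? w w′ k H ext h₁ h₂ =
      trans (split w)
      (trans (main (D? zero))
      (trans (pull (k zero) _ _) (cong (_ *_) (sym (split w′)))))
      where
      pull : ∀ a b c → (a * c) * b ≡ (a * b) * c
      pull = solve 3 (λ a b c → (a :* c) :* b := (a :* b) :* c) refl
      S : (Fin (suc n) → _ → Carrier) → (Vec _ n → Carrier) → Carrier
      S u H = ∑ (allVecs cs n) (λ o → ∏ n (λ i → u (suc i) (lookup o i)) * H o)
      split : ∀ u → ∑ (allVecs cs (suc n)) (λ o → ∏ (suc n) (λ i → u i (lookup o i)) * H o)
            ≡ ∑ cs (λ x → u zero x * S u (H ∘ (x ∷_)))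
      split u = trans (∑-cartesianProductWith _∷_ cs (allVecs cs n) _)
        (∑-cong cs λ x → trans (∑-cong (allVecs cs n) λ o → *-assoc (u zero x) _ _) (∑-*ˡ (allVecs cs n) (u zero x) _))
      ih : ∀ x → S w (H ∘ (x ∷_)) ≡ ∏ n (k ∘ suc) * S w′ (H ∘ (x ∷_))
      ih x = ∑-localise cs a₀ (D ∘ suc) (D? ∘ suc) (w ∘ suc) (w′ ∘ suc) (k ∘ suc) (H ∘ (x ∷_))
               (λ o o′ e → ext _ _ λ { zero _ → refl ; (suc i) d → e i d })
               (h₁ ∘ suc) (h₂ ∘ suc)
      pull′ : ∀ a b c d → (a * b) * (c * d) ≡ a * (b * d) * c
      pull′ = solve 4 (λ a b c d → (a :* b) :* (c :* d) := a :* (b :* d) :* c) refl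
      main : Dec (D zero) → ∑ cs (λ x → w zero x * S w (H ∘ (x ∷_)))
           ≡ (k zero * ∑ cs (λ x → w′ zero x * S w′ (H ∘ (x ∷_)))) * ∏ n (k ∘ suc)
      main (yes d) =
        trans (∑-cong cs λ x → trans (cong₂ _*_ (h₁ zero d x) (ih x)) (pull′ (k zero) _ _ _))
        (trans (∑-*ʳ cs _ _) (cong (_* ∏ n (k ∘ suc)) (∑-*ˡ cs (k zero) _)))
      -- Outside `D` the inner sum does not depend on the entry x, so its value at the arbitrary
      -- element `a₀` can be pulled out on both sides; only the totals of `w` and `w′` remain to be
      -- compared.
      main (no ¬d) =
        trans (∑-cong cs λ x → cong (w zero x *_) (trans (ih x) (cong (_ *_) (const x))))
        (trans (∑-*ʳ cs _ _)
        (trans (cong (_* (∏ n (k ∘ suc) * C)) (h₂ zero ¬d))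
        (trans (pull′ (k zero) _ _ _)
        (cong (_* ∏ n (k ∘ suc))
        (cong (k zero *_)
        (trans (sym (∑-*ʳ cs C (w′ zero))) (∑-cong cs λ x → cong (w′ zero x *_) (sym (const x)))))))))
        where
        C = S w′ (H ∘ (a₀ ∷_))
        const : ∀ x → S w′ (H ∘ (x ∷_)) ≡ C
        const x = ∑-cong (allVecs cs n) λ o → cong (_ *_)
          (ext _ _ λ { zero d → ⊥-elim (¬d d) ; (suc i) _ → refl })

    -- The D-th forward difference vanishes. Over the rationals these are the polynomials of degree
    -- below D, described here without coefficients or division.
    PolySeq : ℕ → (ℕ → Carrier) → Set
    PolySeq zero    f = ∀ j → f j ≡ 0#
    PolySeq (suc D) f = PolySeq D (λ j → f (suc j) - f j)

    PolySeq-cong : ∀ D {f g} → (∀ j → f j ≡ g j) → PolySeq D f → PolySeq D g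
    PolySeq-cong zero    h p = λ j → trans (sym (h j)) (p j)
    PolySeq-cong (suc D) h p   = PolySeq-cong D (λ j → cong₂ _-_ (h (suc j)) (h j)) p

    PolySeq-zero : ∀ D {f} → (∀ j → f j ≡ 0#) → PolySeq D f
    PolySeq-zero zero    h = h
    PolySeq-zero (suc D) h = PolySeq-zero D λ j → trans (cong₂ _-_ (h (suc j)) (h j)) (-‿inverseʳ 0#)

    PolySeq-≤ : ∀ {D D′ f} → D ℕ.≤ D′ → PolySeq D f → PolySeq D′ f
    PolySeq-≤ {D′ = D′} ℕ.z≤n p = PolySeq-zero D′ p
    PolySeq-≤ (ℕ.s≤s le) p = PolySeq-≤ le p

    PolySeq-+ : ∀ D {f g} → PolySeq D f → PolySeq D g → PolySeq D (λ j → f j + g j)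
    PolySeq-+ zero    p q = λ j → trans (cong₂ _+_ (p j) (q j)) (+-identityˡ 0#)
    PolySeq-+ (suc D) {f} {g} p q =
      PolySeq-cong D (λ j → lemma (f (suc j)) (f j) (g (suc j)) (g j)) (PolySeq-+ D p q)
      where
      lemma : ∀ a b c d → (a - b) + (c - d) ≡ (a + c) - (b + d)
      lemma a b c d = trans (interchange a (- b) c (- d)) (cong (a + c +_) (-‿+-comm b d))

    PolySeq-shift : ∀ D {f} → PolySeq D f → PolySeq D (f ∘ suc)
    PolySeq-shift zero    p = p ∘ suc
    PolySeq-shift (suc D) p = PolySeq-shift D p

    -- The Leibniz rule for differences: Δ(fg)(j) = Δf(j) g(j+1) + f(j) Δg(j). Each summand has one
    -- order less in one factor.
    PolySeq-* : ∀ D D′ {f g} → PolySeq D f → PolySeq D′ g → PolySeq (D ℕ.+ D′) (λ j → f j * g j)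
    PolySeq-* zero    D′ {f} {g} p q = PolySeq-zero D′ λ j → trans (cong (_* g j) (p j)) (zeroˡ (g j))
    PolySeq-* (suc D) zero {f} {g} p q = PolySeq-zero (suc D ℕ.+ zero) λ j → trans (cong (f j *_) (q j)) (zeroʳ (f j))
    PolySeq-* (suc D) (suc D′) {f} {g} p q =
      PolySeq-cong (D ℕ.+ suc D′) (λ j → lemma (f (suc j)) (f j) (g (suc j)) (g j))
        (PolySeq-+ (D ℕ.+ suc D′)
          (PolySeq-* D (suc D′) p (PolySeq-shift (suc D′) q))
          (subst (λ m → PolySeq m (λ j → f j * (g (suc j) - g j))) (sym (ℕ.+-suc D D′)) (PolySeq-* (suc D) D′ p q)))
      where
      lemma : ∀ a b c d → (a - b) * c + b * (c - d) ≡ a * c - b * d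
      lemma a b c d = trans (regroup a b (- b) c d)
        (trans (cong (λ x → x * c + (a * c - b * d)) (-‿inverseʳ b))
        (trans (cong (_+ (a * c - b * d)) (zeroˡ c)) (+-identityˡ _)))
        where
        regroup′ : ∀ a b b′ c d′ → (a + b′) * c + b * (c + d′) ≡ (b + b′) * c + (a * c + b * d′)
        regroup′ = solve 5 (λ a b b′ c d′ → (a :+ b′) :* c :+ b :* (c :+ d′) := (b :+ b′) :* c :+ (a :* c :+ b :* d′)) refl
        regroup : ∀ a b b′ c d → (a + b′) * c + b * (c - d) ≡ (b + b′) * c + (a * c - b * d)
        regroup a b b′ c d = trans (regroup′ a b b′ c (- d)) (cong (λ x → (b + b′) * c + (a * c + x)) (sym (-‿distribʳ-* b d)))

    PolySeq-const : ∀ c → PolySeq 1 (λ _ → c)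
    PolySeq-const c j = -‿inverseʳ c

    -- Extrapolation backwards: Δf vanishes at positive arguments too, so Δf(0) = 0 by induction on
    -- D, and f(0) = f(1) - Δf(0) = 0. This takes the place of the bound on the number of roots and
    -- holds over every commutative ring.
    PolySeq-vanish : ∀ D {f} → PolySeq D f → (∀ j → f (suc j) ≡ 0#) → f 0 ≡ 0#
    PolySeq-vanish zero    p h = p 0
    PolySeq-vanish (suc D) {f} p h = begin
      f 0                   ≡⟨ sym (+-identityʳ (f 0)) ⟩
      f 0 + 0#              ≡⟨ cong (f 0 +_) (sym (PolySeq-vanish D p λ j → trans (cong₂ _-_ (h (suc j)) (h j)) (-‿inverseʳ 0#))) ⟩
      f 0 + (f 1 - f 0)     ≡⟨ regroup (f 0) (f 1) (- f 0) ⟩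
      (f 0 - f 0) + f 1     ≡⟨ cong₂ _+_ (-‿inverseʳ (f 0)) (h 0) ⟩
      0# + 0#               ≡⟨ +-identityˡ 0# ⟩
      0#                    ∎
      where
      open ≡-Reasoning
      regroup : ∀ a b c → a + (b + c) ≡ (a + c) + b
      regroup = solve 3 (λ a b c → a :+ (b :+ c) := (a :+ c) :+ b) refl

    IsPoly : (ℕ → Carrier) → Set
    IsPoly f = ∃[ D ] PolySeq D f

    IsPoly-cong : ∀ {f g} → (∀ j → f j ≡ g j) → IsPoly f → IsPoly g
    IsPoly-cong h (D , p) = D , PolySeq-cong D h p

    IsPoly-+ : ∀ {f g} → IsPoly f → IsPoly g → IsPoly (λ j → f j + g j)
    IsPoly-+ (D , p) (D′ , q) =
      D ℕ.⊔ D′ , PolySeq-+ (D ℕ.⊔ D′) (PolySeq-≤ (ℕ.m≤m⊔n D D′) p) (PolySeq-≤ (ℕ.m≤n⊔m D D′) q)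

    IsPoly-* : ∀ {f g} → IsPoly f → IsPoly g → IsPoly (λ j → f j * g j)
    IsPoly-* (D , p) (D′ , q) = D ℕ.+ D′ , PolySeq-* D D′ p q

    IsPoly-const : ∀ c → IsPoly (λ _ → c)
    IsPoly-const c = 1 , PolySeq-const c

    IsPoly-∑ : ∀ {A : Set} (xs : List A) {f : ℕ → A → Carrier} → (∀ x → IsPoly (λ j → f j x)) → IsPoly (λ j → ∑ xs (f j))
    IsPoly-∑ []       h = IsPoly-const 0#
    IsPoly-∑ (x ∷ xs) h = IsPoly-+ (h x) (IsPoly-∑ xs h)

    IsPoly-agree : ∀ {f g} → IsPoly f → IsPoly g → (∀ j → f (suc j) ≡ g (suc j)) → f 0 ≡ g 0
    IsPoly-agree {f} {g} p q eq = begin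
      f 0                         ≡⟨ sym (+-identityʳ (f 0)) ⟩
      f 0 + 0#                    ≡⟨ cong (f 0 +_) (sym (-‿inverseˡ (g 0))) ⟩
      f 0 + (- g 0 + g 0)         ≡⟨ sym (+-assoc (f 0) (- g 0) (g 0)) ⟩
      (f 0 - g 0) + g 0           ≡⟨ cong (_+ g 0) (trans (cong (f 0 +_) (sym (-1* (g 0)))) vanishes) ⟩
      0# + g 0                    ≡⟨ +-identityˡ (g 0) ⟩
      g 0                         ∎
      where
      open ≡-Reasoning
      -1* : ∀ x → - 1# * x ≡ - x
      -1* x = trans (sym (-‿distribˡ-* 1# x)) (cong -_ (*-identityˡ x))
      difference = IsPoly-+ p (IsPoly-* (IsPoly-const (- 1#)) q)
      vanishes : f 0 + - 1# * g 0 ≡ 0#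
      vanishes = PolySeq-vanish (proj₁ difference) (proj₂ difference) λ j →
        trans (cong₂ _+_ (eq j) (-1* (g (suc j)))) (-‿inverseʳ (g (suc j)))

-- Acyclic orientations with prescribed sinks and sources.

module OrientationCounting where

  open CommutativeRings
  open WeightedSums
  open import Data.Bool.Base using (Bool; true; false; if_then_else_; T; _∧_)
  open import Data.Bool.Properties using (T-∧)
  open import Data.Empty using (⊥-elim)
  open import Data.Fin.Base using (Fin; zero; suc)
  import Data.Fin.Properties as Fin
  open import Data.Fin.Subset using (Subset; inside; _∈_; _⊆_; Nonempty)
  open import Data.Fin.Subset.Properties using (_∈?_; _⊆?_; nonempty?; anySubset?)
  open import Data.List.Base using (List; []; _∷_)
  open import Data.Product using (_×_; _,_; proj₁; proj₂; ∃-syntax)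
  open import Data.Sign.Base using (Sign)
  open import Data.Sum.Base using (_⊎_; inj₁; inj₂)
  open import Data.Unit.Base using (tt) renaming (⊤ to Unit)
  open import Data.Nat.Base using (zero; suc)
  open import Data.Vec.Base using (Vec; []; _∷_; lookup; zipWith; tabulate; here; there)
  open import Data.Vec.Properties using ([]=⇒lookup; lookup⇒[]=; lookup∘tabulate)
  open import Function.Base using (_∘_; id)
  open import Function.Bundles using (Equivalence)
  open import Relation.Binary.PropositionalEquality
  open import Relation.Nullary
  open import Relation.Nullary.Decidable using (_×-dec_; _⊎-dec_; _→-dec_; T?)
  open import Defs using (SignedGraph; Arrow; toward; away; allVecs)

  infix 4 _≟ᴬ_
  _≟ᴬ_ : (a b : Arrow) → Dec (a ≡ b)
  toward ≟ᴬ toward = yes refl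
  toward ≟ᴬ away   = no λ ()
  away   ≟ᴬ toward = no λ ()
  away   ≟ᴬ away   = yes refl

  partner : Sign → Arrow → Arrow
  partner Sign.+ toward = away
  partner Sign.+ away   = toward
  partner Sign.- a      = a

  -- An orientation is determined by its arrows at the half-edges numbered zero.
  arrowAt : Sign → Arrow → Fin 2 → Arrow
  arrowAt s a zero    = a
  arrowAt s a (suc _) = partner s a

  -- A mark imposes a condition: for orientations, no outgoing arrow (`sink`) or no incoming arrow
  -- (`source`); for colourings, the largest or the smallest colour. Several labels may fit the same
  -- vertex of an orientation, as inclusion-exclusion requires.
  data Label : Set where
    free sink source : Label

  labels : List Label
  labels = free ∷ sink ∷ source ∷ []

  isFree : Label → Bool
  isFree free   = true
  isFree sink   = false
  isFree source = false

  freeIn : ∀ {n} → Subset n → Vec Label n → Subset n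
  freeIn = zipWith λ u x → u ∧ isFree x

  ∈-freeIn⁻ : ∀ {n} {U : Subset n} {σ v} → v ∈ freeIn U σ → v ∈ U × lookup σ v ≡ free
  ∈-freeIn⁻ {U = inside ∷ U} {free ∷ σ} {zero}  here       = here , refl
  ∈-freeIn⁻ {U = _ ∷ U}      {_ ∷ σ}    {suc v} (there v∈) with ∈-freeIn⁻ v∈
  ... | v∈U , eq = there v∈U , eq

  ∈-freeIn⁺ : ∀ {n} {U : Subset n} {σ v} → v ∈ U → lookup σ v ≡ free → v ∈ freeIn U σ
  ∈-freeIn⁺ {σ = free ∷ σ} here       refl = here
  ∈-freeIn⁺ {σ = _ ∷ σ}    (there v∈) eq   = there (∈-freeIn⁺ v∈ eq)

  agree : Label → Arrow → Bool
  agree free   _      = true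
  agree sink   toward = true
  agree sink   away   = false
  agree source toward = false
  agree source away   = true

  -- With colours ±c on the vertices labelled sink and source, the edge is violated.
  clash : Sign → Label → Label → Bool
  clash Sign.+ sink   sink   = true
  clash Sign.+ source source = true
  clash Sign.- sink   source = true
  clash Sign.- source sink   = true
  clash _      _      _      = false

  clash-freeˡ : ∀ s y → clash s free y ≡ false
  clash-freeˡ Sign.+ _ = refl
  clash-freeˡ Sign.- _ = refl

  clash-freeʳ : ∀ s x → clash s x free ≡ false
  clash-freeʳ Sign.+ free   = refl
  clash-freeʳ Sign.+ sink   = refl
  clash-freeʳ Sign.+ source = refl
  clash-freeʳ Sign.- free   = refl
  clash-freeʳ Sign.- sink   = refl
  clash-freeʳ Sign.- source = refl

  admits : Sign → Label → Label → Arrow → Bool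
  admits s x y a = agree x a ∧ agree y (partner s a)

  -- An edge with a labelled end has a unique admissible orientation unless the labels clash; its arrow at the
  -- half-edge numbered zero points towards the vertex (in₀) or away from it (out₀).
  data Forced (s : Sign) (x y : Label) : Set where
    none : clash s x y ≡ true  → admits s x y toward ≡ false → admits s x y away ≡ false → Forced s x y
    in₀  : clash s x y ≡ false → admits s x y toward ≡ true  → admits s x y away ≡ false → Forced s x y
    out₀ : clash s x y ≡ false → admits s x y toward ≡ false → admits s x y away ≡ true  → Forced s x y

  forced : ∀ s x y → ¬ (x ≡ free × y ≡ free) → Forced s x y
  forced s      free   free   h = ⊥-elim (h (refl , refl))
  forced Sign.+ free   sink   _ = out₀ refl refl refl
  forced Sign.+ free   source _ = in₀  refl refl refl
  forced Sign.+ sink   free   _ = in₀  refl refl refl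
  forced Sign.+ sink   sink   _ = none refl refl refl
  forced Sign.+ sink   source _ = in₀  refl refl refl
  forced Sign.+ source free   _ = out₀ refl refl refl
  forced Sign.+ source sink   _ = out₀ refl refl refl
  forced Sign.+ source source _ = none refl refl refl
  forced Sign.- free   sink   _ = in₀  refl refl refl
  forced Sign.- free   source _ = out₀ refl refl refl
  forced Sign.- sink   free   _ = in₀  refl refl refl
  forced Sign.- sink   sink   _ = in₀  refl refl refl
  forced Sign.- sink   source _ = none refl refl refl
  forced Sign.- source free   _ = out₀ refl refl refl
  forced Sign.- source sink   _ = none refl refl refl
  forced Sign.- source source _ = out₀ refl refl refl

  ≢away⇒toward : ∀ {a} → a ≢ away → a ≡ toward
  ≢away⇒toward {toward} _ = refl
  ≢away⇒toward {away}   h = ⊥-elim (h refl)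

  ≢toward⇒away : ∀ {a} → a ≢ toward → a ≡ away
  ≢toward⇒away {away}   _ = refl
  ≢toward⇒away {toward} h = ⊥-elim (h refl)

  ⟪_⟫ : ∀ {n} {P : Fin n → Set} → (∀ v → Dec (P v)) → Subset n
  ⟪ P? ⟫ = tabulate (does ∘ P?)

  ∈⟪⟫⁻ : ∀ {n} {P : Fin n → Set} (P? : ∀ v → Dec (P v)) {v} → v ∈ ⟪ P? ⟫ → P v
  ∈⟪⟫⁻ P? {v} v∈ with P? v | trans (sym (lookup∘tabulate (does ∘ P?) v)) ([]=⇒lookup v∈)
  ... | yes p | _ = p

  ∈⟪⟫⁺ : ∀ {n} {P : Fin n → Set} (P? : ∀ v → Dec (P v)) {v} → P v → v ∈ ⟪ P? ⟫
  ∈⟪⟫⁺ P? {v} p = lookup⇒[]= v ⟪ P? ⟫ (trans (lookup∘tabulate (does ∘ P?) v) (lemma (P? v)))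
    where
    lemma : ∀ d → does d ≡ true
    lemma (yes _) = refl
    lemma (no ¬p) = ⊥-elim (¬p p)

  module Orientations (G : SignedGraph) where
    open SignedGraph G

    Inside : Subset #V → Edge → Set
    Inside U e = ∀ h → end e h ∈ U

    abstract
      inside? : ∀ U e → Dec (Inside U e)
      inside? U e = Fin.all? λ h → end e h ∈? U

    NoEdges : Subset #V → Set
    NoEdges U = ∀ e → ¬ Inside U e

    abstract
      noEdges? : ∀ U → Dec (NoEdges U)
      noEdges? U = Fin.all? λ e → ¬? (inside? U e)

    Orientation : Set
    Orientation = Vec Arrow #E

    arrow′ : Orientation → Edge → Fin 2 → Arrow
    arrow′ o e = arrowAt (sgn e) (lookup o e)

    Has : Subset #V → Orientation → Vertex → Arrow → Set
    Has W o v d = ∃[ e ] ∃[ h ] Inside W e × end e h ≡ v × arrow′ o e h ≡ d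

    abstract
      has? : ∀ W o v d → Dec (Has W o v d)
      has? W o v d = Fin.any? λ e → Fin.any? λ h →
        inside? W e ×-dec (end e h Fin.≟ v) ×-dec (arrow′ o e h ≟ᴬ d)

    Has-⊆ : ∀ {W U o v d} → W ⊆ U → Has W o v d → Has U o v d
    Has-⊆ W⊆U (e , h , e∈ , v≡ , d≡) = e , h , W⊆U ∘ e∈ , v≡ , d≡

    -- Walks may use edges in either direction and repeat them, so a cycle amounts to a vertex set W all of whose
    -- vertices have arrows of both kinds on edges inside W.
    Cyclic : Subset #V → Orientation → Set
    Cyclic U o = ∃[ W ] W ⊆ U × Nonempty W × (∀ v → v ∈ W → Has W o v toward × Has W o v away)

    abstract
      cyclic? : ∀ U o → Dec (Cyclic U o)
      cyclic? U o = anySubset? λ W → (W ⊆? U) ×-dec nonempty? W ×-dec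
        Fin.all? λ v → (v ∈? W) →-dec (has? W o v toward ×-dec has? W o v away)

    -- A vertex without edges inside U matches `sink` as well as `source`. This double count
    -- produces the factor 1 - 1 - 1 in `transfer-signs`.
    Matches : Subset #V → Orientation → Vertex → Label → Set
    Matches U o v free   = Unit
    Matches U o v sink   = ¬ Has U o v away
    Matches U o v source = ¬ Has U o v toward

    matches? : ∀ U o v x → Dec (Matches U o v x)
    matches? U o v free   = yes tt
    matches? U o v sink   = ¬? (has? U o v away)
    matches? U o v source = ¬? (has? U o v toward)

    MatchesAll : Subset #V → Orientation → Vec Label #V → Set
    MatchesAll U o σ = ∀ v → Matches U o v (lookup σ v)

    abstract
      matchesAll? : ∀ U o σ → Dec (MatchesAll U o σ)
      matchesAll? U o σ = Fin.all? λ v → matches? U o v (lookup σ v)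

    -- Each vertex of a cyclic set has arrows of both kinds, so none of them is labelled `sink` or
    -- `source`; the same set W serves as witness.
    cyclic-freeIn : ∀ {U o σ} → MatchesAll U o σ → Cyclic U o → Cyclic (freeIn U σ) o
    cyclic-freeIn {U} {o} {σ} m (W , W⊆U , ne , mixed) =
      W , (λ {v} v∈W → ∈-freeIn⁺ (W⊆U v∈W) (isfree (lookup σ v) (m v) (mixed v v∈W))) , ne , mixed
      where
      isfree : ∀ {v} x → Matches U o v x → Has W o v toward × Has W o v away → x ≡ free
      isfree free   _ _           = refl
      isfree sink   ¬h (_ , h) = ⊥-elim (¬h (Has-⊆ {o = o} W⊆U h))
      isfree source ¬h (h , _) = ⊥-elim (¬h (Has-⊆ {o = o} W⊆U h))

    cyclic-mono : ∀ {U U′ o} → U′ ⊆ U → Cyclic U′ o → Cyclic U o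
    cyclic-mono U′⊆U (W , W⊆U′ , r) = W , U′⊆U ∘ W⊆U′ , r

    cyclic-local : ∀ {U o o′} → (∀ e → Inside U e → lookup o e ≡ lookup o′ e) → Cyclic U o → Cyclic U o′
    cyclic-local {U} {o} {o′} eq (W , W⊆U , ne , mixed) =
      W , W⊆U , ne , λ v v∈ → move (proj₁ (mixed v v∈)) , move (proj₂ (mixed v v∈))
      where
      move : ∀ {v d} → Has W o v d → Has W o′ v d
      move (e , h , e∈ , v≡ , d≡) =
        e , h , e∈ , v≡ , trans (cong (λ a → arrowAt (sgn e) a h) (sym (eq e (W⊆U ∘ e∈)))) d≡

    -- The vertex conditions of `Matches` rewritten edge by edge, so that the sum over orientations
    -- can be taken one edge at a time.
    Allows : Subset #V → Vec Label #V → Edge → Arrow → Set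
    Allows U σ e a = Inside U e → T (admits (sgn e) (lookup σ (end e zero)) (lookup σ (end e (suc zero))) a)

    abstract
      allows? : ∀ U σ e a → Dec (Allows U σ e a)
      allows? U σ e a = inside? U e →-dec T? _

    matches⇒allows : ∀ {U o σ} → MatchesAll U o σ → ∀ e → Allows U σ e (lookup o e)
    matches⇒allows {U} {o} {σ} m e e∈ = Equivalence.from T-∧ (agrees zero , agrees (suc zero))
      where
      step : ∀ x a v → Matches U o v x → (∀ {d} → a ≡ d → Has U o v d) → T (agree x a)
      step free   a      v _  _ = tt
      step sink   toward v _  _ = tt
      step sink   away   v ¬h f = ⊥-elim (¬h (f refl))
      step source toward v ¬h f = ⊥-elim (¬h (f refl))
      step source away   v _  _ = tt
      agrees : ∀ h → T (agree (lookup σ (end e h)) (arrow′ o e h))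
      agrees h = step _ _ (end e h) (m (end e h)) λ d≡ → e , h , e∈ , refl , d≡

    allows⇒matches : ∀ {U o σ} → (∀ e → Allows U σ e (lookup o e)) → MatchesAll U o σ
    allows⇒matches {U} {o} {σ} al v = build (lookup σ v) refl
      where
      agrees : ∀ e h → Inside U e → T (agree (lookup σ (end e h)) (arrow′ o e h))
      agrees e zero       e∈ = proj₁ (Equivalence.to T-∧ (al e e∈))
      agrees e (suc zero) e∈ = proj₂ (Equivalence.to T-∧ (al e e∈))
      build : ∀ x → lookup σ v ≡ x → Matches U o v x
      build free   eq = tt
      build sink   eq (e , h , e∈ , refl , d≡) = subst₂ (λ x a → T (agree x a)) eq d≡ (agrees e h e∈)
      build source eq (e , h , e∈ , refl , d≡) = subst₂ (λ x a → T (agree x a)) eq d≡ (agrees e h e∈)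

    Extremal : Subset #V → Orientation → Vertex → Set
    Extremal U o v = v ∈ U × (Has U o v toward × ¬ Has U o v away ⊎ Has U o v away × ¬ Has U o v toward)

    abstract
      extremal? : ∀ U o v → Dec (Extremal U o v)
      extremal? U o v = (v ∈? U) ×-dec ((has? U o v toward ×-dec ¬? (has? U o v away)) ⊎-dec
                                        (has? U o v away ×-dec ¬? (has? U o v toward)))

    -- Otherwise the non-isolated vertices of U would witness that o is cyclic.
    extremal : ∀ {U o} e → Inside U e → ¬ Cyclic U o → ∃[ v ] Extremal U o v
    extremal {U} {o} e e∈ ¬cyc with Fin.any? (extremal? U o)
    ... | yes ex = ex
    ... | no ¬ex = ⊥-elim (¬cyc (W , (λ v∈ → proj₁ (∈⟪⟫⁻ touched? v∈)) , (end e zero , end∈W e∈ zero) , mixed))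
      where
      Touched : Vertex → Set
      Touched v = v ∈ U × (Has U o v toward ⊎ Has U o v away)
      touched? : ∀ v → Dec (Touched v)
      touched? v = (v ∈? U) ×-dec (has? U o v toward ⊎-dec has? U o v away)
      W : Subset #V
      W = ⟪ touched? ⟫
      end∈W : ∀ {e} → Inside U e → Inside W e
      end∈W {e} e∈ h = ∈⟪⟫⁺ touched? (e∈ h , split (arrow′ o e h) refl)
        where
        split : ∀ a → arrow′ o e h ≡ a → Has U o (end e h) toward ⊎ Has U o (end e h) away
        split toward eq = inj₁ (e , h , e∈ , refl , eq)
        split away   eq = inj₂ (e , h , e∈ , refl , eq)
      shrink : ∀ {v d} → Has U o v d → Has W o v d
      shrink (e , h , e∈ , r) = e , h , end∈W e∈ , r
      mixed : ∀ v → v ∈ W → Has W o v toward × Has W o v away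
      mixed v v∈ with ∈⟪⟫⁻ touched? v∈ | has? U o v toward | has? U o v away
      ... | v∈U , _      | yes t | yes a = shrink t , shrink a
      ... | v∈U , _      | yes t | no ¬a = ⊥-elim (¬ex (v , v∈U , inj₁ (t , ¬a)))
      ... | v∈U , _      | no ¬t | yes a = ⊥-elim (¬ex (v , v∈U , inj₂ (a , ¬t)))
      ... | v∈U , inj₁ t | no ¬t | no ¬a = ⊥-elim (¬t t)
      ... | v∈U , inj₂ a | no ¬t | no ¬a = ⊥-elim (¬a a)

    module Counting (R : Ring≡) where
      open Ring≡ R
      open Sums R
      open SubsetSums R

      arrows : List Arrow
      arrows = toward ∷ away ∷ []

      -- Edges not inside U carry a conventional orientation, so that every orientation of
      -- the subgraph induced by U is counted once.
      abstract
        default? : ∀ U e a → Dec (Inside U e ⊎ a ≡ toward)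
        default? U e a = inside? U e ⊎-dec a ≟ᴬ toward

      𝟙-matchesAll : ∀ U o σ → 𝟙 (matchesAll? U o σ) ≡ ∏ #V (λ v → 𝟙 (matches? U o v (lookup σ v)))
      𝟙-matchesAll U o σ = sym (trans (∏-𝟙 M?) (𝟙-⇔ (Fin.all? M?) (matchesAll? U o σ) id id))
        where
        M? = λ v → matches? U o v (lookup σ v)

      ∑o : Subset #V → (Orientation → Carrier) → Carrier
      ∑o U F = ∑ (allVecs arrows #E) λ o → ∏ #E (λ e → 𝟙 (default? U e (lookup o e))) * F o

      acyclics : Subset #V → Carrier
      acyclics U = ∑o U λ o → 𝟙 (¬? (cyclic? U o))

      noClash? : ∀ (σ : Vec Label #V) e → Dec (¬ T (clash (sgn e) (lookup σ (end e zero)) (lookup σ (end e (suc zero)))))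
      noClash? σ e = ¬? (T? _)

      noClashes : Vec Label #V → Carrier
      noClashes σ = ∏ #E λ e → 𝟙 (noClash? σ e)

      private
        -- This and the next three identities compare totals over the two arrows of one edge, in the
        -- shape to which `∑ arrows` unfolds. The factor in parentheses is the total of an edge
        -- outside the free part, where only the conventional arrow counts.
        sum-in : 1# * 1# + (1# * 0# + 0#) ≡ 1# * (1# + (0# + 0#))
        sum-in = trans (cong₂ _+_ (*-identityˡ 1#) (cong (_+ 0#) (zeroʳ 1#))) (sym (*-identityˡ _))

        sum-out : 1# * 0# + (1# * 1# + 0#) ≡ 1# * (1# + (0# + 0#))
        sum-out = trans (cong₂ _+_ (zeroʳ 1#) (cong (_+ 0#) (*-identityˡ 1#)))
          (trans (+-identityˡ _) (trans (cong (1# +_) (sym (+-identityˡ 0#))) (sym (*-identityˡ _))))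

        sum-none : 1# * 0# + (1# * 0# + 0#) ≡ 0# * (1# + (0# + 0#))
        sum-none = trans (cong₂ _+_ (zeroʳ 1#) (trans (+-identityʳ _) (zeroʳ 1#)))
          (trans (+-identityˡ 0#) (sym (zeroˡ _)))

        sum-outside : 1# * 1# + (0# * 1# + 0#) ≡ 1# * (1# + (0# + 0#))
        sum-outside = trans (cong (λ x → 1# * 1# + (x + 0#)) (zeroˡ 1#))
          (trans (cong (_+ (0# + 0#)) (*-identityˡ 1#)) (sym (*-identityˡ _)))

      -- The labelled vertices lie on no cycle, and the arrows on their edges are forced.
      ∑o-labelled : ∀ {U σ} → On free labels U σ →
        ∑o U (λ o → 𝟙 (¬? (cyclic? U o)) * 𝟙 (matchesAll? U o σ)) ≡ noClashes σ * acyclics (freeIn U σ)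
      ∑o-labelled {U} {σ} on =
        trans (∑-cong (allVecs arrows #E) summand)
          (∑-localise arrows toward (Inside U₀) (inside? U₀) w w′ k
            (λ o → 𝟙 (¬? (cyclic? U₀ o))) local inner outer)
        where
        U₀ = freeIn U σ
        x₀ x₁ : Edge → Label
        x₀ e = lookup σ (end e zero)
        x₁ e = lookup σ (end e (suc zero))
        -- `w` weighs the arrows of an edge in the labelled graph U, `w′` those in its free part,
        -- and `k` is the ratio of the two. It is 0 when the labels clash; otherwise it is 1,
        -- because the forced arrow of U is traded for the conventional one.
        w w′ : Edge → Arrow → Carrier
        w e a = 𝟙 (default? U e a) * 𝟙 (allows? U σ e a)
        w′ e a = 𝟙 (default? U₀ e a)
        k : Edge → Carrier
        k e = 𝟙 (noClash? σ e)
        U₀⊆U : U₀ ⊆ U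
        U₀⊆U v∈ = proj₁ (∈-freeIn⁻ v∈)

        match : ∀ o → 𝟙 (¬? (cyclic? U o)) * 𝟙 (matchesAll? U o σ)
                    ≡ ∏ #E (λ e → 𝟙 (allows? U σ e (lookup o e))) * 𝟙 (¬? (cyclic? U₀ o))
        match o with matchesAll? U o σ
        ... | yes m = begin
          𝟙 (¬? (cyclic? U o)) * 1#
            ≡⟨ *-comm _ 1# ⟩
          1# * 𝟙 (¬? (cyclic? U o))
            ≡⟨ cong₂ _*_ (sym (∏-1 #E λ e → 𝟙-true (allows? U σ e (lookup o e)) (matches⇒allows {U} {o} {σ} m e)))
                         (𝟙-⇔ (¬? (cyclic? U o)) (¬? (cyclic? U₀ o)) (_∘ cyclic-mono {o = o} U₀⊆U) (_∘ cyclic-freeIn {o = o} m)) ⟩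
          ∏ #E (λ e → 𝟙 (allows? U σ e (lookup o e))) * 𝟙 (¬? (cyclic? U₀ o))
            ∎
          where open ≡-Reasoning
        ... | no ¬m = begin
          𝟙 (¬? (cyclic? U o)) * 0#    ≡⟨ zeroʳ _ ⟩
          0#                            ≡⟨ sym (zeroˡ _) ⟩
          0# * 𝟙 (¬? (cyclic? U₀ o))    ≡⟨ cong (_* 𝟙 (¬? (cyclic? U₀ o))) (sym (𝟙-false (Fin.all? A?) (¬m ∘ allows⇒matches {U} {o} {σ}))) ⟩
          𝟙 (Fin.all? A?) * 𝟙 (¬? (cyclic? U₀ o)) ≡⟨ cong (_* 𝟙 (¬? (cyclic? U₀ o))) (sym (∏-𝟙 A?)) ⟩
          ∏ #E (λ e → 𝟙 (A? e)) * 𝟙 (¬? (cyclic? U₀ o)) ∎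
          where
          open ≡-Reasoning
          A? = λ e → allows? U σ e (lookup o e)

        summand : ∀ o → ∏ #E (λ e → 𝟙 (default? U e (lookup o e))) * (𝟙 (¬? (cyclic? U o)) * 𝟙 (matchesAll? U o σ))
                      ≡ ∏ #E (λ e → w e (lookup o e)) * 𝟙 (¬? (cyclic? U₀ o))
        summand o = trans (cong (∏ #E (λ e → 𝟙 (default? U e (lookup o e))) *_) (match o))
          (trans (sym (*-assoc _ _ _)) (cong (_* 𝟙 (¬? (cyclic? U₀ o))) (sym (∏-* #E _ _))))

        local : ∀ o o′ → (∀ e → Inside U₀ e → lookup o e ≡ lookup o′ e) →
                𝟙 (¬? (cyclic? U₀ o)) ≡ 𝟙 (¬? (cyclic? U₀ o′))
        local o o′ eq = 𝟙-⇔ (¬? (cyclic? U₀ o)) (¬? (cyclic? U₀ o′))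
          (_∘ cyclic-local {o = o′} {o} λ e e∈ → sym (eq e e∈)) (_∘ cyclic-local {o = o} {o′} eq)

        k-1 : ∀ e → clash (sgn e) (x₀ e) (x₁ e) ≡ false → k e ≡ 1#
        k-1 e eq = 𝟙-true (noClash? σ e) λ t → subst T eq t

        inner : ∀ e → Inside U₀ e → ∀ a → w e a ≡ k e * w′ e a
        inner e e∈ a = cong₂ _*_
          (trans (𝟙-true (default? U e a) (inj₁ (U₀⊆U ∘ e∈))) (sym (k-1 e noclash)))
          (trans (𝟙-true (allows? U σ e a) λ _ → subst₂ (λ x y → T (admits (sgn e) x y a)) (sym eq₀) (sym eq₁) tt)
                 (sym (𝟙-true (default? U₀ e a) (inj₁ e∈))))
          where
          eq₀ = proj₂ (∈-freeIn⁻ (e∈ zero))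
          eq₁ = proj₂ (∈-freeIn⁻ (e∈ (suc zero)))
          noclash : clash (sgn e) (x₀ e) (x₁ e) ≡ false
          noclash = trans (cong (λ x → clash (sgn e) x (x₁ e)) eq₀) (clash-freeˡ (sgn e) (x₁ e))

        total′ : ∀ e → ¬ Inside U₀ e → ∑ arrows (w′ e) ≡ 1# + (0# + 0#)
        total′ e e∉ = cong₂ _+_ (𝟙-true (default? U₀ e toward) (inj₂ refl))
          (cong (_+ 0#) (𝟙-false (default? U₀ e away) λ { (inj₁ e∈) → e∉ e∈ ; (inj₂ ()) }))

        outer : ∀ e → ¬ Inside U₀ e → ∑ arrows (w e) ≡ k e * ∑ arrows (w′ e)
        outer e e∉ = trans (go (inside? U e)) (cong (k e *_) (sym (total′ e e∉)))
          where
          go : Dec (Inside U e) → ∑ arrows (w e) ≡ k e * (1# + (0# + 0#))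
          go (yes e∈) = choose (forced (sgn e) (x₀ e) (x₁ e) λ (f₀ , f₁) →
                          e∉ λ { zero → ∈-freeIn⁺ (e∈ zero) f₀ ; (suc zero) → ∈-freeIn⁺ (e∈ (suc zero)) f₁ })
            where
            on-a : ∀ a {b} → admits (sgn e) (x₀ e) (x₁ e) a ≡ b → w e a ≡ 1# * (if b then 1# else 0#)
            on-a a refl = cong₂ _*_ (𝟙-true (default? U e a) (inj₁ e∈))
              (𝟙-⇔ (allows? U σ e a) (T? (admits (sgn e) (x₀ e) (x₁ e) a)) (λ f → f e∈) λ t _ → t)
            choose : Forced (sgn e) (x₀ e) (x₁ e) → ∑ arrows (w e) ≡ k e * (1# + (0# + 0#))
            choose (none c t a) = trans (cong₂ (λ p q → p + (q + 0#)) (on-a toward t) (on-a away a))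
              (trans sum-none (cong (_* (1# + (0# + 0#))) (sym (𝟙-false (noClash? σ e) λ ¬t → ¬t (subst T (sym c) tt)))))
            choose (in₀ c t a)  = trans (cong₂ (λ p q → p + (q + 0#)) (on-a toward t) (on-a away a))
              (trans sum-in (cong (_* (1# + (0# + 0#))) (sym (k-1 e c))))
            choose (out₀ c t a) = trans (cong₂ (λ p q → p + (q + 0#)) (on-a toward t) (on-a away a))
              (trans sum-out (cong (_* (1# + (0# + 0#))) (sym (k-1 e c))))
          -- Some end of e lies outside U and carries the default label `free`; hence nothing
          -- clashes, and the conventional arrow is the only one counted in U as well.
          go (no e∉U) = trans (cong₂ (λ p q → p + (q + 0#))
              (cong₂ _*_ (𝟙-true (default? U e toward) (inj₂ refl)) (vacuous toward))
              (cong₂ _*_ (𝟙-false (default? U e away) λ { (inj₁ e∈) → e∉U e∈ ; (inj₂ ()) }) (vacuous away)))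
            (trans sum-outside (cong (_* (1# + (0# + 0#))) (sym (k-1 e noclash))))
            where
            vacuous : ∀ a → 𝟙 (allows? U σ e a) ≡ 1#
            vacuous a = 𝟙-true (allows? U σ e a) (⊥-elim ∘ e∉U)
            noclash : clash (sgn e) (x₀ e) (x₁ e) ≡ false
            noclash with end e zero ∈? U | end e (suc zero) ∈? U
            ... | no v∉ | _ = trans (cong (λ x → clash (sgn e) x (x₁ e)) (On-outside free labels on _ v∉)) (clash-freeˡ (sgn e) (x₁ e))
            ... | yes _ | no v∉ = trans (cong (clash (sgn e) (x₀ e)) (On-outside free labels on _ v∉)) (clash-freeʳ (sgn e) (x₀ e))
            ... | yes v∈ | yes v∈′ = ⊥-elim (e∉U λ { zero → v∈ ; (suc zero) → v∈′ })

      -- One layer of the recursion. On counts of colourings it adds two extreme colours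
      -- (`colourings-layer`); on `acyclics` it prescribes sinks and sources (`transfer-acyclics`).
      transfer : (Label → Carrier) → (Subset #V → Carrier) → Subset #V → Carrier
      transfer y f U = ∑on free y labels U λ σ → noClashes σ * f (freeIn U σ)

      -- By `∑o-labelled`, read from right to left, clash-free labels together with an acyclic
      -- orientation of the free part amount to an acyclic orientation of U that matches the labels.
      -- Once the orientation is fixed, the labels at different vertices are independent and the sum
      -- factors.
      transfer-acyclics : ∀ y U → transfer y acyclics U ≡
        ∑o U (λ o → 𝟙 (¬? (cyclic? U o)) *
          ∏ #V (λ v → if lookup U v then ∑ labels (λ x → y x * 𝟙 (matches? U o v x)) else 1#))
      transfer-acyclics y U =
        trans (∑on-cong free {w = y} labels U (λ _ → refl) (sym ∘ ∑o-labelled))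
        (trans (∑on-∑ free y labels U (allVecs arrows #E) _)
          (∑-cong (allVecs arrows #E) λ o →
            trans (∑on-*ˡ free y labels U _ _)
            (cong (∏ #E (λ e → 𝟙 (default? U e (lookup o e))) *_)
            (trans (∑on-*ˡ free y labels U _ _)
            (cong (𝟙 (¬? (cyclic? U o)) *_)
            (trans (∑on-cong free {w = y} labels U (λ _ → refl) λ {σ} _ → 𝟙-matchesAll U o σ)
                   (∑on-∏ free y labels U λ v x → 𝟙 (matches? U o v x))))))))

      -- -1 is at once the sign of inclusion-exclusion and the value of the variables belonging to
      -- the ordinary colours. `signedCount` rests on this coincidence.
      signs : Label → Carrier
      signs free   = 1#
      signs sink   = - 1#
      signs source = - 1#

      -- The factor 1 - [sink] - [source] vanishes at an extremal vertex, so only edgeless U contribute.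
      transfer-signs : ∀ U → transfer signs acyclics U ≡
        ∏ #V (λ v → if lookup U v then - 1# else 1#) * 𝟙 (noEdges? U)
      transfer-signs U = trans (transfer-acyclics signs U) (go (noEdges? U))
        where
        os = allVecs arrows #E
        factor : Orientation → Vertex → Carrier
        factor o v = ∑ labels (λ x → signs x * 𝟙 (matches? U o v x))
        Π : Orientation → Carrier
        Π o = ∏ #V λ v → if lookup U v then factor o v else 1#
        negs = ∏ #V (λ v → if lookup U v then - 1# else 1#)

        one-end : ∀ o v → Has U o v toward × ¬ Has U o v away ⊎ Has U o v away × ¬ Has U o v toward → factor o v ≡ 0#
        one-end o v (inj₁ (t , ¬a)) = trans
          (cong₂ (λ p q → 1# * 1# + (- 1# * p + (- 1# * q + 0#)))
            (𝟙-true (matches? U o v sink) ¬a) (𝟙-false (matches? U o v source) λ ¬t → ¬t t))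
          (trans (cong₂ _+_ (*-identityˡ 1#) (trans (cong₂ _+_ (*-identityʳ (- 1#)) (trans (+-identityʳ _) (zeroʳ _))) (+-identityʳ _)))
                 (-‿inverseʳ 1#))
        one-end o v (inj₂ (a , ¬t)) = trans
          (cong₂ (λ p q → 1# * 1# + (- 1# * p + (- 1# * q + 0#)))
            (𝟙-false (matches? U o v sink) λ ¬a → ¬a a) (𝟙-true (matches? U o v source) ¬t))
          (trans (cong₂ _+_ (*-identityˡ 1#) (trans (cong₂ _+_ (zeroʳ (- 1#)) (trans (+-identityʳ _) (*-identityʳ _))) (+-identityˡ _)))
                 (-‿inverseʳ 1#))

        -- Without edges both conditions hold at every vertex, and 1 - 1 - 1 = -1.
        no-end : NoEdges U → ∀ o v → factor o v ≡ - 1#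
        no-end ne o v = trans
          (cong₂ (λ p q → 1# * 1# + (- 1# * p + (- 1# * q + 0#)))
            (𝟙-true (matches? U o v sink) λ (e , _ , e∈ , _) → ne e e∈) (𝟙-true (matches? U o v source) λ (e , _ , e∈ , _) → ne e e∈))
          (trans (sym (+-assoc _ _ _))
          (trans (cong₂ _+_ (trans (cong₂ _+_ (*-identityˡ 1#) (*-identityʳ (- 1#))) (-‿inverseʳ 1#))
                            (trans (+-identityʳ _) (*-identityʳ _)))
                 (+-identityˡ _)))

        vanish : ∀ e → Inside U e → ∀ o → 𝟙 (¬? (cyclic? U o)) * Π o ≡ 0#
        vanish e e∈ o with cyclic? U o
        ... | yes _ = zeroˡ _
        ... | no ¬cyc with extremal {o = o} e e∈ ¬cyc
        ...   | v , v∈U , ends = trans (cong (1# *_) (∏-0 v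
                (trans (cong (λ b → if b then factor o v else 1#) ([]=⇒lookup v∈U)) (one-end o v ends)))) (zeroʳ 1#)

        go : (ne? : Dec (NoEdges U)) → ∑o U (λ o → 𝟙 (¬? (cyclic? U o)) * Π o) ≡ negs * 𝟙 ne?
        go (no ¬ne) = trans (∑-cong os λ o → trans (cong (∏ #E (λ e → 𝟙 (default? U e (lookup o e))) *_) (zero-term o)) (zeroʳ _)) (trans (∑-0 os) (sym (zeroʳ negs)))
          where
          zero-term : ∀ o → 𝟙 (¬? (cyclic? U o)) * Π o ≡ 0#
          zero-term with Fin.¬∀⟶∃¬ #E _ (λ e → ¬? (inside? U e)) ¬ne
          ... | e , ¬¬e∈ with inside? U e
          ...   | yes e∈ = vanish e e∈
          ...   | no e∉  = ⊥-elim (¬¬e∈ e∉)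
        go (yes ne) = begin
          ∑ os (λ o → D o * (𝟙 (¬? (cyclic? U o)) * Π o)) ≡⟨ ∑-cong os (λ o → cong (D o *_) (term o)) ⟩
          ∑ os (λ o → D o * negs)                         ≡⟨ ∑-*ʳ os negs D ⟩
          ∑ os D * negs                                   ≡⟨ cong (_* negs) (∑-∏ arrows #E λ e a → 𝟙 (default? U e a)) ⟩
          ∏ #E (λ e → ∑ arrows (λ a → 𝟙 (default? U e a))) * negs ≡⟨ cong (_* negs) (∏-1 #E only) ⟩
          1# * negs                                       ≡⟨ *-comm 1# negs ⟩
          negs * 1#                                       ∎
          where
          open ≡-Reasoning
          D : Orientation → Carrier
          D o = ∏ #E (λ e → 𝟙 (default? U e (lookup o e)))
          -- No edge lies inside U, so the edgeless graph has exactly one orientation: the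
          -- conventional one.
          only : ∀ e → ∑ arrows (λ a → 𝟙 (default? U e a)) ≡ 1#
          only e = trans (cong₂ _+_ (𝟙-true (default? U e toward) (inj₂ refl))
            (cong (_+ 0#) (𝟙-false (default? U e away) λ { (inj₁ e∈) → ne e e∈ ; (inj₂ ()) })))
            (trans (cong (1# +_) (+-identityˡ 0#)) (+-identityʳ 1#))
          acyclic : ∀ o → ¬ Cyclic U o
          acyclic o (W , W⊆U , (v , v∈) , mixed) with proj₁ (mixed v v∈)
          ... | e , _ , e∈ , _ = ne e (W⊆U ∘ e∈)
          term : ∀ o → 𝟙 (¬? (cyclic? U o)) * Π o ≡ negs
          term o = trans (cong₂ _*_ (𝟙-true (¬? (cyclic? U o)) (acyclic o))
            (∏-cong #V λ v → cong (if lookup U v then_else 1#) (no-end ne o v))) (*-identityˡ _)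

-- Proper colourings, peeled from the extreme colours inwards.

module ColouringCounting where

  open CommutativeRings
  open WeightedSums
  open OrientationCounting
  open import Data.Bool.Base using (if_then_else_; T)
  open import Data.Empty using (⊥-elim)
  open import Data.Fin.Base using (Fin; zero; suc)
  import Data.Fin.Properties as Fin
  open import Data.Fin.Subset using (Subset; inside; outside; _∈_; ∣_∣)
  open import Data.Fin.Subset.Properties using (_∈?_; p⊆q⇒∣p∣≤∣q∣)
  open import Data.Integer.Base as ℤ using (ℤ; +_; -[1+_]; 0ℤ)
  import Data.Integer.Properties as ℤ
  open import Data.List.Base using (List; []; _∷_)
  import Data.List.Membership.Propositional as List
  open import Data.List.Relation.Unary.Any using (here; there)
  open import Data.Nat.Base as ℕ using (ℕ; zero; suc; _≤_; _<_; z≤n; s≤s)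
  import Data.Nat.Properties as ℕ
  open import Data.Product using (_×_; _,_; proj₁; proj₂; ∃-syntax)
  open import Data.Sign.Base using (Sign)
  open import Data.Unit.Base using (tt)
  open import Data.Vec.Base using (Vec; []; _∷_; lookup; zipWith; replicate)
  open import Data.Vec.Properties using (lookup-zipWith; lookup-replicate)
  open import Function.Base using (_∘_)
  open import Relation.Binary.PropositionalEquality
  open import Relation.Nullary
  open import Relation.Nullary.Decidable using (_→-dec_)
  open import Defs using (SignedGraph; signed)

  colours : ℕ → List ℤ
  colours zero    = 0ℤ ∷ []
  colours (suc m) = + suc m ∷ -[1+ m ] ∷ colours m

  colours-bounded : ∀ m {c} → c List.∈ colours m → ℤ.∣ c ∣ ≤ m
  colours-bounded zero    (here refl)         = z≤n
  colours-bounded (suc m) (here refl)         = ℕ.≤-refl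
  colours-bounded (suc m) (there (here refl)) = ℕ.≤-refl
  colours-bounded (suc m) (there (there c∈))  = ℕ.m≤n⇒m≤1+n (colours-bounded m c∈)

  ∣signed∣ : ∀ s i → ℤ.∣ signed s i ∣ ≡ ℤ.∣ i ∣
  ∣signed∣ Sign.+ i = refl
  ∣signed∣ Sign.- i = ℤ.∣-i∣≡∣i∣ i

  module _ {A : Set} (c₊ c₋ : A) where
    paint : Label → A → A
    paint free   c = c
    paint sink   _ = c₊
    paint source _ = c₋

    overlay : ∀ {n} → Vec Label n → Vec A n → Vec A n
    overlay = zipWith paint

  clash-painted : ∀ m s x y c d → T (clash s x y) →
    paint (+ suc m) -[1+ m ] x c ≡ signed s (paint (+ suc m) -[1+ m ] y d)
  clash-painted m Sign.+ sink   sink   c d _ = refl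
  clash-painted m Sign.+ source source c d _ = refl
  clash-painted m Sign.- sink   source c d _ = refl
  clash-painted m Sign.- source sink   c d _ = refl
  clash-painted m Sign.+ free   free   c d ()
  clash-painted m Sign.+ free   sink   c d ()
  clash-painted m Sign.+ free   source c d ()
  clash-painted m Sign.+ sink   free   c d ()
  clash-painted m Sign.+ sink   source c d ()
  clash-painted m Sign.+ source free   c d ()
  clash-painted m Sign.+ source sink   c d ()
  clash-painted m Sign.- free   free   c d ()
  clash-painted m Sign.- free   sink   c d ()
  clash-painted m Sign.- free   source c d ()
  clash-painted m Sign.- sink   free   c d ()
  clash-painted m Sign.- sink   sink   c d ()
  clash-painted m Sign.- source free   c d ()
  clash-painted m Sign.- source source c d ()

  -- If just one end is labelled, the colours have absolute values m + 1 and at most m, which no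
  -- sign can make equal. If both are, equality of ±(m + 1) with a signed ±(m + 1) is precisely a
  -- clash.
  noClash-painted : ∀ m s x y c d → ¬ (x ≡ free × y ≡ free) → ¬ T (clash s x y) →
    ℤ.∣ c ∣ ≤ m → ℤ.∣ d ∣ ≤ m →
    paint (+ suc m) -[1+ m ] x c ≢ signed s (paint (+ suc m) -[1+ m ] y d)
  noClash-painted m s      free   free   c d ne ¬c c≤ d≤ eq = ne (refl , refl)
  noClash-painted m s      free   sink   c d ne ¬c c≤ d≤ eq =
    ℕ.1+n≰n (subst (_≤ m) (trans (cong ℤ.∣_∣ eq) (∣signed∣ s _)) c≤)
  noClash-painted m s      free   source c d ne ¬c c≤ d≤ eq =
    ℕ.1+n≰n (subst (_≤ m) (trans (cong ℤ.∣_∣ eq) (∣signed∣ s _)) c≤)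
  noClash-painted m s      sink   free   c d ne ¬c c≤ d≤ eq =
    ℕ.1+n≰n (subst (_≤ m) (sym (trans (cong ℤ.∣_∣ eq) (∣signed∣ s _))) d≤)
  noClash-painted m s      source free   c d ne ¬c c≤ d≤ eq =
    ℕ.1+n≰n (subst (_≤ m) (sym (trans (cong ℤ.∣_∣ eq) (∣signed∣ s _))) d≤)
  noClash-painted m Sign.+ sink   sink   c d ne ¬c c≤ d≤ eq = ¬c tt
  noClash-painted m Sign.+ source source c d ne ¬c c≤ d≤ eq = ¬c tt
  noClash-painted m Sign.- sink   source c d ne ¬c c≤ d≤ eq = ¬c tt
  noClash-painted m Sign.- source sink   c d ne ¬c c≤ d≤ eq = ¬c tt
  noClash-painted m Sign.+ sink   source c d ne ¬c c≤ d≤ ()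
  noClash-painted m Sign.+ source sink   c d ne ¬c c≤ d≤ ()
  noClash-painted m Sign.- sink   sink   c d ne ¬c c≤ d≤ ()
  noClash-painted m Sign.- source source c d ne ¬c c≤ d≤ ()

  module Layers (R : Ring≡) where
    open Ring≡ R
    open Sums R
    open SubsetSums R

    -- The colours c₊ and c₋ mark the vertices labelled sink and source.
    ∑on-layer : ∀ {A : Set} (d c₊ c₋ : A) cs (w : A → Carrier) (y : Label → Carrier) →
      y free ≡ 1# → y sink ≡ w c₊ → y source ≡ w c₋ → ∀ {n} (U : Subset n) F →
      ∑on d w (c₊ ∷ c₋ ∷ cs) U F ≡
      ∑on free y labels U λ σ → ∑on d w cs (freeIn U σ) (F ∘ overlay c₊ c₋ σ)
    ∑on-layer d c₊ c₋ cs w y y₀ y₊ y₋ [] F = refl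
    ∑on-layer d c₊ c₋ cs w y y₀ y₊ y₋ (outside ∷ U) F = ∑on-layer d c₊ c₋ cs w y y₀ y₊ y₋ U (F ∘ (d ∷_))
    ∑on-layer {A} d c₊ c₋ cs w y y₀ y₊ y₋ (inside ∷ U) F = begin
      w c₊ * old c₊ + (w c₋ * old c₋ + ∑ cs (λ c → w c * old c))
        ≡⟨ cong₂ (λ p q → w c₊ * p + (w c₋ * q + ∑ cs (λ c → w c * old c))) (ih c₊) (ih c₋) ⟩
      w c₊ * new c₊ + (w c₋ * new c₋ + ∑ cs (λ c → w c * old c))
        ≡⟨ cong (λ s → w c₊ * new c₊ + (w c₋ * new c₋ + s)) lower ⟩
      w c₊ * new c₊ + (w c₋ * new c₋ + 1# * low)
        ≡⟨ reorder _ _ _ ⟩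
      1# * low + (w c₊ * new c₊ + (w c₋ * new c₋ + 0#))
        ≡⟨ cong₂ (λ p q → p * low + q) (sym y₀) (cong₂ (λ p q → p * new c₊ + (q * new c₋ + 0#)) (sym y₊) (sym y₋)) ⟩
      y free * low + (y sink * new c₊ + (y source * new c₋ + 0#)) ∎
      where
      open ≡-Reasoning
      old new : A → Carrier
      old c = ∑on d w (c₊ ∷ c₋ ∷ cs) U (F ∘ (c ∷_))
      new c = ∑on free y labels U λ σ → ∑on d w cs (freeIn U σ) (F ∘ (c ∷_) ∘ overlay c₊ c₋ σ)
      low : Carrier
      low = ∑on free y labels U λ σ → ∑ cs λ c → w c * ∑on d w cs (freeIn U σ) (F ∘ (c ∷_) ∘ overlay c₊ c₋ σ)
      ih : ∀ c → old c ≡ new c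
      ih c = ∑on-layer d c₊ c₋ cs w y y₀ y₊ y₋ U (F ∘ (c ∷_))
      lower : ∑ cs (λ c → w c * old c) ≡ 1# * low
      lower = trans (∑-cong cs λ c → trans (cong (w c *_) (ih c)) (sym (∑on-*ˡ free y labels U (w c) _)))
                (trans (sym (∑on-∑ free y labels U cs _)) (sym (*-identityˡ low)))
      reorder : ∀ a b c → a + (b + c) ≡ c + (a + (b + 0#))
      reorder a b c = trans (sym (+-assoc a b c)) (trans (+-comm (a + b) c)
                        (cong (λ x → c + (a + x)) (sym (+-identityʳ b))))

    module _ (y : Label → Carrier) (y₀ : y free ≡ 1#) where

      IsPoly-∑on : ∀ {n} (U : Subset n) (F : ℕ → Vec Label n → Carrier) →
        (∀ {σ} → On free labels U σ → IsPoly (λ j → F j σ)) → IsPoly (λ j → ∑on free y labels U (F j))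
      IsPoly-∑on []            F h = h []
      IsPoly-∑on (outside ∷ U) F h = IsPoly-∑on U (λ j → F j ∘ (free ∷_)) (h ∘ skip)
      IsPoly-∑on (inside ∷ U)  F h =
        IsPoly-+ (part free (here refl))
        (IsPoly-+ (part sink (there (here refl)))
        (IsPoly-+ (part source (there (there (here refl)))) (IsPoly-const 0#)))
        where
        part : ∀ x → x List.∈ labels → IsPoly (λ j → y x * ∑on free y labels U (F j ∘ (x ∷_)))
        part x x∈ = IsPoly-* (IsPoly-const (y x)) (IsPoly-∑on U (λ j → F j ∘ (x ∷_)) (h ∘ (x∈ ∷_)))

      -- Only the labelling that is `free` everywhere keeps all of U; every other one has a smaller
      -- free part. Subtracting that single term makes induction on the size of U possible.
      IsPoly-∑on-nonfree : ∀ {n} (U : Subset n) (F : ℕ → Vec Label n → Carrier) →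
        (∀ {σ} → On free labels U σ → ∣ freeIn U σ ∣ < ∣ U ∣ → IsPoly (λ j → F j σ)) →
        IsPoly (λ j → ∑on free y labels U (F j) - F j (replicate n free))
      IsPoly-∑on-nonfree []            F h = IsPoly-cong (λ j → sym (-‿inverseʳ (F j []))) (IsPoly-const 0#)
      IsPoly-∑on-nonfree (outside ∷ U) F h =
        IsPoly-∑on-nonfree U (λ j → F j ∘ (free ∷_)) (h ∘ skip)
      IsPoly-∑on-nonfree (inside ∷ U)  F h =
        IsPoly-cong (λ j → trans (reorder _ _ _)
                      (cong (λ x → x + (y sink * ∑on free y labels U (F j ∘ (sink ∷_)) + (y source * ∑on free y labels U (F j ∘ (source ∷_)) + 0#)) - F j (replicate _ free)) (trans (sym (*-identityˡ _)) (cong (_* ∑on free y labels U (F j ∘ (free ∷_))) (sym y₀)))))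
        (IsPoly-+ (IsPoly-∑on-nonfree U (λ j → F j ∘ (free ∷_)) λ on lt → h (here refl ∷ on) (s≤s lt))
        (IsPoly-+ (part sink (there (here refl)) s≤s)
        (IsPoly-+ (part source (there (there (here refl))) s≤s) (IsPoly-const 0#))))
        where
        reorder : ∀ a b c → (a - b) + c ≡ a + c - b
        reorder a b c = trans (+-assoc a (- b) c) (trans (cong (λ x → a + x) (+-comm (- b) c)) (sym (+-assoc a c (- b))))
        part : ∀ x → x List.∈ labels → (∀ {σ} → ∣ freeIn U σ ∣ ≤ ∣ U ∣ → ∣ freeIn (inside ∷ U) (x ∷ σ) ∣ < ∣ inside ∷ U ∣) →
          IsPoly (λ j → y x * ∑on free y labels U (F j ∘ (x ∷_)))
        part x x∈ lt = IsPoly-* (IsPoly-const (y x)) (IsPoly-∑on U (λ j → F j ∘ (x ∷_))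
          λ {σ} on → h (x∈ ∷ on) (lt (p⊆q⇒∣p∣≤∣q∣ {p = freeIn U σ} {U} λ v∈ → proj₁ (∈-freeIn⁻ {σ = σ} v∈))))

  freeIn-replicate : ∀ {n} (U : Subset n) → freeIn U (replicate n free) ≡ U
  freeIn-replicate []            = refl
  freeIn-replicate (inside ∷ U)  = cong (inside ∷_) (freeIn-replicate U)
  freeIn-replicate (outside ∷ U) = cong (outside ∷_) (freeIn-replicate U)

  module Colourings (G : SignedGraph) (R : Ring≡) where
    open SignedGraph G
    open Ring≡ R
    open Sums R
    open SubsetSums R
    open Layers R
    open Orientations G
    open Counting R

    ProperOn : Subset #V → Vec ℤ #V → Set
    ProperOn U κ = ∀ e → Inside U e → lookup κ (end e zero) ≢ signed (sgn e) (lookup κ (end e (suc zero)))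

    abstract
      properOn? : ∀ U κ → Dec (ProperOn U κ)
      properOn? U κ = Fin.all? λ e → inside? U e →-dec ¬? (_ ℤ.≟ _)

    -- An edge inside U with a labelled end is violated exactly when its labels clash, and every
    -- other edge inside U lies in the free part, where the colours are those of κ.
    𝟙-overlay : ∀ m {U σ κ} → On free labels U σ → On 0ℤ (colours m) (freeIn U σ) κ →
      𝟙 (properOn? U (overlay (+ suc m) -[1+ m ] σ κ)) ≡ noClashes σ * 𝟙 (properOn? (freeIn U σ) κ)
    𝟙-overlay m {U} {σ} {κ} onσ onκ =
      trans (𝟙-× (Fin.all? (noClash? σ)) (properOn? (freeIn U σ) κ) (properOn? U τ)
               (λ pr → clashless pr , restricted pr) combined)
            (cong (_* 𝟙 (properOn? (freeIn U σ) κ)) (sym (∏-𝟙 (noClash? σ))))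
      where
      τ = overlay (+ suc m) -[1+ m ] σ κ
      τ-at : ∀ v → lookup τ v ≡ paint (+ suc m) -[1+ m ] (lookup σ v) (lookup κ v)
      τ-at v = lookup-zipWith (paint (+ suc m) -[1+ m ]) v σ κ
      bounded : ∀ v → ℤ.∣ lookup κ v ∣ ≤ m
      bounded = On-lookup 0ℤ (colours m) {λ c → ℤ.∣ c ∣ ≤ m} (colours-bounded m) z≤n onκ
      clash-inside : ∀ e → T (clash (sgn e) (lookup σ (end e zero)) (lookup σ (end e (suc zero)))) → Inside U e
      clash-inside e t zero with end e zero ∈? U
      ... | yes v∈ = v∈
      ... | no v∉ = ⊥-elim (subst T (trans (cong (λ x → clash (sgn e) x (lookup σ (end e (suc zero)))) (On-outside free labels onσ _ v∉))
                                           (clash-freeˡ (sgn e) _)) t)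
      clash-inside e t (suc zero) with end e (suc zero) ∈? U
      ... | yes v∈ = v∈
      ... | no v∉ = ⊥-elim (subst T (trans (cong (clash (sgn e) (lookup σ (end e zero))) (On-outside free labels onσ _ v∉))
                                           (clash-freeʳ (sgn e) _)) t)
      clashless : ProperOn U τ → ∀ e → ¬ T (clash (sgn e) (lookup σ (end e zero)) (lookup σ (end e (suc zero))))
      clashless pr e t = pr e (clash-inside e t)
        (trans (τ-at _) (trans (clash-painted m (sgn e) _ _ _ _ t) (cong (signed (sgn e)) (sym (τ-at _)))))
      τ-free : ∀ {v} → v ∈ freeIn U σ → lookup τ v ≡ lookup κ v
      τ-free {v} v∈ = trans (τ-at v) (cong (λ x → paint (+ suc m) -[1+ m ] x (lookup κ v)) (proj₂ (∈-freeIn⁻ v∈)))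
      restricted : ProperOn U τ → ProperOn (freeIn U σ) κ
      restricted pr e e∈ eq = pr e (λ h → proj₁ (∈-freeIn⁻ (e∈ h)))
        (trans (τ-free (e∈ zero)) (trans eq (cong (signed (sgn e)) (sym (τ-free (e∈ (suc zero)))))))
      combined : (∀ e → ¬ T (clash (sgn e) (lookup σ (end e zero)) (lookup σ (end e (suc zero))))) →
        ProperOn (freeIn U σ) κ → ProperOn U τ
      combined nc pr e e∈ eq with inside? (freeIn U σ) e
      ... | yes e∈′ = pr e e∈′ (trans (sym (τ-free (e∈′ zero))) (trans eq (cong (signed (sgn e)) (τ-free (e∈′ (suc zero))))))
      ... | no e∉ = noClash-painted m (sgn e) _ _ _ _
            (λ (f₀ , f₁) → e∉ λ { zero → ∈-freeIn⁺ (e∈ zero) f₀ ; (suc zero) → ∈-freeIn⁺ (e∈ (suc zero)) f₁ })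
            (nc e) (bounded _) (bounded _)
            (trans (sym (τ-at _)) (trans eq (cong (signed (sgn e)) (τ-at _))))

    colourings : (ℤ → Carrier) → ℕ → Subset #V → Carrier
    colourings w m U = ∑on 0ℤ w (colours m) U λ κ → 𝟙 (properOn? U κ)

    colourings-layer : ∀ m w y → y free ≡ 1# → y sink ≡ w (+ suc m) → y source ≡ w -[1+ m ] → ∀ U →
      colourings w (suc m) U ≡ transfer y (colourings w m) U
    colourings-layer m w y y₀ y₊ y₋ U =
      trans (∑on-layer 0ℤ (+ suc m) -[1+ m ] (colours m) w y y₀ y₊ y₋ U _)
        (∑on-cong free {w = y} labels U (λ _ → refl) λ {σ} on →
          trans (∑on-cong 0ℤ {w = w} (colours m) (freeIn U σ) (λ _ → refl) (𝟙-overlay m on))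
                (∑on-*ˡ 0ℤ w (colours m) (freeIn U σ) (noClashes σ) _))

    transfer-cong : ∀ y {f g} → (∀ U → f U ≡ g U) → ∀ U → transfer y f U ≡ transfer y g U
    transfer-cong y h U = ∑on-cong free {w = y} labels U (λ _ → refl) λ {σ} _ → cong (noClashes σ *_) (h (freeIn U σ))

    -- Shifted by one: the value at m + 1 counts proper colourings of U with values in [-m , m], up to
    -- sign, and the value at 0 extends this polynomial sequence backwards to m = -1.
    signedCount : ℕ → Subset #V → Carrier
    signedCount zero    = acyclics
    signedCount (suc m) = transfer signs (signedCount m)

    -- The case m = 0 is where orientations and colourings meet. Since 0 = ±0, the colour 0 alone is
    -- proper only if U has no edges, and `transfer-signs` gives the same signed indicator from
    -- acyclic orientations. Above it both sides obey the same recursion.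
    signedCount-suc : ∀ m U → signedCount (suc m) U ≡ colourings (λ _ → - 1#) m U
    signedCount-suc zero U = trans (transfer-signs U)
      (sym (trans (∑on-singleton 0ℤ (λ _ → - 1#) U _)
        (cong (∏ #V (λ v → if lookup U v then - 1# else 1#) *_)
          (𝟙-⇔ (properOn? U (replicate #V 0ℤ)) (noEdges? U)
            (λ pr e e∈ → pr e e∈ (trans (lookup-replicate (end e zero) 0ℤ)
               (sym (trans (cong (signed (sgn e)) (lookup-replicate (end e (suc zero)) 0ℤ)) (signed-0 (sgn e))))))
            (λ ne e e∈ _ → ne e e∈)))))
      where
      signed-0 : ∀ s → signed s 0ℤ ≡ 0ℤ
      signed-0 Sign.+ = refl
      signed-0 Sign.- = refl
    signedCount-suc (suc m) U =
      trans (transfer-cong signs (signedCount-suc m) U)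
            (sym (colourings-layer m (λ _ → - 1#) signs refl refl refl U))

    noClashes-free : noClashes (replicate #V free) ≡ 1#
    noClashes-free = ∏-1 #E λ e → 𝟙-true (noClash? (replicate #V free) e) λ t →
      subst T (trans (cong (λ x → clash (sgn e) x (lookup (replicate #V free) (end e (suc zero)))) (lookup-replicate (end e zero) free)) (clash-freeˡ (sgn e) _)) t

    -- In the difference of consecutive values the all-free labelling cancels, so the difference
    -- involves only proper subsets of U, to which strong induction applies. Summation raises the
    -- order by one.
    signedCount-poly : ∀ b U → ∣ U ∣ < b → IsPoly (λ j → signedCount j U)
    signedCount-poly (suc b) U (s≤s lt) = suc (proj₁ step) , proj₂ step
      where
      F : ℕ → Vec Label #V → Carrier
      F j σ = noClashes σ * signedCount j (freeIn U σ)
      step : ∃[ D ] PolySeq (suc D) (λ j → signedCount j U)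
      step with IsPoly-∑on-nonfree signs refl U F (λ {σ} on lt′ →
             IsPoly-* (IsPoly-const (noClashes σ)) (signedCount-poly b (freeIn U σ) (ℕ.<-≤-trans lt′ lt)))
      ... | D , p = D , PolySeq-cong D (λ j → cong (λ x → transfer signs (signedCount j) U - x)
              (trans (cong₂ _*_ noClashes-free (cong (signedCount j) (freeIn-replicate U))) (*-identityˡ _))) p

-- Closed walks versus cyclic vertex sets, and the enumeration of orientations.

module Cycles where

  open OrientationCounting
  open import Data.Fin.Base using (Fin; zero; suc; opposite)
  import Data.Fin.Properties as Fin
  open import Data.Fin.Subset using (Subset; ⊤; _∈_; ∣_∣; _⊂_)
  open import Data.Fin.Subset.Properties using (∈⊤; p⊂q⇒∣p∣<∣q∣)
  open import Data.List.Base using (List; []; _∷_; map; filter; length; allFin)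
  import Data.List.Membership.Propositional as List
  open import Data.List.Properties using (length-map)
  open import Data.List.Membership.Propositional.Properties using (∈-allFin; ∈-filter⁺; ∈-filter⁻; ∈-map⁺; ∈-map⁻; ∈-cartesianProductWith⁺)
  open import Data.List.Membership.Propositional.Properties.WithK using (unique∧set⇒bag)
  open import Data.List.Relation.Binary.BagAndSetEquality using (∼bag⇒↭)
  open import Data.List.Relation.Binary.Permutation.Propositional.Properties using (↭-length)
  import Data.List.Membership.DecPropositional as DecMembership
  open import Data.List.Relation.Unary.All as All using (All; []; _∷_)
  import Data.List.Relation.Unary.AllPairs as AllPairs
  open import Data.List.Relation.Unary.Any using (here; there)
  open import Data.List.Relation.Unary.Unique.Propositional using (Unique)
  import Data.List.Relation.Unary.Unique.Propositional.Properties as Unique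
  open import Data.Nat.Base as ℕ using (ℕ; zero; suc; _<_; s≤s)
  import Data.Nat.Properties as ℕ
  open import Data.Product using (_×_; _,_; proj₁; proj₂; ∃-syntax)
  open import Data.Sign.Base using (Sign)
  open import Data.Sum.Base using (_⊎_; inj₁; inj₂; [_,_]′)
  open import Data.Vec.Base as Vec using (Vec; []; _∷_; lookup; tabulate; head)
  open import Data.Vec.Properties using (lookup∘tabulate; tabulate∘lookup; tabulate-cong; lookup-map)
  open import Function.Base using (_∘_)
  open import Function.Bundles using (_⇔_; mk⇔; Equivalence)
  open import Relation.Binary.PropositionalEquality
  open import Relation.Nullary
  open import Relation.Nullary.Decidable using (_×-dec_; _⊎-dec_; map′; decidable-stable)
  open import Defs using (SignedGraph; Arrow; toward; away; allVecs; HasCardinality; Arrows; arrow; Compatible;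
    IsOrientation; Walk; stop; step; vertices; edges; HasArrow; IsCycle; Acyclic; IsSink; AcyclicOrientationWithSinks)

  -- Duplicate-free lists with the same members are permutations of each other. This identifies the
  -- prescribed k with the computed number `sinks o`.
  HasCardinality-unique : ∀ {A : Set} {P : A → Set} {m n} → HasCardinality P m → HasCardinality P n → m ≡ n
  HasCardinality-unique (xs , uxs , hxs , refl) (ys , uys , hys , refl) =
    ↭-length (∼bag⇒↭ (unique∧set⇒bag uxs uys λ {x} →
      mk⇔ (Equivalence.from (hys x) ∘ Equivalence.to (hxs x)) (Equivalence.from (hxs x) ∘ Equivalence.to (hys x))))

  HasCardinality-filter : ∀ {A : Set} {P : A → Set} (P? : ∀ x → Dec (P x)) {xs} → Unique xs → (∀ x → x List.∈ xs) →
    HasCardinality P (length (filter P? xs))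
  HasCardinality-filter P? {xs} u all =
    filter P? xs , Unique.filter⁺ P? u , (λ x → mk⇔ (proj₂ ∘ ∈-filter⁻ P? {xs = xs}) (∈-filter⁺ P? {xs = xs} (all x))) , refl

  allVecs-unique : ∀ {A : Set} {xs : List A} → Unique xs → ∀ n → Unique (allVecs xs n)
  allVecs-unique u zero    = [] AllPairs.∷ AllPairs.[]
  allVecs-unique u (suc n) = Unique.cartesianProductWith⁺ _∷_ (λ { refl → refl , refl }) u (allVecs-unique u n)

  ∈-allVecs : ∀ {A : Set} {xs : List A} → (∀ x → x List.∈ xs) → ∀ {n} (κ : Vec A n) → κ List.∈ allVecs xs n
  ∈-allVecs all []      = here refl
  ∈-allVecs all (x ∷ κ) = ∈-cartesianProductWith⁺ _∷_ (all x) (∈-allVecs all κ)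

  partner-compatible : ∀ s a → Compatible s a (partner s a)
  partner-compatible Sign.+ toward ()
  partner-compatible Sign.+ away   ()
  partner-compatible Sign.- a      = refl

  compatible⇒partner : ∀ s {a b} → Compatible s a b → b ≡ partner s a
  compatible⇒partner Sign.+ {toward} c = ≢toward⇒away (c ∘ sym)
  compatible⇒partner Sign.+ {away}   c = ≢away⇒toward (c ∘ sym)
  compatible⇒partner Sign.- c          = sym c

  module Walks (G : SignedGraph) where
    open SignedGraph G
    open Orientations G
    open DecMembership (Fin._≟_ {#V}) using () renaming (_∈?_ to _∈ⱽ?_)
    open DecMembership (Fin._≟_ {#E}) using () renaming (_∈?_ to _∈ᴱ?_)

    arrows-of : Orientation → Arrows G
    arrows-of o = tabulate λ e → lookup o e ∷ partner (sgn e) (lookup o e) ∷ []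

    arrow-arrows-of : ∀ o e h → arrow G (arrows-of o) (e , h) ≡ arrow′ o e h
    arrow-arrows-of o e h = trans (cong (λ as → lookup as h) (lookup∘tabulate _ e)) (split h)
      where
      split : ∀ h → lookup (lookup o e ∷ partner (sgn e) (lookup o e) ∷ []) h ≡ arrow′ o e h
      split zero       = refl
      split (suc zero) = refl

    start∈ : ∀ {u v} (w : Walk G u v) → u List.∈ vertices G w
    start∈ (stop u)            = here refl
    start∈ (step u e h _ _ w)  = here refl

    ends∈ : ∀ {u v} (w : Walk G u v) {e} → e List.∈ edges G w → ∀ h → end e h List.∈ vertices G w
    ends∈ (step u e h p q w) (there e∈) h′ = there (ends∈ w e∈ h′)
    ends∈ (step u e zero p q w) (here refl) zero             = here p
    ends∈ (step u e zero p q w) (here refl) (suc zero)       = there (subst (List._∈ vertices G w) (sym q) (start∈ w))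
    ends∈ (step u e (suc zero) p q w) (here refl) zero       = there (subst (List._∈ vertices G w) (sym q) (start∈ w))
    ends∈ (step u e (suc zero) p q w) (here refl) (suc zero) = here p

    -- The vertex set of the walk is the witness: it contains both ends of each edge of the walk, so
    -- the arrows required of a cycle lie on edges inside it.
    cycle⇒cyclic : ∀ o {u} (w : Walk G u u) → IsCycle G (arrows-of o) w → Cyclic ⊤ o
    cycle⇒cyclic o {u} w cyc = ⟪ on? ⟫ , (λ _ → ∈⊤) , (u , ∈⟪⟫⁺ on? (start∈ w)) ,
      λ v v∈ → let (t , a) = cyc v (∈⟪⟫⁻ on? v∈) in has t , has a
      where
      on? : ∀ v → Dec (v List.∈ vertices G w)
      on? v = v ∈ⱽ? vertices G w
      has : ∀ {v d} → HasArrow G (arrows-of o) (edges G w) v d → Has ⟪ on? ⟫ o v d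
      has ((e , h) , e∈ , p , q) = e , h , (λ h′ → ∈⟪⟫⁺ on? (ends∈ w e∈ h′)) , p , trans (sym (arrow-arrows-of o e h)) q

    -- Goes along e and straight back. Walks may traverse edges against their arrows, so any edge at
    -- a vertex of the walk can be added without changing its ends.
    detour : ∀ {v x} e h → end e h ≡ v → Walk G v x → Walk G v x
    detour e zero       p r = step _ e zero p refl (step _ e (suc zero) refl p r)
    detour e (suc zero) p r = step _ e (suc zero) p refl (step _ e zero refl p r)

    splice : ∀ {a b v} (w : Walk G a b) → v List.∈ vertices G w → ∀ e h → end e h ≡ v → Walk G a b
    splice (stop u)           (here refl) e h p = detour e h p (stop u)
    splice (step u f k q r w) (here refl) e h p = detour e h p (step u f k q r w)
    splice (step u f k q r w) (there v∈)  e h p = step u f k q r (splice w v∈ e h p)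

    detour-edges : ∀ {v x} e h (p : end e h ≡ v) (w : Walk G v x) → edges G (detour e h p w) ≡ e ∷ e ∷ edges G w
    detour-edges e zero       p w = refl
    detour-edges e (suc zero) p w = refl

    splice-old : ∀ {a b v} (w : Walk G a b) v∈ e h (p : end e h ≡ v) {f} →
      f List.∈ edges G w → f List.∈ edges G (splice w v∈ e h p)
    splice-old (step u f k q r w) (here refl) e h p f∈ =
      subst (_ List.∈_) (sym (detour-edges e h p (step u f k q r w))) (there (there f∈))
    splice-old (step u f k q r w) (there v∈) e h p (here eq)  = here eq
    splice-old (step u f k q r w) (there v∈) e h p (there f∈) = there (splice-old w v∈ e h p f∈)

    splice-new : ∀ {a b v} (w : Walk G a b) v∈ e h (p : end e h ≡ v) → e List.∈ edges G (splice w v∈ e h p)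
    splice-new (stop u)           (here refl) e h p = subst (e List.∈_) (sym (detour-edges e h p (stop u))) (here refl)
    splice-new (step u f k q r w) (here refl) e h p =
      subst (e List.∈_) (sym (detour-edges e h p (step u f k q r w))) (here refl)
    splice-new (step u f k q r w) (there v∈)  e h p = there (splice-new w v∈ e h p)

    splice-all : ∀ {P : Edge → Set} {a b v} (w : Walk G a b) v∈ e h (p : end e h ≡ v) →
      P e → All P (edges G w) → All P (edges G (splice w v∈ e h p))
    splice-all {P} (stop u) (here refl) e h p pe ps = subst (All P) (sym (detour-edges e h p (stop u))) (pe ∷ pe ∷ ps)
    splice-all {P} (step u f k q r w) (here refl) e h p pe ps =
      subst (All P) (sym (detour-edges e h p (step u f k q r w))) (pe ∷ pe ∷ ps)
    splice-all (step u f k q r w) (there v∈) e h p pe (pf ∷ ps) = pf ∷ splice-all w v∈ e h p pe ps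

    vertices-inside : ∀ {W : Subset #V} {a b} (w : Walk G a b) → a ∈ W → All (Inside W) (edges G w) →
      ∀ {v} → v List.∈ vertices G w → v ∈ W
    vertices-inside (stop u)           a∈ _        (here refl) = a∈
    vertices-inside (step u e h p q w) a∈ _        (here refl) = a∈
    vertices-inside (step u e h p q w) a∈ (i ∷ is) (there v∈)  =
      vertices-inside w (subst (_∈ _) q (i (opposite h))) is v∈

    hasArrow? : ∀ a es v d → Dec (HasArrow G a es v d)
    hasArrow? a es v d = map′ (λ (e , h , r) → (e , h) , r) (λ ((e , h) , r) → e , h , r)
      (Fin.any? λ e → Fin.any? λ h → (e ∈ᴱ? es) ×-dec (end e h Fin.≟ v) ×-dec (arrow G a (e , h) ≟ᴬ d))

    module _ (o : Orientation) (W : Subset #V) (mixed : ∀ v → v ∈ W → Has W o v toward × Has W o v away) where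

      missing : ∀ {u} → Walk G u u → Subset #E
      missing w = ⟪ (λ e → ¬? (e ∈ᴱ? edges G w)) ⟫

      -- Whenever a vertex of the walk lacks an arrow, a detour along an edge of W supplies it.
      complete : ∀ n {u} (w : Walk G u u) → u ∈ W → All (Inside W) (edges G w) → ∣ missing w ∣ < n →
        ∃[ w′ ] IsCycle G {u} (arrows-of o) w′
      complete (suc n) {u} w u∈ ins (s≤s lt) with Fin.any? lacking?
        where
        es = edges G w
        lacking? : ∀ v → Dec (v List.∈ vertices G w × (¬ HasArrow G (arrows-of o) es v toward ⊎ ¬ HasArrow G (arrows-of o) es v away))
        lacking? v = (v ∈ⱽ? vertices G w) ×-dec (¬? (hasArrow? (arrows-of o) es v toward) ⊎-dec ¬? (hasArrow? (arrows-of o) es v away))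
      ... | no all = w , λ v v∈ →
            decidable-stable (hasArrow? (arrows-of o) (edges G w) v toward) (λ ¬t → all (v , v∈ , inj₁ ¬t)) ,
            decidable-stable (hasArrow? (arrows-of o) (edges G w) v away)   (λ ¬a → all (v , v∈ , inj₂ ¬a))
      ... | yes (v , v∈ , lack) = [ extend (proj₁ (mixed v v∈W)) , extend (proj₂ (mixed v v∈W)) ]′ lack
        where
        v∈W = vertices-inside w u∈ ins v∈
        extend : ∀ {d} → Has W o v d → ¬ HasArrow G (arrows-of o) (edges G w) v d →
          ∃[ w′ ] IsCycle G {u} (arrows-of o) w′
        extend (e , h , e∈ , p , q) ¬has =
          complete n (splice w v∈ e h p) u∈ (splice-all w v∈ e h p e∈ ins)
            (ℕ.<-≤-trans (p⊂q⇒∣p∣<∣q∣ smaller) lt)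
          where
          new? = λ f → ¬? (f ∈ᴱ? edges G (splice w v∈ e h p))
          old? = λ f → ¬? (f ∈ᴱ? edges G w)
          -- The edge e was missing before, since otherwise its arrow at v would not be lacking. So
          -- each detour shrinks the set of missing edges, whose size bounds the recursion.
          smaller : missing (splice w v∈ e h p) ⊂ missing w
          smaller = (λ f∈ → ∈⟪⟫⁺ old? (∈⟪⟫⁻ new? f∈ ∘ splice-old w v∈ e h p)) ,
            e , ∈⟪⟫⁺ old? (λ e∈w → ¬has ((e , h) , e∈w , p , trans (arrow-arrows-of o e h) q)) ,
            λ e∈ → ∈⟪⟫⁻ new? e∈ (splice-new w v∈ e h p)

    cyclic⇒cycle : ∀ o → Cyclic ⊤ o → ∃[ u ] ∃[ w ] IsCycle G {u} (arrows-of o) w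
    cyclic⇒cycle o (W , _ , (u , u∈) , mixed) =
      u , complete o W mixed _ (stop u) u∈ [] ℕ.≤-refl

    acyclic⇒ : ∀ o → Acyclic G (arrows-of o) → ¬ Cyclic ⊤ o
    acyclic⇒ o ac c = let (_ , w , cyc) = cyclic⇒cycle o c in ac w cyc

    acyclic⇐ : ∀ o → ¬ Cyclic ⊤ o → Acyclic G (arrows-of o)
    acyclic⇐ o ¬c w cyc = ¬c (cycle⇒cyclic o w cyc)

    sink⇔ : ∀ o v → IsSink G (arrows-of o) v ⇔ Matches ⊤ o v sink
    sink⇔ o v = mk⇔
      (λ s (e , h , _ , p , q) → toward≢away (trans (sym (s (e , h) p)) (trans (arrow-arrows-of o e h) q)))
      (λ ¬a (e , h) p → trans (arrow-arrows-of o e h) (≢away⇒toward λ q → ¬a (e , h , (λ _ → ∈⊤) , p , q)))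
      where
      toward≢away : toward ≢ away
      toward≢away ()

    sinks : Orientation → ℕ
    sinks o = length (filter (λ v → matches? ⊤ o v sink) (allFin #V))

    sinks-cardinality : ∀ o → HasCardinality (IsSink G (arrows-of o)) (sinks o)
    sinks-cardinality o with HasCardinality-filter (λ v → matches? ⊤ o v sink) (Unique.allFin⁺ #V) ∈-allFin
    ... | xs , u , h , eq = xs , u , (λ v → mk⇔ (Equivalence.from (sink⇔ o v) ∘ Equivalence.to (h v))
                                                (Equivalence.from (h v) ∘ Equivalence.to (sink⇔ o v))) , eq

    Counted : ℕ → Orientation → Set
    Counted k o = ¬ Cyclic ⊤ o × sinks o ≡ k

    counted? : ∀ k o → Dec (Counted k o)
    counted? k o = ¬? (cyclic? ⊤ o) ×-dec (sinks o ℕ.≟ k)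

    orientations : List Orientation
    orientations = allVecs (toward ∷ away ∷ []) #E

    arrows-of-injective : ∀ {o o′} → arrows-of o ≡ arrows-of o′ → o ≡ o′
    arrows-of-injective {o} {o′} eq = trans (sym (tabulate∘lookup o))
      (trans (tabulate-cong λ e → trans (sym (arrow-arrows-of o e zero))
               (trans (cong (λ a → arrow G a (e , zero)) eq) (arrow-arrows-of o′ e zero)))
             (tabulate∘lookup o′))

    arrows-of-isOrientation : ∀ o → IsOrientation G (arrows-of o)
    arrows-of-isOrientation o e = subst₂ (Compatible (sgn e)) (sym (arrow-arrows-of o e zero)) (sym (arrow-arrows-of o e (suc zero)))
      (partner-compatible (sgn e) (lookup o e))

    isOrientation⇒arrows-of : ∀ a → IsOrientation G a → ∃[ o ] a ≡ arrows-of o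
    isOrientation⇒arrows-of a or = Vec.map head a ,
      trans (sym (tabulate∘lookup a)) (tabulate-cong λ e → pair e (lookup a e) refl)
      where
      pair : ∀ e (as : Vec Arrow 2) → lookup a e ≡ as →
        as ≡ lookup (Vec.map head a) e ∷ partner (sgn e) (lookup (Vec.map head a) e) ∷ []
      pair e (x ∷ y ∷ []) eq =
        trans (cong (λ t → x ∷ t ∷ []) (compatible⇒partner (sgn e)
                (subst (λ as → Compatible (sgn e) (lookup as zero) (lookup as (suc zero))) eq (or e))))
              (cong (λ t → t ∷ partner (sgn e) t ∷ []) (sym (trans (lookup-map e head a) (cong head eq))))

    orientations-cardinality : ∀ k →
      HasCardinality (AcyclicOrientationWithSinks G k) (length (filter (counted? k) orientations))
    orientations-cardinality k with HasCardinality-filter (counted? k) (allVecs-unique unique #E) (∈-allVecs all)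
      where
      unique : Unique (toward ∷ away ∷ [])
      unique = ((λ ()) ∷ []) AllPairs.∷ [] AllPairs.∷ AllPairs.[]
      all : ∀ a → a List.∈ toward ∷ away ∷ []
      all toward = here refl
      all away   = there (here refl)
    ... | os , u , h , eq = map arrows-of os , Unique.map⁺ arrows-of-injective u ,
      (λ a → mk⇔ (fwd a) (bwd a)) , trans (length-map arrows-of os) eq
      where
      fwd : ∀ a → a List.∈ map arrows-of os → AcyclicOrientationWithSinks G k a
      fwd a a∈ with ∈-map⁻ arrows-of a∈
      ... | o , o∈ , refl with Equivalence.to (h o) o∈
      ...   | ¬c , refl = arrows-of-isOrientation o , acyclic⇐ o ¬c , sinks-cardinality o
      bwd : ∀ a → AcyclicOrientationWithSinks G k a → a List.∈ map arrows-of os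
      bwd a (or , ac , card) with isOrientation⇒arrows-of a or
      ... | o , refl = ∈-map⁺ arrows-of (Equivalence.from (h o)
        (acyclic⇒ o ac , HasCardinality-unique (sinks-cardinality o) card))

-- Evaluating coefficient functions with finite support.

module Evaluation where

  open CommutativeRings
  open WeightedSums


  open import Data.Fin.Base using (Fin; zero; suc)
  open import Data.List.Base using (List; []; _∷_; map; _++_; upTo; cartesianProductWith; deduplicate)
  open import Data.List.Membership.Propositional using (_∈_; _∉_)
  open import Data.List.Membership.Propositional.Properties using (∈-deduplicate⁺; ∈-map⁺; ∈-++⁺ˡ; ∈-++⁺ʳ; ∈-cartesianProductWith⁺; ∈-cartesianProductWith⁻; ∈-upTo⁺; ∈-upTo⁻)
  open import Data.List.Properties using (map-upTo)
  open import Data.List.Relation.Unary.All as All using ()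
  open import Data.List.Relation.Unary.AllPairs as AllPairs using ([]; _∷_)
  open import Data.List.Relation.Unary.Any using (here; there)
  open import Data.List.Relation.Unary.Unique.Propositional using (Unique)
  import Data.List.Relation.Unary.Unique.Propositional.Properties as Unique
  open import Data.List.Relation.Unary.Unique.DecPropositional.Properties using (deduplicate-!)
  open import Data.Nat.Base as ℕ using (ℕ; zero; suc; s≤s)
  open import Data.Nat.Combinatorics using (_C_; nCk+nC[k+1]≡[n+1]C[k+1]; k>n⇒nCk≡0)
  import Data.Nat.Properties as ℕ
  open import Data.Product using (_×_; _,_; proj₂; ∃-syntax)
  open import Data.Vec.Base using (Vec; []; _∷_; lookup)
  open import Data.Vec.Properties using (≡-dec; lookup-zipWith; lookup-replicate)
  open import Function.Base using (_∘_)
  open import Relation.Binary.Definitions using (DecidableEquality)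
  open import Relation.Binary.PropositionalEquality
  open import Relation.Nullary
  open import Defs using (1ᵐ; _*ᵐ_; _/ᵐ_; x[_]^_; divisors)

  infix 4 _≟ᵐ_
  _≟ᵐ_ : ∀ {n} → DecidableEquality (Vec ℕ n)
  _≟ᵐ_ = ≡-dec ℕ._≟_

  divisors-unique : ∀ {n} (α : Vec ℕ n) → Unique (divisors α)
  divisors-unique []      = All.[] ∷ []
  divisors-unique (a ∷ α) = Unique.cartesianProductWith⁺ _∷_ (λ { refl → refl , refl }) (Unique.upTo⁺ (suc a)) (divisors-unique α)

  ∈-divisors-*ᵐ : ∀ {n} (β γ : Vec ℕ n) → β ∈ divisors (β *ᵐ γ)
  ∈-divisors-*ᵐ []      []      = here refl
  ∈-divisors-*ᵐ (b ∷ β) (c ∷ γ) = ∈-cartesianProductWith⁺ _∷_ (∈-upTo⁺ (s≤s (ℕ.m≤m+n b c))) (∈-divisors-*ᵐ β γ)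

  *ᵐ-/ᵐ : ∀ {n} (β γ : Vec ℕ n) → (β *ᵐ γ) /ᵐ β ≡ γ
  *ᵐ-/ᵐ []      []      = refl
  *ᵐ-/ᵐ (b ∷ β) (c ∷ γ) = cong₂ _∷_ (ℕ.m+n∸m≡n b c) (*ᵐ-/ᵐ β γ)

  *ᵐ-/ᵐ-divisor : ∀ {n} (α : Vec ℕ n) {β} → β ∈ divisors α → β *ᵐ (α /ᵐ β) ≡ α
  *ᵐ-/ᵐ-divisor []      {[]} _ = refl
  *ᵐ-/ᵐ-divisor (a ∷ α) {b ∷ β} β∈ with ∈-cartesianProductWith⁻ _∷_ (upTo (suc a)) (divisors α) β∈
  ... | _ , _ , b∈ , β∈′ , refl = cong₂ _∷_ (ℕ.m+[n∸m]≡n (ℕ.≤-pred (∈-upTo⁻ b∈))) (*ᵐ-/ᵐ-divisor α β∈′)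

  module FormalSums (R : Ring≡) where
    open Ring≡ R
    open Sums R
    open SubsetSums R
    open SemiringSolver using (solve; _:+_; _:*_; _:=_)

    infixr 9 _^_
    _^_ : Carrier → ℕ → Carrier
    x ^ zero  = 1#
    x ^ suc n = x * x ^ n

    ^-+ : ∀ x m n → x ^ (m ℕ.+ n) ≡ x ^ m * x ^ n
    ^-+ x zero    n = sym (*-identityˡ _)
    ^-+ x (suc m) n = trans (cong (x *_) (^-+ x m n)) (sym (*-assoc x _ _))

    fromℕ : ℕ → Carrier
    fromℕ zero    = 0#
    fromℕ (suc n) = 1# + fromℕ n

    fromℕ-+ : ∀ m n → fromℕ (m ℕ.+ n) ≡ fromℕ m + fromℕ n
    fromℕ-+ zero    n = sym (+-identityˡ _)
    fromℕ-+ (suc m) n = trans (cong (1# +_) (fromℕ-+ m n)) (sym (+-assoc 1# _ _))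

    module _ {A : Set} (_≟_ : DecidableEquality A) where

      ∑-pick-∉ : ∀ {xs : List A} {b} (f : A → Carrier) → b ∉ xs → ∑ xs (λ c → 𝟙 (c ≟ b) * f c) ≡ 0#
      ∑-pick-∉ {xs} {b} f b∉ = trans (∑-cong-∈ xs λ {c} c∈ →
        trans (cong (_* f c) (𝟙-false (c ≟ b) λ { refl → b∉ c∈ })) (zeroˡ (f c))) (∑-0 xs)

      ∑-pick-∈ : ∀ {xs : List A} {b} (f : A → Carrier) → Unique xs → b ∈ xs → ∑ xs (λ c → 𝟙 (c ≟ b) * f c) ≡ f b
      ∑-pick-∈ {x ∷ xs} {b} f (x∉ ∷ u) (here refl) =
        trans (cong₂ _+_ (trans (cong (_* f b) (𝟙-true (b ≟ b) refl)) (*-identityˡ (f b)))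
                         (∑-pick-∉ f λ b∈ → All.lookup x∉ b∈ refl))
              (+-identityʳ (f b))
      ∑-pick-∈ {x ∷ xs} {b} f (x∉ ∷ u) (there b∈) =
        trans (cong₂ _+_ (trans (cong (_* f x) (𝟙-false (x ≟ b) (All.lookup x∉ b∈))) (zeroˡ (f x)))
                         (∑-pick-∈ f u b∈))
              (+-identityˡ (f b))

    ∑-upTo-suc : ∀ n (f : ℕ → Carrier) → ∑ (upTo (suc n)) f ≡ f 0 + ∑ (upTo n) (f ∘ suc)
    ∑-upTo-suc n f = cong (f 0 +_) (trans (cong (λ xs → ∑ xs f) (sym (map-upTo suc n))) (∑-map suc (upTo n) f))

    ∑-upTo-snoc : ∀ n (f : ℕ → Carrier) → ∑ (upTo (suc n)) f ≡ ∑ (upTo n) f + f n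
    ∑-upTo-snoc zero    f = +-comm (f 0) 0#
    ∑-upTo-snoc (suc n) f = begin
      ∑ (upTo (suc (suc n))) f                        ≡⟨ ∑-upTo-suc (suc n) f ⟩
      f 0 + ∑ (upTo (suc n)) (f ∘ suc)                ≡⟨ cong (f 0 +_) (∑-upTo-snoc n (f ∘ suc)) ⟩
      f 0 + (∑ (upTo n) (f ∘ suc) + f (suc n))        ≡⟨ sym (+-assoc (f 0) _ _) ⟩
      (f 0 + ∑ (upTo n) (f ∘ suc)) + f (suc n)        ≡⟨ cong (_+ f (suc n)) (sym (∑-upTo-suc n f)) ⟩
      ∑ (upTo (suc n)) f + f (suc n)                  ∎
      where open ≡-Reasoning

    binomial : ∀ n y → ∑ (upTo (suc n)) (λ a → fromℕ (n C a) * y ^ a) ≡ (1# + y) ^ n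
    binomial zero    y = trans (+-identityʳ _) (trans (*-identityʳ _) (+-identityʳ 1#))
    binomial (suc n) y = begin
      B (suc n) (suc (suc n))
        ≡⟨ ∑-upTo-suc (suc n) _ ⟩
      b + ∑ (upTo (suc n)) (λ a → fromℕ (suc n C suc a) * (y * y ^ a))
        ≡⟨ cong (b +_) (∑-cong (upTo (suc n)) pascal) ⟩
      b + ∑ (upTo (suc n)) (λ a → y * (fromℕ (n C a) * y ^ a) + fromℕ (n C suc a) * (y * y ^ a))
        ≡⟨ cong (b +_) (∑-+ (upTo (suc n)) _ _) ⟩
      b + (∑ (upTo (suc n)) (λ a → y * (fromℕ (n C a) * y ^ a)) + ∑ (upTo (suc n)) (λ a → fromℕ (n C suc a) * (y * y ^ a)))
        ≡⟨ regroup _ _ _ ⟩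
      (b + ∑ (upTo (suc n)) (λ a → fromℕ (n C suc a) * (y * y ^ a))) + ∑ (upTo (suc n)) (λ a → y * (fromℕ (n C a) * y ^ a))
        ≡⟨ cong₂ _+_ (sym (∑-upTo-suc (suc n) (λ a → fromℕ (n C a) * y ^ a))) (∑-*ˡ (upTo (suc n)) y _) ⟩
      B n (suc (suc n)) + y * B n (suc n)
        ≡⟨ cong (_+ y * B n (suc n)) (trans (∑-upTo-snoc (suc n) _) (trans (cong (B n (suc n) +_) top) (+-identityʳ _))) ⟩
      B n (suc n) + y * B n (suc n)
        ≡⟨ cong (λ s → s + y * s) (binomial n y) ⟩
      (1# + y) ^ n + y * (1# + y) ^ n
        ≡⟨ cong (_+ y * (1# + y) ^ n) (sym (*-identityˡ _)) ⟩
      1# * (1# + y) ^ n + y * (1# + y) ^ n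
        ≡⟨ sym (distribʳ _ 1# y) ⟩
      (1# + y) * (1# + y) ^ n ∎
      where
      open ≡-Reasoning
      B : ℕ → ℕ → Carrier
      B m k = ∑ (upTo k) (λ a → fromℕ (m C a) * y ^ a)
      b = fromℕ (n C 0) * y ^ 0
      pascal : ∀ a → fromℕ (suc n C suc a) * (y * y ^ a) ≡ y * (fromℕ (n C a) * y ^ a) + fromℕ (n C suc a) * (y * y ^ a)
      pascal a = trans (cong (λ c → fromℕ c * (y * y ^ a)) (sym (nCk+nC[k+1]≡[n+1]C[k+1] n a)))
        (trans (cong (_* (y * y ^ a)) (fromℕ-+ (n C a) (n C suc a))) (expand _ _ y (y ^ a)))
        where
        expand : ∀ c d y z → (c + d) * (y * z) ≡ y * (c * z) + d * (y * z)
        expand = solve 4 (λ c d y z → (c :+ d) :* (y :* z) := y :* (c :* z) :+ d :* (y :* z)) refl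
      regroup : ∀ a b c → a + (b + c) ≡ (a + c) + b
      regroup = solve 3 (λ a b c → a :+ (b :+ c) := (a :+ c) :+ b) refl
      top : fromℕ (n C suc n) * y ^ suc n ≡ 0#
      top = trans (cong (λ c → fromℕ c * y ^ suc n) (k>n⇒nCk≡0 (ℕ.n<1+n n))) (zeroˡ _)

    δ : ∀ {n} → Vec ℕ n → Vec ℕ n → Carrier
    δ β α = 𝟙 (α ≟ᵐ β)

    infixl 7 _⋆_
    _⋆_ : ∀ {n} → (Vec ℕ n → Carrier) → (Vec ℕ n → Carrier) → Vec ℕ n → Carrier
    (f ⋆ g) α = ∑ (divisors α) λ β → f β * g (α /ᵐ β)

    δ-⋆ : ∀ {n} (β γ α : Vec ℕ n) → (δ β ⋆ δ γ) α ≡ δ (β *ᵐ γ) α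
    δ-⋆ β γ α with α ≟ᵐ (β *ᵐ γ)
    ... | yes refl = trans (∑-pick-∈ _≟ᵐ_ (λ β′ → δ γ (α /ᵐ β′)) (divisors-unique α) (∈-divisors-*ᵐ β γ))
                       (𝟙-true ((α /ᵐ β) ≟ᵐ γ) (*ᵐ-/ᵐ β γ))
    ... | no ≢ = trans (∑-cong-∈ (divisors α) {g = λ _ → 0#} term) (∑-0 (divisors α))
      where
      term : ∀ {β′} → β′ ∈ divisors α → δ β β′ * δ γ (α /ᵐ β′) ≡ 0#
      term {β′} β∈ with β′ ≟ᵐ β
      ... | no _ = zeroˡ _
      ... | yes refl = trans (cong (1# *_) (𝟙-false ((α /ᵐ β) ≟ᵐ γ) λ { refl → ≢ (sym (*ᵐ-/ᵐ-divisor α β∈)) })) (zeroʳ 1#)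

    module _ {n : ℕ} where

      FormalSum : Set
      FormalSum = List (Carrier × Vec ℕ n)

      coef : FormalSum → Vec ℕ n → Carrier
      coef L α = ∑ L λ (c , β) → c * δ β α

      _∙_ : FormalSum → FormalSum → FormalSum
      _∙_ = cartesianProductWith λ (c , β) (d , γ) → c * d , β *ᵐ γ

      coef-∙ : ∀ L M α → (coef L ⋆ coef M) α ≡ coef (L ∙ M) α
      coef-∙ L M α = begin
        ∑ (divisors α) (λ β → ∑ L (λ (c , β₁) → c * δ β₁ β) * ∑ M (λ (d , β₂) → d * δ β₂ (α /ᵐ β)))
          ≡⟨ ∑-cong (divisors α) (λ β → trans (sym (∑-*ʳ L _ _)) (∑-cong L λ (c , β₁) → sym (∑-*ˡ M _ _))) ⟩
        ∑ (divisors α) (λ β → ∑ L (λ (c , β₁) → ∑ M (λ (d , β₂) → c * δ β₁ β * (d * δ β₂ (α /ᵐ β)))))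
          ≡⟨ trans (∑-swap (divisors α) L _) (∑-cong L λ _ → ∑-swap (divisors α) M _) ⟩
        ∑ L (λ (c , β₁) → ∑ M (λ (d , β₂) → ∑ (divisors α) (λ β → c * δ β₁ β * (d * δ β₂ (α /ᵐ β)))))
          ≡⟨ ∑-cong L (λ (c , β₁) → ∑-cong M λ (d , β₂) →
               trans (∑-cong (divisors α) λ β → *-interchange c _ d _) (trans (∑-*ˡ (divisors α) (c * d) _) (cong (c * d *_) (δ-⋆ β₁ β₂ α)))) ⟩
        ∑ L (λ (c , β₁) → ∑ M (λ (d , β₂) → c * d * δ (β₁ *ᵐ β₂) α))
          ≡⟨ sym (∑-cartesianProductWith _ L M _) ⟩
        coef (L ∙ M) α ∎
        where open ≡-Reasoning

      evalᵐ : (Fin n → Carrier) → Vec ℕ n → Carrier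
      evalᵐ x α = ∏ n λ i → x i ^ lookup α i

      evalᵐ-* : ∀ x α β → evalᵐ x (α *ᵐ β) ≡ evalᵐ x α * evalᵐ x β
      evalᵐ-* x α β = trans (∏-cong n λ i → trans (cong (x i ^_) (lookup-zipWith ℕ._+_ i α β)) (^-+ (x i) (lookup α i) (lookup β i))) (∏-* n _ _)

      evalᵐ-1 : ∀ x → evalᵐ x 1ᵐ ≡ 1#
      evalᵐ-1 x = ∏-1 n λ i → cong (x i ^_) (lookup-replicate i 0)

      eval : (Fin n → Carrier) → FormalSum → Carrier
      eval x L = ∑ L λ (c , β) → c * evalᵐ x β

      eval-∙ : ∀ x L M → eval x (L ∙ M) ≡ eval x L * eval x M
      eval-∙ x L M = trans (∑-cartesianProductWith _ L M _)
        (trans (∑-cong L λ (c , β) → trans (∑-cong M λ (d , γ) →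
            trans (cong (c * d *_) (evalᵐ-* x β γ)) (*-interchange c d _ _)) (∑-*ˡ M _ _))
          (∑-*ʳ L _ _))

      eval-support : ∀ x S L → Unique S → (∀ {t} → t ∈ L → proj₂ t ∈ S) →
        eval x L ≡ ∑ S (λ α → coef L α * evalᵐ x α)
      eval-support x S L u sup = sym (begin
        ∑ S (λ α → coef L α * evalᵐ x α)
          ≡⟨ ∑-cong S (λ α → sym (∑-*ʳ L _ _)) ⟩
        ∑ S (λ α → ∑ L (λ (c , β) → c * δ β α * evalᵐ x α))
          ≡⟨ ∑-swap S L _ ⟩
        ∑ L (λ (c , β) → ∑ S (λ α → c * δ β α * evalᵐ x α))
          ≡⟨ ∑-cong-∈ L (λ {(c , β)} t∈ → trans (∑-cong S λ α → *-assoc c _ _) (trans (∑-*ˡ S c _)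
               (cong (c *_) (∑-pick-∈ _≟ᵐ_ (evalᵐ x) u (sup t∈))))) ⟩
        eval x L ∎)
        where open ≡-Reasoning

      -- Both lists are collected over one duplicate-free list of all their monomials, where only
      -- the coefficients enter.
      eval-unique : ∀ x L M → (∀ α → coef L α ≡ coef M α) → eval x L ≡ eval x M
      eval-unique x L M eq =
        trans (eval-support x S L u λ t∈ → ∈-deduplicate⁺ _≟ᵐ_ (∈-++⁺ˡ (∈-map⁺ proj₂ t∈)))
        (trans (∑-cong S λ α → cong (_* evalᵐ x α) (eq α))
               (sym (eval-support x S M u λ t∈ → ∈-deduplicate⁺ _≟ᵐ_ (∈-++⁺ʳ (map proj₂ L) (∈-map⁺ proj₂ t∈)))))
        where
        S = deduplicate _≟ᵐ_ (map proj₂ L ++ map proj₂ M)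
        u : Unique S
        u = deduplicate-! _≟ᵐ_ (map proj₂ L ++ map proj₂ M)

      -- A bare coefficient function does not reveal a finite support, so evaluation is a relation
      -- that goes through some list representing the function. `HasValue-unique` makes the value
      -- well defined.
      HasValue : (Fin n → Carrier) → (Vec ℕ n → Carrier) → Carrier → Set
      HasValue x f v = ∃[ L ] (∀ α → f α ≡ coef L α) × eval x L ≡ v

      module _ {x : Fin n → Carrier} where

        HasValue-unique : ∀ {f g v w} → (∀ α → f α ≡ g α) → HasValue x f v → HasValue x g w → v ≡ w
        HasValue-unique eq (L , hf , refl) (M , hg , refl) =
          eval-unique x L M λ α → trans (sym (hf α)) (trans (eq α) (hg α))

        HasValue-cong : ∀ {f g v w} → (∀ α → f α ≡ g α) → v ≡ w → HasValue x g v → HasValue x f w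
        HasValue-cong eq refl (L , hg , hv) = L , (λ α → trans (eq α) (hg α)) , hv

        HasValue-δ : ∀ β → HasValue x (δ β) (evalᵐ x β)
        HasValue-δ β = (1# , β) ∷ [] , (λ α → sym (trans (+-identityʳ _) (*-identityˡ _))) ,
          trans (+-identityʳ _) (*-identityˡ _)

        HasValue-0 : HasValue x (λ _ → 0#) 0#
        HasValue-0 = [] , (λ _ → refl) , refl

        HasValue-+ : ∀ {f g v w} → HasValue x f v → HasValue x g w → HasValue x (λ α → f α + g α) (v + w)
        HasValue-+ (L , hf , refl) (M , hg , refl) =
          L ++ M , (λ α → trans (cong₂ _+_ (hf α) (hg α)) (sym (∑-++ L M _))) , ∑-++ L M _

        HasValue-scale : ∀ {f v} c → HasValue x f v → HasValue x (λ α → c * f α) (c * v)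
        HasValue-scale c (L , hf , refl) = map (λ (d , β) → c * d , β) L ,
          (λ α → trans (cong (c *_) (hf α)) (sym (trans (∑-map _ L _) (trans (∑-cong L λ (d , β) → *-assoc c d _) (∑-*ˡ L c _))))) ,
          trans (∑-map _ L _) (trans (∑-cong L λ (d , β) → *-assoc c d _) (∑-*ˡ L c _))

        HasValue-∑ : ∀ {A : Set} (xs : List A) {f : A → Vec ℕ n → Carrier} {v : A → Carrier} →
          (∀ i → HasValue x (f i) (v i)) → HasValue x (λ α → ∑ xs (λ i → f i α)) (∑ xs v)
        HasValue-∑ []       h = HasValue-0
        HasValue-∑ (i ∷ xs) h = HasValue-+ (h i) (HasValue-∑ xs h)

        HasValue-⋆ : ∀ {f g v w} → HasValue x f v → HasValue x g w → HasValue x (f ⋆ g) (v * w)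
        HasValue-⋆ (L , hf , refl) (M , hg , refl) = L ∙ M ,
          (λ α → trans (∑-cong (divisors α) λ β → cong₂ _*_ (hf β) (hg (α /ᵐ β))) (coef-∙ L M α)) ,
          eval-∙ x L M

    evalᵐ-x : ∀ {n} x (i : Fin n) a → evalᵐ x (x[ i ]^ a) ≡ x i ^ a
    evalᵐ-x x zero    a = trans (cong (x zero ^ a *_) (evalᵐ-1 (x ∘ suc))) (*-identityʳ _)
    evalᵐ-x x (suc i) a = trans (cong (1# *_) (evalᵐ-x (x ∘ suc) i a)) (*-identityˡ _)

-- Values of the generators and of X at the chosen point.

module SeriesValues where

  open CommutativeRings
  open WeightedSums
  open OrientationCounting
  open ColouringCounting
  open Cycles
  open Evaluation
  open import Data.Bool.Base using (true; false; if_then_else_)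
  open import Data.Empty using (⊥-elim)
  open import Data.Fin.Base as Fin using (Fin; zero; suc; toℕ; opposite)
  import Data.Fin.Properties as Fin
  open import Data.Fin.Subset using (⊤)
  open import Data.Fin.Subset.Properties using (∈⊤)
  open import Data.Integer.Base as ℤ using (ℤ; +_; -[1+_]; 0ℤ; _⊖_)
  import Data.Integer.Properties as ℤ
  open import Data.List.Base as List using (List; []; _∷_; map; filter; length; upTo; allFin)
  open import Data.List.Properties using (map-tabulate)
  open import Data.Nat.Base as ℕ using (ℕ; zero; suc; _∸_; _≤_; NonZero)
  import Data.Nat.Properties as ℕ
  open import Data.Nat.Combinatorics using (_C_)
  open import Data.Product using (_×_; _,_)
  open import Data.Sum.Base using (inj₁)
  open import Data.Vec.Base as Vec using (Vec; []; _∷_; lookup)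
  open import Data.Vec.Properties using (lookup-map; lookup-replicate)
  open import Function.Base using (_∘_; id)
  open import Relation.Binary.PropositionalEquality
  open import Relation.Nullary
  open import Defs using (SignedGraph; signed; allVecs; Index; value; index0; x[_]^_; _*ᵐ_; ∏x; Generator; ξ; q; z; ξ-weight; proper?; Proper)

  value-opposite : ∀ N i → value N (opposite i) ≡ ℤ.- value N i
  value-opposite N i = begin
    toℕ (opposite i) ⊖ N                  ≡⟨ cong (_⊖ N) (Fin.opposite-prop i) ⟩
    l ⊖ N                                 ≡⟨ sym (ℤ.+-cancelˡ-⊖ k l N) ⟩
    (k ℕ.+ l) ⊖ (k ℕ.+ N)                 ≡⟨ cong₂ _⊖_ (ℕ.m+[n∸m]≡n (ℕ.≤-pred (Fin.toℕ<n i))) (ℕ.+-comm k N) ⟩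
    (N ℕ.+ N) ⊖ (N ℕ.+ k)                 ≡⟨ ℤ.+-cancelˡ-⊖ N N k ⟩
    N ⊖ k                                 ≡⟨ ℤ.⊖-swap N k ⟩
    ℤ.- (k ⊖ N)                           ∎
    where
    open ≡-Reasoning
    k = toℕ i
    l = (N ℕ.+ N) ∸ k

  value-index0 : ∀ N → value N (index0 N) ≡ 0ℤ
  value-index0 N = trans (cong (_⊖ N) (trans (Fin.toℕ-↑ˡ (Fin.fromℕ N) N) (Fin.toℕ-fromℕ N))) (ℤ.n⊖n≡0 N)

  if-yes : ∀ {P A : Set} (P? : Dec P) {x y : A} → P → (if does P? then x else y) ≡ x
  if-yes (yes _) p = refl
  if-yes (no ¬p) p = ⊥-elim (¬p p)

  if-no : ∀ {P A : Set} (P? : Dec P) {x y : A} → ¬ P → (if does P? then x else y) ≡ y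
  if-no (yes p) ¬p = ⊥-elim (¬p p)
  if-no (no _)  ¬p = refl

  module Values (R : Ring≡) where
    open Ring≡ R
    open Sums R
    open SubsetSums R
    open FormalSums R

    ∑-allFin : ∀ n (f : Fin n → Carrier) (g : ℕ → Carrier) → (∀ i → f i ≡ g (toℕ i)) →
      ∑ (allFin n) f ≡ ∑ (upTo n) g
    ∑-allFin zero    f g h = refl
    ∑-allFin (suc n) f g h = begin
      f zero + ∑ (List.tabulate suc) f         ≡⟨ cong (λ xs → f zero + ∑ xs f) (sym (map-tabulate id suc)) ⟩
      f zero + ∑ (map suc (allFin n)) f        ≡⟨ cong (λ s → f zero + s) (∑-map suc (allFin n) f) ⟩
      f zero + ∑ (allFin n) (f ∘ suc)          ≡⟨ cong₂ _+_ (h zero) (∑-allFin n (f ∘ suc) (g ∘ suc) (h ∘ suc)) ⟩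
      g 0 + ∑ (upTo n) (g ∘ suc)               ≡⟨ sym (∑-upTo-suc n g) ⟩
      ∑ (upTo (suc n)) g                       ∎
      where open ≡-Reasoning

    ∑-value : ∀ N (f : ℤ → Carrier) → ∑ (allFin _) (f ∘ value N) ≡ ∑ (colours N) f
    ∑-value N f = trans (∑-allFin (suc (N ℕ.+ N)) (f ∘ value N) (λ k → f (k ⊖ N)) λ _ → refl) (go N)
      where
      -- Raising N by one shifts the old indices by one, which leaves their integers unchanged, and
      -- adds one index at either end: the two new extreme colours.
      go : ∀ N → ∑ (upTo (suc (N ℕ.+ N))) (λ k → f (k ⊖ N)) ≡ ∑ (colours N) f
      go zero    = refl
      go (suc N) = begin
        ∑ (upTo (suc (suc N ℕ.+ suc N))) (λ k → f (k ⊖ suc N))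
          ≡⟨ cong (λ n → ∑ (upTo (suc (suc n))) (λ k → f (k ⊖ suc N))) (ℕ.+-suc N N) ⟩
        ∑ (upTo (suc (suc (suc (N ℕ.+ N))))) (λ k → f (k ⊖ suc N))
          ≡⟨ ∑-upTo-suc (suc (suc (N ℕ.+ N))) _ ⟩
        f -[1+ N ] + ∑ (upTo (suc (suc (N ℕ.+ N)))) (λ k → f (suc k ⊖ suc N))
          ≡⟨ cong (λ s → f -[1+ N ] + s) (trans (∑-cong (upTo (suc (suc (N ℕ.+ N)))) λ k → cong f (ℤ.[1+m]⊖[1+n]≡m⊖n k N)) (∑-upTo-snoc (suc (N ℕ.+ N)) _)) ⟩
        f -[1+ N ] + (∑ (upTo (suc (N ℕ.+ N))) (λ k → f (k ⊖ N)) + f (suc (N ℕ.+ N) ⊖ N))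
          ≡⟨ cong₂ (λ s c → f -[1+ N ] + (s + f c)) (go N) top ⟩
        f -[1+ N ] + (∑ (colours N) f + f (+ suc N))
          ≡⟨ rotate _ _ _ ⟩
        f (+ suc N) + (f -[1+ N ] + ∑ (colours N) f) ∎
        where
        open ≡-Reasoning
        rotate : ∀ a b c → a + (b + c) ≡ c + (a + b)
        rotate a b c = trans (sym (+-assoc a b c)) (+-comm (a + b) c)
        top : suc (N ℕ.+ N) ⊖ N ≡ + suc N
        top = trans (ℤ.⊖-≥ (ℕ.≤-trans (ℕ.m≤m+n N N) (ℕ.n≤1+n _))) (cong +_ (ℕ.m+n∸n≡m (suc N) N))

    ∑-allVecs-map : ∀ {A B : Set} (h : A → B) xs ys → (∀ f → ∑ xs (f ∘ h) ≡ ∑ ys f) →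
      ∀ n (F : Vec B n → Carrier) → ∑ (allVecs xs n) (F ∘ Vec.map h) ≡ ∑ (allVecs ys n) F
    ∑-allVecs-map h xs ys eq zero    F = refl
    ∑-allVecs-map h xs ys eq (suc n) F = begin
      ∑ (allVecs xs (suc n)) (F ∘ Vec.map h)
        ≡⟨ ∑-cartesianProductWith _∷_ xs (allVecs xs n) _ ⟩
      ∑ xs (λ x → ∑ (allVecs xs n) (λ κ → F (h x ∷ Vec.map h κ)))
        ≡⟨ ∑-cong xs (λ x → ∑-allVecs-map h xs ys eq n (F ∘ (h x ∷_))) ⟩
      ∑ xs (λ x → ∑ (allVecs ys n) (λ κ → F (h x ∷ κ)))
        ≡⟨ eq (λ y → ∑ (allVecs ys n) (λ κ → F (y ∷ κ))) ⟩
      ∑ ys (λ y → ∑ (allVecs ys n) (λ κ → F (y ∷ κ)))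
        ≡⟨ sym (∑-cartesianProductWith _∷_ ys (allVecs ys n) F) ⟩
      ∑ (allVecs ys (suc n)) F ∎
      where open ≡-Reasoning

    ∏-count : ∀ {A : Set} {P : A → Set} (P? : ∀ x → Dec (P x)) t n (g : Fin n → A) →
      ∏ n (λ v → if does (P? (g v)) then t else 1#) ≡ t ^ length (filter P? (List.tabulate g))
    ∏-count P? t zero    g = refl
    ∏-count P? t (suc n) g with does (P? (g zero))
    ... | true  = cong (λ x → t * x) (∏-count P? t n (g ∘ suc))
    ... | false = trans (*-identityˡ _) (∏-count P? t n (g ∘ suc))

    0^suc : ∀ n → .{{NonZero n}} → 0# ^ n ≡ 0#
    0^suc (suc n) = zeroˡ _

    1^ : ∀ n → 1# ^ n ≡ 1#
    1^ zero    = refl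
    1^ (suc n) = trans (*-identityˡ _) (1^ n)

    *-^ : ∀ x y n → (x * y) ^ n ≡ x ^ n * y ^ n
    *-^ x y zero    = sym (*-identityˡ 1#)
    *-^ x y (suc n) = trans (cong (λ w → x * y * w) (*-^ x y n)) (*-interchange x y _ _)

    -1*-1 : - 1# * - 1# ≡ 1#
    -1*-1 = trans (sym (-‿distribˡ-* 1# (- 1#))) (trans (cong -_ (*-identityˡ (- 1#))) (-‿involutive 1#))

    fromℕ-poly : IsPoly fromℕ
    fromℕ-poly = 2 , PolySeq-cong 1 (λ j → sym (trans (+-assoc 1# _ _) (trans (cong (λ x → 1# + x) (-‿inverseʳ _)) (+-identityʳ 1#)))) (PolySeq-const 1#)

    module AtPoint (t : Carrier) where

      s : Carrier
      s = t - 1#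

      1+s : 1# + s ≡ t
      1+s = trans (+-comm 1# s) (trans (+-assoc t (- 1#) 1#) (trans (cong (λ x → t + x) (-‿inverseˡ 1#)) (+-identityʳ t)))

      -- The point x_N = t - 1, x_{-N} = 0 and x_i = -1 otherwise, where N = m + 1.
      abstract
        weight : ℕ → ℤ → Carrier
        weight m c = if does (c ℤ.≟ + suc m) then s else if does (c ℤ.≟ -[1+ m ]) then 0# else - 1#

        weight-top : ∀ m → weight m (+ suc m) ≡ s
        weight-top m = if-yes (+ suc m ℤ.≟ + suc m) refl

        weight-bottom : ∀ m → weight m -[1+ m ] ≡ 0#
        weight-bottom m = if-yes (-[1+ m ] ℤ.≟ -[1+ m ]) refl

        weight-small : ∀ m c → ℤ.∣ c ∣ ≤ m → weight m c ≡ - 1#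
        weight-small m c c≤ = trans
          (if-no (c ℤ.≟ + suc m) λ { refl → ℕ.1+n≰n c≤ })
          (if-no (c ℤ.≟ -[1+ m ]) λ { refl → ℕ.1+n≰n c≤ })

      point : ∀ m → Index (suc m) → Carrier
      point m i = weight m (value (suc m) i)

      -- For j ≥ 1 the number of colours in [-(j-1) , j-1].
      odd : ℕ → Carrier
      odd j = fromℕ j + fromℕ j - 1#

      odd-poly : IsPoly odd
      odd-poly = IsPoly-+ (IsPoly-+ fromℕ-poly fromℕ-poly) (IsPoly-const (- 1#))

      odd-colours : ∀ m → ∑ (colours m) (λ _ → 1#) ≡ odd (suc m)
      odd-colours zero    = sym (trans (step 0# 0#) (cong (λ x → 1# + x) (+-identityˡ 0#)))
        where
        step : ∀ a b → 1# + a + (1# + b) - 1# ≡ 1# + (a + b)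
        step a b = trans (cong (λ x → x - 1#) (trans (interchange 1# a 1# b) (+-assoc 1# 1# (a + b))))
          (trans (+-comm _ (- 1#)) (trans (sym (+-assoc (- 1#) 1# _)) (trans (cong (λ x → x + (1# + (a + b))) (-‿inverseˡ 1#)) (+-identityˡ _))))
      odd-colours (suc m) = trans (cong (λ x → 1# + (1# + x)) (odd-colours m))
        (sym (trans (cong (λ x → x - 1#) (trans (interchange 1# _ 1# _) (+-assoc 1# 1# _)))
          (trans (+-assoc 1# _ _) (cong (λ x → 1# + x) (+-assoc 1# _ _)))))

      -- The first summand comes from the ordinary colours, the other two from i = N and i = -N.
      -- Since 0^0 = 1, the power `0# ^ b` is the bracket [b = 0].
      powerSumValue : ℕ → ℕ → ℕ → Carrier
      powerSumValue a b j = odd j * ((- 1#) ^ a * (- 1#) ^ b) + (s ^ a * 0# ^ b + 0# ^ a * s ^ b)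

      powerSumValue-poly : ∀ a b → IsPoly (powerSumValue a b)
      powerSumValue-poly a b = IsPoly-+ (IsPoly-* odd-poly (IsPoly-const _)) (IsPoly-const _)

      powerSumValue-suc : ∀ a b m → ∑ (allFin _) (λ i → point m i ^ a * point m (opposite i) ^ b) ≡ powerSumValue a b (suc m)
      powerSumValue-suc a b m = begin
        ∑ (allFin _) (λ i → point m i ^ a * point m (opposite i) ^ b)
          ≡⟨ ∑-cong (allFin _) (λ i → cong (λ c → point m i ^ a * weight m c ^ b) (value-opposite (suc m) i)) ⟩
        ∑ (allFin _) (λ i → f (value (suc m) i))
          ≡⟨ ∑-value (suc m) f ⟩
        f (+ suc m) + (f -[1+ m ] + ∑ (colours m) f)
          ≡⟨ cong₂ _+_ (cong₂ (λ x y → x ^ a * y ^ b) (weight-top m) (weight-bottom m))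
               (cong₂ _+_ (cong₂ (λ x y → x ^ a * y ^ b) (weight-bottom m) (weight-top m)) low) ⟩
        s ^ a * 0# ^ b + (0# ^ a * s ^ b + odd (suc m) * e)
          ≡⟨ trans (sym (+-assoc _ _ _)) (+-comm _ _) ⟩
        powerSumValue a b (suc m) ∎
        where
        open ≡-Reasoning
        e = (- 1#) ^ a * (- 1#) ^ b
        f : ℤ → Carrier
        f c = weight m c ^ a * weight m (ℤ.- c) ^ b
        low : ∑ (colours m) f ≡ odd (suc m) * e
        low = trans (∑-cong-∈ (colours m) λ {c} c∈ → trans
                (cong₂ (λ x y → x ^ a * y ^ b) (weight-small m c (colours-bounded m c∈))
                   (weight-small m (ℤ.- c) (subst (_≤ m) (sym (ℤ.∣-i∣≡∣i∣ c)) (colours-bounded m c∈))))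
                (sym (*-identityˡ e)))
          (trans (∑-*ʳ (colours m) e (λ _ → 1#)) (cong (_* e) (odd-colours m)))

      -- At j = 0 there are formally -1 ordinary colours: the reason for extrapolating to this
      -- argument.
      odd-0 : odd 0 ≡ - 1#
      odd-0 = trans (cong (λ x → x - 1#) (+-identityˡ 0#)) (+-identityˡ _)

      -- Polynomials in j; the value of the series at the point for m is taken at j = m + 1.
      generatorValue : Generator → ℕ → Carrier
      generatorValue (ξ n)   j = ∑ (map suc (upTo n)) λ a → fromℕ (n C a) * powerSumValue a 0 j
      generatorValue (q a b) j = (- 1#) ^ (a ℕ.+ b ℕ.+ 1) * powerSumValue a b j
      generatorValue z       j = 1#

      generatorValue-poly : ∀ g → IsPoly (generatorValue g)
      generatorValue-poly (ξ n)   = IsPoly-∑ (map suc (upTo n)) λ a → IsPoly-* (IsPoly-const _) (powerSumValue-poly a 0)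
      generatorValue-poly (q a b) = IsPoly-* (IsPoly-const _) (powerSumValue-poly a b)
      generatorValue-poly z       = IsPoly-const 1#

      -- For q both terms with s contain a positive power of 0, and the remaining -(-1)^(a+b)
      -- cancels against the sign in q. For ξ the sum may be started at a = 0, where (t - 1)^0 -
      -- (-1)^0 = 0; the binomial theorem then gives t^n - 0^n, with n ≥ 1.
      generatorValue-0 : ∀ g → generatorValue g 0 ≡ t ^ ξ-weight (g ∷ [])
      generatorValue-0 z = refl
      generatorValue-0 (q a b) = begin
        (- 1#) ^ (a ℕ.+ b ℕ.+ 1) * powerSumValue a b 0
          ≡⟨ cong₂ _*_ (trans (^-+ (- 1#) (a ℕ.+ b) 1) (cong₂ _*_ (^-+ (- 1#) a b) (*-identityʳ (- 1#))))
               (trans (cong₂ _+_ (cong (_* e) odd-0) (trans (cong₂ _+_ (trans (cong (λ x → s ^ a * x) (0^suc b)) (zeroʳ _)) (trans (cong (_* s ^ b) (0^suc a)) (zeroˡ _))) (+-identityˡ 0#))) (+-identityʳ _)) ⟩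
        (e * - 1#) * (- 1# * e)
          ≡⟨ trans (*-interchange e (- 1#) (- 1#) e) (cong₂ _*_ refl (*-comm (- 1#) e)) ⟩
        (e * - 1#) * (e * - 1#)
          ≡⟨ trans (*-interchange e (- 1#) e (- 1#)) (cong₂ _*_ ee -1*-1) ⟩
        1# * 1#
          ≡⟨ *-identityˡ 1# ⟩
        1# ∎
        where
        open ≡-Reasoning
        e = (- 1#) ^ a * (- 1#) ^ b
        square : ∀ n → (- 1#) ^ n * (- 1#) ^ n ≡ 1#
        square n = trans (sym (*-^ (- 1#) (- 1#) n)) (trans (cong (_^ n) -1*-1) (1^ n))
        ee : e * e ≡ 1#
        ee = trans (*-interchange _ _ _ _) (trans (cong₂ _*_ (square a) (square b)) (*-identityˡ 1#))
      generatorValue-0 (ξ (suc n)) = begin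
        ∑ (map suc (upTo N)) (λ a → fromℕ (N C a) * powerSumValue a 0 0)
          ≡⟨ ∑-map suc (upTo N) _ ⟩
        ∑ (upTo N) (λ a → fromℕ (N C suc a) * powerSumValue (suc a) 0 0)
          ≡⟨ ∑-cong (upTo N) (λ a → cong (λ x → fromℕ (N C suc a) * x) (powerSumValue-0 a)) ⟩
        ∑ (upTo N) (λ a → h (suc a))
          ≡⟨ sym (trans (cong (_+ ∑ (upTo N) (h ∘ suc)) h-0) (+-identityˡ _)) ⟩
        h 0 + ∑ (upTo N) (h ∘ suc)
          ≡⟨ sym (∑-upTo-suc N h) ⟩
        ∑ (upTo (suc N)) h
          ≡⟨ trans (∑-cong (upTo (suc N)) λ a → distribˡ (fromℕ (N C a)) (s ^ a) (- 1# * (- 1#) ^ a)) (∑-+ (upTo (suc N)) _ _) ⟩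
        ∑ (upTo (suc N)) (λ a → fromℕ (N C a) * s ^ a) + ∑ (upTo (suc N)) (λ a → fromℕ (N C a) * (- 1# * (- 1#) ^ a))
          ≡⟨ cong₂ _+_ (trans (binomial N s) (cong (_^ N) 1+s)) second ⟩
        t ^ N + 0#
          ≡⟨ +-identityʳ _ ⟩
        t ^ N
          ≡⟨ cong (t ^_) (sym (ℕ.+-identityʳ N)) ⟩
        t ^ (N ℕ.+ 0) ∎
        where
        open ≡-Reasoning
        N = suc n
        h : ℕ → Carrier
        h a = fromℕ (N C a) * (s ^ a + - 1# * (- 1#) ^ a)
        h-0 : h 0 ≡ 0#
        h-0 = trans (cong (λ x → fromℕ (N C 0) * x) (trans (cong (λ x → 1# + x) (*-identityʳ (- 1#))) (-‿inverseʳ 1#))) (zeroʳ _)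
        powerSumValue-0 : ∀ a → powerSumValue (suc a) 0 0 ≡ s ^ suc a + - 1# * (- 1#) ^ suc a
        powerSumValue-0 a = trans (cong₂ _+_ (cong₂ _*_ odd-0 (*-identityʳ _))
                   (trans (cong₂ _+_ (*-identityʳ _) (trans (cong (_* 1#) (zeroˡ (0# ^ a))) (zeroˡ 1#))) (+-identityʳ _)))
                 (+-comm _ _)
        second : ∑ (upTo (suc N)) (λ a → fromℕ (N C a) * (- 1# * (- 1#) ^ a)) ≡ 0#
        second = begin
          ∑ (upTo (suc N)) (λ a → fromℕ (N C a) * (- 1# * (- 1#) ^ a))
            ≡⟨ ∑-cong (upTo (suc N)) (λ a → swap (fromℕ (N C a)) (- 1#) _) ⟩
          ∑ (upTo (suc N)) (λ a → - 1# * (fromℕ (N C a) * (- 1#) ^ a))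
            ≡⟨ trans (∑-*ˡ (upTo (suc N)) (- 1#) _) (cong (λ x → - 1# * x) (trans (binomial N (- 1#)) (cong (_^ N) (-‿inverseʳ 1#)))) ⟩
          - 1# * 0# ^ N
            ≡⟨ trans (cong (λ x → - 1# * x) (0^suc N)) (zeroʳ _) ⟩
          0# ∎
          where
          swap : ∀ a b c → a * (b * c) ≡ b * (a * c)
          swap a b c = trans (sym (*-assoc a b c)) (trans (cong (_* c) (*-comm a b)) (*-assoc b a c))

      monomialValue : List Generator → ℕ → Carrier
      monomialValue []       j = 1#
      monomialValue (g ∷ gs) j = generatorValue g j * monomialValue gs j

      monomialValue-poly : ∀ gs → IsPoly (monomialValue gs)
      monomialValue-poly []       = IsPoly-const 1#
      monomialValue-poly (g ∷ gs) = IsPoly-* (generatorValue-poly g) (monomialValue-poly gs)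

      monomialValue-0 : ∀ gs → monomialValue gs 0 ≡ t ^ ξ-weight gs
      monomialValue-0 []       = refl
      monomialValue-0 (g ∷ gs) = trans (cong₂ _*_ (generatorValue-0 g) (monomialValue-0 gs)) (trans (sym (^-+ t (ξ-weight (g ∷ [])) (ξ-weight gs))) (cong (t ^_) (additive g)))
        where
        additive : ∀ g → ξ-weight (g ∷ []) ℕ.+ ξ-weight gs ≡ ξ-weight (g ∷ gs)
        additive (ξ n)   = cong (ℕ._+ ξ-weight gs) (ℕ.+-identityʳ n)
        additive (q a b) = refl
        additive z       = refl

      polynomialValue : List (Carrier × List Generator) → ℕ → Carrier
      polynomialValue P j = ∑ P λ (c , gs) → c * monomialValue gs j

      polynomialValue-poly : ∀ P → IsPoly (polynomialValue P)
      polynomialValue-poly P = IsPoly-∑ P λ (c , gs) → IsPoly-* (IsPoly-const c) (monomialValue-poly gs)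

      powerSum-hasValue : ∀ a b m → HasValue (point m)
        (λ α → ∑ (allFin _) λ (i : Index (suc m)) → δ ((x[ i ]^ a) *ᵐ (x[ opposite i ]^ b)) α) (powerSumValue a b (suc m))
      powerSum-hasValue a b m = HasValue-cong {x = point m} (λ _ → refl) (powerSumValue-suc a b m)
        (HasValue-∑ {x = point m} (allFin _) λ i → HasValue-cong {x = point m} (λ _ → refl)
          (trans (evalᵐ-* (point m) (x[ i ]^ a) (x[ opposite i ]^ b)) (cong₂ _*_ (evalᵐ-x (point m) i a) (evalᵐ-x (point m) (opposite i) b)))
          (HasValue-δ {x = point m} ((x[ i ]^ a) *ᵐ (x[ opposite i ]^ b))))

      -- Here N = m + 1 is positive, so the colour 0 differs from ±N and x_0 has the ordinary value
      -- -1.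
      z-hasValue : ∀ m → HasValue (point m) (λ α → - δ (x[ index0 (suc m) ]^ 1) α) 1#
      z-hasValue m = HasValue-cong {x = point m} (λ α → trans (cong -_ (sym (*-identityˡ _))) (-‿distribˡ-* 1# _))
        (trans (cong (λ x → - 1# * x) (trans (evalᵐ-x (point m) (index0 (suc m)) 1)
          (trans (*-identityʳ _) (trans (cong (weight m) (value-index0 (suc m))) (weight-small m 0ℤ ℕ.z≤n))))) -1*-1)
        (HasValue-scale {x = point m} (- 1#) (HasValue-δ {x = point m} (x[ index0 (suc m) ]^ 1)))

    module Graph (G : SignedGraph) (t : Carrier) where
      open SignedGraph G
      open Orientations G
      open Counting R
      open Colourings G R
      open Layers R
      open Walks G
      open AtPoint t

      tilt : Label → Carrier
      tilt free   = 1#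
      tilt sink   = s
      tilt source = 0#

      graphValue : ℕ → Carrier
      graphValue j = transfer tilt (signedCount j) ⊤

      graphValue-poly : IsPoly graphValue
      graphValue-poly = IsPoly-∑on tilt refl ⊤ (λ j σ → noClashes σ * signedCount j (freeIn ⊤ σ)) λ {σ} _ →
        IsPoly-* (IsPoly-const _) (signedCount-poly _ (freeIn ⊤ σ) ℕ.≤-refl)

      graphValue-0 : graphValue 0 ≡ ∑ orientations (λ o → 𝟙 (¬? (cyclic? ⊤ o)) * t ^ sinks o)
      graphValue-0 = trans (transfer-acyclics tilt ⊤) (∑-cong orientations λ o →
        trans (cong₂ _*_ (∏-1 #E λ e → 𝟙-true (default? ⊤ e (lookup o e)) (inj₁ λ _ → ∈⊤))
                         (cong (λ x → 𝟙 (¬? (cyclic? ⊤ o)) * x) (sinkWeight o)))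
              (*-identityˡ _))
        where
        vertexWeight : ∀ o v → ∑ labels (λ x → tilt x * 𝟙 (matches? ⊤ o v x)) ≡ (if does (matches? ⊤ o v sink) then t else 1#)
        vertexWeight o v = trans (cong₂ _+_ (*-identityˡ 1#) (cong (λ x → s * 𝟙 (matches? ⊤ o v sink) + x)
                                   (trans (cong (_+ 0#) (zeroˡ (𝟙 (matches? ⊤ o v source)))) (+-identityˡ 0#))))
                                 (by (does (matches? ⊤ o v sink)))
          where
          by : ∀ b → 1# + (s * (if b then 1# else 0#) + 0#) ≡ (if b then t else 1#)
          by true  = trans (cong (λ x → 1# + x) (trans (+-identityʳ _) (*-identityʳ s))) 1+s
          by false = trans (cong (λ x → 1# + x) (trans (+-identityʳ _) (zeroʳ s))) (+-identityʳ 1#)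
        sinkWeight : ∀ o → ∏ #V (λ v → if lookup ⊤ v then ∑ labels (λ x → tilt x * 𝟙 (matches? ⊤ o v x)) else 1#) ≡ t ^ sinks o
        sinkWeight o = trans (∏-cong #V λ v → trans (cong (λ b → if b then ∑ labels (λ x → tilt x * 𝟙 (matches? ⊤ o v x)) else 1#) (lookup-replicate v true))
                                                    (vertexWeight o v))
                             (∏-count (λ v → matches? ⊤ o v sink) t #V id)

      -- Only the outermost layer ±N has special weights. Below it every colour weighs -1, and what
      -- is left is `signedCount`.
      graphValue-suc : ∀ m → graphValue (suc m) ≡ colourings (weight m) (suc m) ⊤
      graphValue-suc m = trans
        (transfer-cong tilt (λ U → trans (signedCount-suc m U)
          (∑on-cong 0ℤ (colours m) U (λ {c} c∈ → sym (weight-small m c (colours-bounded m c∈))) (λ _ → refl))) ⊤)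
        (sym (colourings-layer m (weight m) tilt refl (sym (weight-top m)) (sym (weight-bottom m)) ⊤))

      evalᵐ-∏x : ∀ {n k} (x : Fin n → Carrier) (κ : Vec (Fin n) k) → evalᵐ x (∏x κ) ≡ ∏ k (λ v → x (lookup κ v))
      evalᵐ-∏x x []      = evalᵐ-1 x
      evalᵐ-∏x x (i ∷ κ) = trans (evalᵐ-* x (x[ i ]^ 1) (∏x κ)) (cong₂ _*_ (trans (evalᵐ-x x i 1) (*-identityʳ _)) (evalᵐ-∏x x κ))

      graph-hasValue : ∀ m → HasValue (point m)
        (λ α → ∑ (filter (λ κ → proper? G (value (suc m) ∘ lookup κ)) (allVecs (allFin _) #V)) λ κ → δ (∏x κ) α) (graphValue (suc m))
      graph-hasValue m = HasValue-cong {x = point m} (λ _ → refl) total (HasValue-∑ {x = point m} (filter good? κs) λ κ → HasValue-δ {x = point m} (∏x κ))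
        where
        N = suc m
        κs : List (Vec (Index N) #V)
        κs = allVecs (allFin _) #V
        good? : ∀ κ → Dec (Proper G (value N ∘ lookup κ))
        good? κ = proper? G (value N ∘ lookup κ)
        F : Vec ℤ #V → Carrier
        F κ = ∏ #V (λ v → weight m (lookup κ v)) * 𝟙 (properOn? ⊤ κ)
        same : ∀ κ → 𝟙 (good? κ) * evalᵐ (point m) (∏x κ) ≡ F (Vec.map (value N) κ)
        same κ = trans (*-comm _ _) (cong₂ _*_
          (trans (evalᵐ-∏x (point m) κ) (∏-cong #V λ v → cong (weight m) (sym (lookup-map v (value N) κ))))
          (𝟙-⇔ (good? κ) (properOn? ⊤ (Vec.map (value N) κ))
            (λ pr e _ eq → pr e (trans (sym (lookup-map _ (value N) κ)) (trans eq (cong (signed (sgn e)) (lookup-map _ (value N) κ)))))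
            (λ pr e eq → pr e (λ _ → ∈⊤) (trans (lookup-map _ (value N) κ) (trans eq (cong (signed (sgn e)) (sym (lookup-map _ (value N) κ))))))))
        total : ∑ (filter good? κs) (λ κ → evalᵐ (point m) (∏x κ)) ≡ graphValue (suc m)
        total = begin
          ∑ (filter good? κs) (λ κ → evalᵐ (point m) (∏x κ))      ≡⟨ ∑-filter good? κs _ ⟩
          ∑ κs (λ κ → 𝟙 (good? κ) * evalᵐ (point m) (∏x κ))       ≡⟨ ∑-cong κs same ⟩
          ∑ κs (F ∘ Vec.map (value N))                            ≡⟨ ∑-allVecs-map (value N) (allFin _) (colours N) (∑-value N) #V F ⟩
          ∑ (allVecs (colours N) #V) F                            ≡⟨ ∑-allVecs 0ℤ (weight m) (colours N) (λ κ → 𝟙 (properOn? ⊤ κ)) ⟩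
          colourings (weight m) N ⊤                               ≡⟨ sym (graphValue-suc m) ⟩
          graphValue (suc m) ∎
          where open ≡-Reasoning

      -- Both sides are polynomial in j and agree for j ≥ 1, hence for j = 0.
      compare : ∀ P → (∀ m → polynomialValue P (suc m) ≡ graphValue (suc m)) →
        ∑ P (λ (c , gs) → c * t ^ ξ-weight gs) ≡ ∑ orientations (λ o → 𝟙 (¬? (cyclic? ⊤ o)) * t ^ sinks o)
      compare P eq = begin
        ∑ P (λ (c , gs) → c * t ^ ξ-weight gs)   ≡⟨ ∑-cong P (λ (c , gs) → cong (λ x → c * x) (sym (monomialValue-0 gs))) ⟩
        polynomialValue P 0                      ≡⟨ agree₀ ⟩
        graphValue 0                             ≡⟨ graphValue-0 ⟩
        ∑ orientations (λ o → 𝟙 (¬? (cyclic? ⊤ o)) * t ^ sinks o) ∎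
        where
        open ≡-Reasoning
        agree₀ : polynomialValue P 0 ≡ graphValue 0
        agree₀ = IsPoly-agree (polynomialValue-poly P) graphValue-poly eq

-- Recovering coefficients from values at natural numbers.

module CoefficientComparison where

  open CommutativeRings
  open WeightedSums
  open Evaluation
  open SeriesValues
  open import Data.List.Base as List using (List; []; _∷_; filter; length; upTo)
  open import Data.List.Membership.Propositional using (_∈_)
  open import Data.List.Membership.Propositional.Properties using (∈-upTo⁺)
  open import Data.List.Relation.Unary.Any using (here; there)
  import Data.List.Relation.Unary.Unique.Propositional.Properties as Unique
  open import Data.Nat.Base as ℕ using (ℕ; zero; suc; _<_; s≤s)
  import Data.Nat.Properties as ℕ
  open import Data.Product using (_,_; proj₁; proj₂; ∃-syntax)
  open import Function.Base using (_∘_)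
  open import Relation.Binary.PropositionalEquality
  open import Relation.Nullary

  bounded : ∀ {A : Set} (d : A → ℕ) (xs : List A) → ∃[ M ] (∀ {x} → x ∈ xs → d x < M)
  bounded d []       = 0 , λ ()
  bounded d (x ∷ xs) with bounded d xs
  ... | M , h = suc (d x) ℕ.⊔ M , λ
    { (here refl) → ℕ.m≤m⊔n (suc (d x)) M
    ; (there x∈)  → ℕ.≤-trans (h x∈) (ℕ.m≤n⊔m (suc (d x)) M) }

  module Extraction (R : Ring≡) where
    open Ring≡ R
    open FormalSums R
    open Sums R
    open SubsetSums R
    open Values R

    ∑-𝟙 : ∀ {A : Set} {P : A → Set} (P? : ∀ x → Dec (P x)) xs → ∑ xs (λ x → 𝟙 (P? x)) ≡ fromℕ (length (filter P? xs))
    ∑-𝟙 P? []       = refl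
    ∑-𝟙 P? (x ∷ xs) with P? x
    ... | yes _ = cong (1# +_) (∑-𝟙 P? xs)
    ... | no  _ = trans (+-identityˡ _) (∑-𝟙 P? xs)

    ^-poly : ∀ {f} k → IsPoly f → IsPoly (λ j → f j ^ k)
    ^-poly zero    p = IsPoly-const 1#
    ^-poly (suc k) p = IsPoly-* p (^-poly k p)

    collect : ∀ {A : Set} (c : A → Carrier) (d : A → ℕ) xs M → (∀ {x} → x ∈ xs → d x < M) → ∀ t →
      ∑ xs (λ x → c x * t ^ d x) ≡ ∑ (upTo M) (λ k → ∑ xs (λ x → 𝟙 (k ℕ.≟ d x) * c x) * t ^ k)
    collect c d xs M h t = begin
      ∑ xs (λ x → c x * t ^ d x)
        ≡⟨ ∑-cong-∈ xs (λ {x} x∈ → sym (∑-pick-∈ ℕ._≟_ (λ k → c x * t ^ k) (Unique.upTo⁺ M) (∈-upTo⁺ (h x∈)))) ⟩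
      ∑ xs (λ x → ∑ (upTo M) (λ k → 𝟙 (k ℕ.≟ d x) * (c x * t ^ k)))
        ≡⟨ ∑-swap xs (upTo M) _ ⟩
      ∑ (upTo M) (λ k → ∑ xs (λ x → 𝟙 (k ℕ.≟ d x) * (c x * t ^ k)))
        ≡⟨ ∑-cong (upTo M) (λ k → trans (∑-cong xs λ x → sym (*-assoc _ _ _)) (∑-*ʳ xs (t ^ k) _)) ⟩
      ∑ (upTo M) (λ k → ∑ xs (λ x → 𝟙 (k ℕ.≟ d x) * c x) * t ^ k) ∎
      where open ≡-Reasoning

    module Cancellative (cancel : ∀ n x → fromℕ (suc n) * x ≡ 0# → x ≡ 0#) where

      -- The value at n = 0 is the constant coefficient. The rest is n S(n), with S built from the
      -- shifted coefficients; cancelling n gives S(n) = 0 for n ≥ 1, `PolySeq-vanish` adds n = 0,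
      -- and S has one coefficient fewer.
      coefficients-vanish : ∀ M (a : ℕ → Carrier) → (∀ n → ∑ (upTo M) (λ k → a k * fromℕ n ^ k) ≡ 0#) →
        ∀ k → k < M → a k ≡ 0#
      coefficients-vanish (suc M) a h = λ { zero _ → a₀ ; (suc k) (s≤s k<M) → coefficients-vanish M (a ∘ suc) tail k k<M }
        where
        open ≡-Reasoning
        S : ℕ → Carrier
        S n = ∑ (upTo M) (λ k → a (suc k) * fromℕ n ^ k)
        split : ∀ n → a 0 + fromℕ n * S n ≡ 0#
        split n = begin
          a 0 + fromℕ n * S n
            ≡⟨ cong₂ _+_ (sym (*-identityʳ (a 0))) (trans (sym (∑-*ˡ (upTo M) (fromℕ n) _)) (∑-cong (upTo M) λ k → swap (fromℕ n) (a (suc k)) _)) ⟩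
          a 0 * 1# + ∑ (upTo M) (λ k → a (suc k) * (fromℕ n * fromℕ n ^ k))
            ≡⟨ sym (∑-upTo-suc M (λ k → a k * fromℕ n ^ k)) ⟩
          ∑ (upTo (suc M)) (λ k → a k * fromℕ n ^ k)
            ≡⟨ h n ⟩
          0# ∎
          where
          swap : ∀ x y z → x * (y * z) ≡ y * (x * z)
          swap x y z = trans (sym (*-assoc x y z)) (trans (cong (_* z) (*-comm x y)) (*-assoc y x z))
        a₀ : a 0 ≡ 0#
        a₀ = trans (sym (trans (cong (a 0 +_) (zeroˡ (S 0))) (+-identityʳ (a 0)))) (split 0)
        positive : ∀ n → S (suc n) ≡ 0#
        positive n = cancel n (S (suc n)) (trans (sym (trans (cong (_+ fromℕ (suc n) * S (suc n)) a₀) (+-identityˡ _))) (split (suc n)))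
        S-poly : IsPoly S
        S-poly = IsPoly-∑ (upTo M) λ k → IsPoly-* (IsPoly-const (a (suc k))) (^-poly k fromℕ-poly)
        tail : ∀ n → S n ≡ 0#
        tail zero    = PolySeq-vanish (proj₁ S-poly) (proj₂ S-poly) positive
        tail (suc n) = positive n

      module _ {A B : Set} (c : A → Carrier) (d : A → ℕ) (c′ : B → Carrier) (d′ : B → ℕ) where

        equal-coefficients : ∀ xs ys →
          (∀ n → ∑ xs (λ x → c x * fromℕ n ^ d x) ≡ ∑ ys (λ y → c′ y * fromℕ n ^ d′ y)) →
          ∀ k → ∑ xs (λ x → 𝟙 (k ℕ.≟ d x) * c x) ≡ ∑ ys (λ y → 𝟙 (k ℕ.≟ d′ y) * c′ y)
        equal-coefficients xs ys h k = begin
          a k                  ≡⟨ sym (+-identityʳ (a k)) ⟩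
          a k + 0#             ≡⟨ cong (a k +_) (sym (-‿inverseˡ (b k))) ⟩
          a k + (- b k + b k)  ≡⟨ sym (+-assoc (a k) _ _) ⟩
          (a k - b k) + b k    ≡⟨ cong (_+ b k) (coefficients-vanish M (λ k → a k - b k) zero-sum k k<M) ⟩
          0# + b k             ≡⟨ +-identityˡ (b k) ⟩
          b k                  ∎
          where
          open ≡-Reasoning
          a b : ℕ → Carrier
          a k = ∑ xs (λ x → 𝟙 (k ℕ.≟ d x) * c x)
          b k = ∑ ys (λ y → 𝟙 (k ℕ.≟ d′ y) * c′ y)
          M₁ = proj₁ (bounded d xs)
          M₂ = proj₁ (bounded d′ ys)
          -- `suc k` is included so that k < M even when k exceeds every degree on both sides.
          M = suc k ℕ.⊔ (M₁ ℕ.⊔ M₂)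
          k<M : k < M
          k<M = ℕ.m≤m⊔n (suc k) (M₁ ℕ.⊔ M₂)
          M₁₂≤M = ℕ.m≤n⊔m (suc k) (M₁ ℕ.⊔ M₂)
          zero-sum : ∀ n → ∑ (upTo M) (λ k → (a k - b k) * fromℕ n ^ k) ≡ 0#
          zero-sum n = begin
            ∑ (upTo M) (λ k → (a k - b k) * t ^ k)
              ≡⟨ trans (∑-cong (upTo M) λ k → trans (distribʳ (t ^ k) (a k) (- b k)) (cong (λ x → a k * t ^ k + x) (negate (b k) (t ^ k)))) (∑-+ (upTo M) _ _) ⟩
            ∑ (upTo M) (λ k → a k * t ^ k) + ∑ (upTo M) (λ k → - 1# * (b k * t ^ k))
              ≡⟨ cong₂ _+_ (sym (collect c d xs M (λ x∈ → ℕ.≤-trans (proj₂ (bounded d xs) x∈) (ℕ.≤-trans (ℕ.m≤m⊔n M₁ M₂) M₁₂≤M)) t))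
                   (trans (∑-*ˡ (upTo M) (- 1#) _) (cong (- 1# *_) (sym (collect c′ d′ ys M (λ y∈ → ℕ.≤-trans (proj₂ (bounded d′ ys) y∈) (ℕ.≤-trans (ℕ.m≤n⊔m M₁ M₂) M₁₂≤M)) t)))) ⟩
            ∑ xs (λ x → c x * t ^ d x) + - 1# * ∑ ys (λ y → c′ y * t ^ d′ y)
              ≡⟨ cong₂ _+_ (h n) (trans (sym (-‿distribˡ-* 1# _)) (cong -_ (*-identityˡ _))) ⟩
            ∑ ys (λ y → c′ y * t ^ d′ y) - ∑ ys (λ y → c′ y * t ^ d′ y)
              ≡⟨ -‿inverseʳ _ ⟩
            0# ∎
            where
            t = fromℕ n
            negate : ∀ x y → - x * y ≡ - 1# * (x * y)
            negate x y = trans (cong (_* y) (sym (trans (sym (-‿distribˡ-* 1# x)) (cong -_ (*-identityˡ x))))) (*-assoc (- 1#) x y)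

-- Rational arithmetic, and counting acyclic orientations with k sinks.

module SinkCount where

  open CommutativeRings
  open OrientationCounting
  open Cycles
  open Evaluation
  open SeriesValues
  open CoefficientComparison
  open import Data.Fin.Subset using (⊤)
  open import Data.Integer.Base as ℤ using (ℤ; +_; -[1+_]; -1ℤ)
  import Data.Integer.Properties as ℤ
  open import Data.List.Base using ([]; _∷_; map; filter; length; upTo)
  open import Data.Nat.Base as ℕ using (ℕ; zero; suc)
  open import Data.Nat.Combinatorics using (_C_)
  import Data.Nat.Coprimality as Coprimality
  import Data.Nat.Properties as ℕ
  open import Data.Product using (_,_; proj₁; proj₂)
  open import Data.Rational.Base as ℚ using (ℚ; mkℚ; 0ℚ; 1ℚ; _+_; _*_; -_; 1/_)
  import Data.Rational.Properties as ℚ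
  open import Function.Base using (_∘_)
  open import Relation.Binary.PropositionalEquality
  open import Relation.Nullary
  open import Defs using (SignedGraph; fromℤ; coefficientSum; ⟦_⟧; ⟦_⟧ᵐ; _≈_; X; ξ; q; z; series; p; ξ-weight; 1ᵐ)

  ℚ-ring : Ring≡
  ℚ-ring = record { isCommutativeRing = ℚ.+-*-isCommutativeRing }

  module _ where
    open FormalSums ℚ-ring

    fromℤ-mkℚ : ∀ n → fromℤ (+ n) ≡ mkℚ (+ n) 0 (Coprimality.sym (Coprimality.1-coprimeTo n))
    fromℤ-mkℚ n = ℚ.normalize-coprime (Coprimality.sym (Coprimality.1-coprimeTo n))

    -- With n / 1 written as a fraction of literal denominator 1, the rational sum computes to the
    -- integer 1 + n · 1 over 1.
    fromℤ-suc : ∀ n → fromℤ (+ suc n) ≡ 1ℚ + fromℤ (+ n)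
    fromℤ-suc n = sym (trans (cong (λ x → 1ℚ + x) (fromℤ-mkℚ n))
      (cong (ℚ._/ 1) (cong (λ x → + 1 ℤ.+ x) (ℤ.*-identityʳ (+ n)))))

    fromℤ-fromℕ : ∀ n → fromℤ (+ n) ≡ fromℕ n
    fromℤ-fromℕ zero    = refl
    fromℤ-fromℕ (suc n) = trans (fromℤ-suc n) (cong (λ x → 1ℚ + x) (fromℤ-fromℕ n))

    fromℤ-sign : ∀ n → fromℤ (-1ℤ ℤ.^ n) ≡ (- 1ℚ) ^ n
    fromℤ-sign zero    = refl
    fromℤ-sign (suc n) = trans (negate (-1ℤ ℤ.^ n)) (cong (- 1ℚ *_) (fromℤ-sign n))
      where
      negate : ∀ i → fromℤ (-1ℤ ℤ.* i) ≡ - 1ℚ * fromℤ i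
      negate i = trans (cong fromℤ (ℤ.-1*i≡-i i)) (trans (neg i) (trans (cong -_ (sym (ℚ.*-identityˡ (fromℤ i)))) (ℚ.neg-distribˡ-* 1ℚ (fromℤ i))))
        where
        neg : ∀ i → fromℤ (ℤ.- i) ≡ - fromℤ i
        neg (+ zero)  = refl
        neg (+ suc n) = refl
        neg -[1+ n ]  = sym (Ring≡.-‿involutive ℚ-ring (fromℤ (+ suc n)))

    fromℕ-cancel : ∀ n x → fromℕ (suc n) * x ≡ 0ℚ → x ≡ 0ℚ
    fromℕ-cancel n x eq = begin
      x                    ≡⟨ sym (ℚ.*-identityˡ x) ⟩
      1ℚ * x               ≡⟨ cong (_* x) (sym (ℚ.*-inverseˡ d)) ⟩
      (1/ d * d) * x       ≡⟨ ℚ.*-assoc (1/ d) d x ⟩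
      1/ d * (d * x)       ≡⟨ cong (λ y → 1/ d * (y * x)) (trans (sym (fromℤ-mkℚ (suc n))) (fromℤ-fromℕ (suc n))) ⟩
      1/ d * (fromℕ (suc n) * x) ≡⟨ cong (1/ d *_) eq ⟩
      1/ d * 0ℚ            ≡⟨ ℚ.*-zeroʳ (1/ d) ⟩
      0ℚ                   ∎
      where
      open ≡-Reasoning
      d : ℚ
      d = mkℚ (+ suc n) 0 (Coprimality.sym (Coprimality.1-coprimeTo (suc n)))

  module _ where
    open Sums ℚ-ring
    open FormalSums ℚ-ring
    open Values ℚ-ring
    open Extraction ℚ-ring
    open Cancellative fromℕ-cancel

    module _ (t : ℚ) (m : ℕ) where
      open AtPoint t

      series-hasValue : ∀ g → HasValue (point m) (series g (suc m)) (generatorValue g (suc m))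
      series-hasValue (ξ n) = HasValue-cong {x = point m} {f = series (ξ n) (suc m)} (λ _ → refl)
        (∑-cong (map suc (upTo n)) (λ a → cong (_* powerSumValue a 0 (suc m)) (fromℤ-fromℕ (n C a))))
        (HasValue-∑ {x = point m} (map suc (upTo n)) {λ a α → fromℤ (+ (n C a)) * p a 0 (suc m) α} {λ a → fromℤ (+ (n C a)) * powerSumValue a 0 (suc m)}
          λ a → HasValue-scale {x = point m} {p a 0 (suc m)} {powerSumValue a 0 (suc m)} (fromℤ (+ (n C a))) (powerSum-hasValue a 0 m))
      series-hasValue (q a b) = HasValue-cong {x = point m} {f = series (q a b) (suc m)} (λ _ → refl)
        (cong (_* powerSumValue a b (suc m)) (fromℤ-sign (a ℕ.+ b ℕ.+ 1)))
        (HasValue-scale {x = point m} {p a b (suc m)} {powerSumValue a b (suc m)} (fromℤ (-1ℤ ℤ.^ (a ℕ.+ b ℕ.+ 1))) (powerSum-hasValue a b m))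
      series-hasValue z = z-hasValue m

      monomial-hasValue : ∀ gs → HasValue (point m) (⟦ gs ⟧ᵐ (suc m)) (monomialValue gs (suc m))
      monomial-hasValue []       = HasValue-cong {x = point m} {⟦ [] ⟧ᵐ (suc m)} (λ _ → refl) (evalᵐ-1 (point m)) (HasValue-δ {x = point m} 1ᵐ)
      monomial-hasValue (g ∷ gs) = HasValue-⋆ {x = point m} {series g (suc m)} {⟦ gs ⟧ᵐ (suc m)} {generatorValue g (suc m)} {monomialValue gs (suc m)}
        (series-hasValue g) (monomial-hasValue gs)

      polynomial-hasValue : ∀ P → HasValue (point m) (⟦ P ⟧ (suc m)) (polynomialValue P (suc m))
      polynomial-hasValue P = HasValue-∑ {x = point m} P {λ (c , gs) α → c * ⟦ gs ⟧ᵐ (suc m) α} {λ (c , gs) → c * monomialValue gs (suc m)}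
        λ (c , gs) → HasValue-scale {x = point m} {⟦ gs ⟧ᵐ (suc m)} {monomialValue gs (suc m)} c (monomial-hasValue gs)

    module _ (G : SignedGraph) where
      open Orientations G
      open Walks G

      -- The identity in t is stated at natural numbers t = n, which already determine the
      -- coefficients by `equal-coefficients`.
      generatingFunction : ∀ P → ⟦ P ⟧ ≈ X G → ∀ n →
        ∑ P (λ (c , gs) → c * fromℕ n ^ ξ-weight gs) ≡ ∑ orientations (λ o → 𝟙 (¬? (cyclic? ⊤ o)) * fromℕ n ^ sinks o)
      generatingFunction P eq n = compare P λ m →
        HasValue-unique {x = point m} {⟦ P ⟧ (suc m)} {X G (suc m)} {polynomialValue P (suc m)} {graphValue (suc m)}
          (eq (suc m)) (polynomial-hasValue (fromℕ n) m P) (graph-hasValue m)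
        where
        open AtPoint (fromℕ n)
        open Graph G (fromℕ n)

      count : ∀ P → ⟦ P ⟧ ≈ X G → ∀ k → fromℤ (+ length (filter (counted? k) orientations)) ≡ coefficientSum k P
      count P eq k = begin
        fromℤ (+ length (filter (counted? k) orientations))
          ≡⟨ fromℤ-fromℕ (length (filter (counted? k) orientations)) ⟩
        fromℕ (length (filter (counted? k) orientations))
          ≡⟨ sym (∑-𝟙 (counted? k) orientations) ⟩
        ∑ orientations (λ o → 𝟙 (counted? k o))
          ≡⟨ ∑-cong orientations (λ o → 𝟙-× (k ℕ.≟ sinks o) (¬? (cyclic? ⊤ o)) (counted? k o)
               (λ (¬c , s) → sym s , ¬c) (λ s ¬c → ¬c , sym s)) ⟩
        ∑ orientations (λ o → 𝟙 (k ℕ.≟ sinks o) * 𝟙 (¬? (cyclic? ⊤ o)))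
          ≡⟨ sym (equal-coefficients proj₁ (ξ-weight ∘ proj₂) (λ o → 𝟙 (¬? (cyclic? ⊤ o))) sinks P orientations (generatingFunction P eq) k) ⟩
        ∑ P (λ t → 𝟙 (k ℕ.≟ ξ-weight (proj₂ t)) * proj₁ t)
          ≡⟨ ∑-cong P (λ t → cong (_* proj₁ t) (𝟙-⇔ (k ℕ.≟ ξ-weight (proj₂ t)) (ξ-weight (proj₂ t) ℕ.≟ k) sym sym)) ⟩
        ∑ P (λ t → 𝟙 (ξ-weight (proj₂ t) ℕ.≟ k) * proj₁ t)
          ≡⟨ sym (∑-filter (λ t → ξ-weight (proj₂ t) ℕ.≟ k) P proj₁) ⟩
        coefficientSum k P ∎
        where open ≡-Reasoning

-- Eliminating variables from systems of signed inequalities.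

module Contraction where

  open CommutativeRings
  open WeightedSums
  open Evaluation
  open SeriesValues
  open import Algebra.Bundles using (AbelianGroup)
  import Algebra.Properties.Group as Group

  open import Data.Empty using (⊥-elim)
  open import Data.Fin.Base as Fin using (Fin; zero; suc; toℕ; opposite; punchOut)
  import Data.Fin.Properties as Fin
  open import Data.Integer.Base as ℤ using (ℤ; +_; 0ℤ)
  import Data.Integer.Properties as ℤ
  open import Data.List.Base as List using (List; []; _∷_; map; allFin)

  open import Data.List.Membership.Propositional.Properties using (∈-allFin)

  import Data.List.Relation.Unary.Unique.Propositional.Properties as Unique
  open import Data.Nat.Base as ℕ using (ℕ; zero; suc)
  import Data.Nat.Properties as ℕ

  open import Data.Product using (_×_; _,_)
  open import Data.Rational.Base as ℚ using (_+_; _*_; -_)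
  open import Data.Sign.Base as Sign using (Sign)
  open import Data.Sign.Properties using () renaming (_≟_ to _≟ˢ_)
  open import Data.Vec.Base as Vec using (Vec; []; _∷_; lookup; insertAt; removeAt; updateAt)
  open import Data.Vec.Properties using (insertAt-lookup; insertAt-punchIn; zipWith-assoc; zipWith-comm; zipWith-identityˡ; zipWith-identityʳ)
  open import Function.Base using (_∘_)
  open import Relation.Binary.PropositionalEquality
  open import Relation.Nullary
  open import Defs using (allVecs; Index; value; index0; Monomial; 1ᵐ; _*ᵐ_; _/ᵐ_; x[_]^_; divisors; signed)

  *ᵐ-assoc : ∀ {n} (α β γ : Vec ℕ n) → (α *ᵐ β) *ᵐ γ ≡ α *ᵐ (β *ᵐ γ)
  *ᵐ-assoc = zipWith-assoc ℕ.+-assoc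

  *ᵐ-comm : ∀ {n} (α β : Vec ℕ n) → α *ᵐ β ≡ β *ᵐ α
  *ᵐ-comm = zipWith-comm ℕ.+-comm

  *ᵐ-identityˡ : ∀ {n} (α : Vec ℕ n) → 1ᵐ *ᵐ α ≡ α
  *ᵐ-identityˡ = zipWith-identityˡ ℕ.+-identityˡ

  *ᵐ-identityʳ : ∀ {n} (α : Vec ℕ n) → α *ᵐ 1ᵐ ≡ α
  *ᵐ-identityʳ = zipWith-identityʳ ℕ.+-identityʳ

  *ᵐ-swapˡ : ∀ {n} (α β γ : Vec ℕ n) → α *ᵐ (β *ᵐ γ) ≡ β *ᵐ (α *ᵐ γ)
  *ᵐ-swapˡ α β γ = trans (sym (*ᵐ-assoc α β γ)) (trans (cong (_*ᵐ γ) (*ᵐ-comm α β)) (*ᵐ-assoc β α γ))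

  *ᵐ-interchange : ∀ {n} (α β γ δ : Vec ℕ n) → (α *ᵐ β) *ᵐ (γ *ᵐ δ) ≡ (α *ᵐ γ) *ᵐ (β *ᵐ δ)
  *ᵐ-interchange α β γ δ = trans (*ᵐ-assoc α β _) (trans (cong (α *ᵐ_) (*ᵐ-swapˡ β γ δ)) (sym (*ᵐ-assoc α γ _)))

  x^0 : ∀ {n} (i : Fin n) → x[ i ]^ 0 ≡ 1ᵐ
  x^0 zero    = refl
  x^0 (suc i) = cong (0 ∷_) (x^0 i)

  x^-+ : ∀ {n} (i : Fin n) a b → x[ i ]^ (a ℕ.+ b) ≡ (x[ i ]^ a) *ᵐ (x[ i ]^ b)
  x^-+ zero    a b = cong (a ℕ.+ b ∷_) (sym (*ᵐ-identityˡ 1ᵐ))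
  x^-+ (suc i) a b = cong (0 ∷_) (x^-+ i a b)

  value-injective : ∀ N {i j} → value N i ≡ value N j → i ≡ j
  value-injective N {i} {j} eq = Fin.toℕ-injective (ℤ.+-injective
    (Group.∙-cancelʳ (AbelianGroup.group ℤ.+-0-abelianGroup) (ℤ.- + N) (+ toℕ i) (+ toℕ j)
      (trans (ℤ.m-n≡m⊖n (toℕ i) N) (trans eq (sym (ℤ.m-n≡m⊖n (toℕ j) N))))))

  opposite-index0 : ∀ N → opposite (index0 N) ≡ index0 N
  opposite-index0 N = value-injective N (trans (value-opposite N (index0 N))
    (trans (cong ℤ.-_ (value-index0 N)) (sym (value-index0 N))))

  opposite-fixed : ∀ N i → i ≡ opposite i → i ≡ index0 N
  opposite-fixed N i eq = value-injective N (trans (self-negative (value N i) (trans (cong (value N) eq) (value-opposite N i))) (sym (value-index0 N)))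
    where
    self-negative : ∀ c → c ≡ ℤ.- c → c ≡ 0ℤ
    self-negative (+ zero) _ = refl

  flip : ∀ {n} → Sign → Fin n → Fin n
  flip Sign.+ i = i
  flip Sign.- i = opposite i

  flip-involutive : ∀ {n} s (i : Fin n) → flip s (flip s i) ≡ i
  flip-involutive Sign.+ i = refl
  flip-involutive Sign.- i = Fin.opposite-involutive i

  flip-* : ∀ {n} s s′ (i : Fin n) → flip s (flip s′ i) ≡ flip (s Sign.* s′) i
  flip-* Sign.+ s′     i = refl
  flip-* Sign.- Sign.+ i = refl
  flip-* Sign.- Sign.- i = Fin.opposite-involutive i

  flip-index0 : ∀ s N → flip s (index0 N) ≡ index0 N
  flip-index0 Sign.+ N = refl
  flip-index0 Sign.- N = opposite-index0 N

  value-flip : ∀ N s i → value N (flip s i) ≡ signed s (value N i)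
  value-flip N Sign.+ i = refl
  value-flip N Sign.- i = value-opposite N i

  -- `null` stands for the colour 0. It arises when a variable is forced to equal its own negative,
  -- as by contracting a negative loop.
  data Term (k : ℕ) : Set where
    null : Term k
    ±    : Sign → Fin k → Term k

  interpret : ∀ N {k} → Vec (Index N) k → Term k → Index N
  interpret N κ null    = index0 N
  interpret N κ (± s i) = flip s (lookup κ i)

  turn : ∀ {k} → Sign → Term k → Term k
  turn s null     = null
  turn s (± s′ i) = ± (s Sign.* s′) i

  interpret-turn : ∀ N {k} (κ : Vec (Index N) k) s τ → interpret N κ (turn s τ) ≡ flip s (interpret N κ τ)
  interpret-turn N κ s null     = sym (flip-index0 s N)
  interpret-turn N κ s (± s′ i) = sym (flip-* s s′ (lookup κ i))

  lookup-insertAt : ∀ {A : Set} {k} (κ : Vec A k) {i j} v (i≢j : i ≢ j) → lookup (insertAt κ i v) j ≡ lookup κ (punchOut i≢j)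
  lookup-insertAt κ {i} v i≢j =
    trans (cong (lookup (insertAt κ i v)) (sym (Fin.punchIn-punchOut i≢j))) (insertAt-punchIn κ i v (punchOut i≢j))

  substitute : ∀ {k} → Fin (suc k) → Term k → Term (suc k) → Term k
  substitute i τ null    = null
  substitute i τ (± s j) with i Fin.≟ j
  ... | yes _  = turn s τ
  ... | no i≢j = ± s (punchOut i≢j)

  interpret-substitute : ∀ N {k} (κ : Vec (Index N) k) i τ u →
    interpret N (insertAt κ i (interpret N κ τ)) u ≡ interpret N κ (substitute i τ u)
  interpret-substitute N κ i τ null    = refl
  interpret-substitute N κ i τ (± s j) with i Fin.≟ j
  ... | yes refl = trans (cong (flip s) (insertAt-lookup κ i _)) (sym (interpret-turn N κ s τ))
  ... | no i≢j   = cong (flip s) (lookup-insertAt κ _ i≢j)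

  -- The solution is uniform in N, so that one contracted system represents the violating
  -- assignments for all N at once.
  data Solution : ∀ {k} → Term k → Term k → Set where
    always    : ∀ {k} {u v : Term k} → (∀ N κ → interpret N κ u ≡ interpret N κ v) → Solution u v
    eliminate : ∀ {k} {u v : Term (suc k)} (i : Fin (suc k)) (τ : Term k) →
      (∀ N κ c → interpret N (insertAt κ i c) u ≡ interpret N (insertAt κ i c) v → c ≡ interpret N κ τ) →
      (∀ N κ c → c ≡ interpret N κ τ → interpret N (insertAt κ i c) u ≡ interpret N (insertAt κ i c) v) →
      Solution u v

  flip≡index0 : ∀ N s i → flip s i ≡ index0 N → i ≡ index0 N
  flip≡index0 N s i eq = trans (sym (flip-involutive s i)) (trans (cong (flip s) eq) (flip-index0 s N))

  flips-agree : ∀ N s s′ i → s ≢ s′ → flip s i ≡ flip s′ i → i ≡ index0 N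
  flips-agree N Sign.+ Sign.+ i ne eq = ⊥-elim (ne refl)
  flips-agree N Sign.- Sign.- i ne eq = ⊥-elim (ne refl)
  flips-agree N Sign.+ Sign.- i ne eq = opposite-fixed N i eq
  flips-agree N Sign.- Sign.+ i ne eq = opposite-fixed N i (sym eq)

  -- The same variable with opposite signs gives c = -c, hence c = 0. In the other nontrivial cases
  -- a variable occurs on one side only, and applying its sign once more isolates it.
  solveEquation : ∀ {k} (u v : Term k) → Solution u v
  solveEquation null null = always λ _ _ → refl
  solveEquation {suc k} null (± s i) = eliminate i null
    (λ N κ c eq → flip≡index0 N s c (trans (cong (flip s) (sym (insertAt-lookup κ i c))) (sym eq)))
    (λ { N κ c refl → sym (trans (cong (flip s) (insertAt-lookup κ i c)) (flip-index0 s N)) })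
  solveEquation {suc k} (± s i) null = eliminate i null
    (λ N κ c eq → flip≡index0 N s c (trans (cong (flip s) (sym (insertAt-lookup κ i c))) eq))
    (λ { N κ c refl → trans (cong (flip s) (insertAt-lookup κ i c)) (flip-index0 s N) })
  solveEquation {suc k} (± s i) (± s′ j) with i Fin.≟ j | s ≟ˢ s′

  ... | yes refl | yes refl = always λ _ _ → refl
  ... | yes refl | no s≢s′  = eliminate i null
    (λ N κ c eq → flips-agree N s s′ c s≢s′ (subst (λ d → flip s d ≡ flip s′ d) (insertAt-lookup κ i c) eq))
    (λ { N κ c refl → trans (cong (flip s) (insertAt-lookup κ i c)) (trans (flip-index0 s N)
          (sym (trans (cong (flip s′) (insertAt-lookup κ i c)) (flip-index0 s′ N)))) })
  ... | no i≢j   | _        = eliminate i (± (s Sign.* s′) (punchOut i≢j))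
    (λ N κ c eq → trans (sym (flip-involutive s c)) (trans (cong (flip s)
       (trans (cong (flip s) (sym (insertAt-lookup κ i c))) (trans eq (cong (flip s′) (lookup-insertAt κ c i≢j)))))
       (flip-* s s′ _)))
    (λ { N κ c refl → trans (cong (flip s) (insertAt-lookup κ i c)) (trans (cong (flip s) (sym (flip-* s s′ _)))
          (trans (flip-involutive s _) (cong (flip s′) (sym (lookup-insertAt κ c i≢j))))) })

  -- A set of vertices whose colours agree up to sign.  The block (a , b) contributes x_c^(a+1) x_{-c}^b when it has
  -- colour c; the exponent a+1 keeps blocks nonempty, since Σ_c 1 is not a power series.
  Block : Set
  Block = ℕ × ℕ

  block : ∀ N → Block → Index N → Monomial N
  block N (a , b) c = (x[ c ]^ suc a) *ᵐ (x[ opposite c ]^ b)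

  blocks : ∀ N {k} → Vec Block k → Vec (Index N) k → Monomial N
  blocks N []      []      = 1ᵐ
  blocks N (w ∷ ws) (c ∷ κ) = block N w c *ᵐ blocks N ws κ

  join : Sign → Block → Block → Block
  join Sign.+ (a , b) (a′ , b′) = a ℕ.+ suc a′ , b ℕ.+ b′
  join Sign.- (a , b) (a′ , b′) = a′ ℕ.+ b , b′ ℕ.+ suc a

  block-join : ∀ N s B B′ c → block N (join s B B′) c ≡ block N B (flip s c) *ᵐ block N B′ c
  block-join N Sign.+ (a , b) (a′ , b′) c =
    trans (cong₂ _*ᵐ_ (x^-+ c (suc a) (suc a′)) (x^-+ (opposite c) b b′)) (*ᵐ-interchange _ _ _ _)
  block-join N Sign.- (a , b) (a′ , b′) c =
    trans (cong₂ _*ᵐ_ (x^-+ c (suc a′) b) (x^-+ (opposite c) b′ (suc a)))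
    (trans (*ᵐ-interchange _ _ _ _) (trans (*ᵐ-comm _ _) (cong (_*ᵐ block N (a′ , b′) c)
      (trans (*ᵐ-comm _ _) (cong (λ d → (x[ opposite c ]^ suc a) *ᵐ (x[ d ]^ b)) (sym (Fin.opposite-involutive c)))))))

  blocks-updateAt : ∀ N {k} (ws : Vec Block k) κ j s B →
    blocks N (updateAt ws j (join s B)) κ ≡ block N B (flip s (lookup κ j)) *ᵐ blocks N ws κ
  blocks-updateAt N (w ∷ ws) (c ∷ κ) zero    s B = trans (cong (_*ᵐ blocks N ws κ) (block-join N s B w c)) (*ᵐ-assoc _ _ _)
  blocks-updateAt N (w ∷ ws) (c ∷ κ) (suc j) s B = trans (cong (block N w c *ᵐ_) (blocks-updateAt N ws κ j s B)) (*ᵐ-swapˡ _ _ _)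

  blocks-insertAt : ∀ N {k} (ws : Vec Block (suc k)) κ i c →
    blocks N ws (insertAt κ i c) ≡ block N (lookup ws i) c *ᵐ blocks N (removeAt ws i) κ
  blocks-insertAt N (w ∷ ws)     κ       zero    c = refl
  blocks-insertAt N (w ∷ v ∷ ws) (d ∷ κ) (suc i) c =
    trans (cong (block N w d *ᵐ_) (blocks-insertAt N (v ∷ ws) κ i c)) (*ᵐ-swapˡ _ _ _)

  -- The exponent next to the blocks is that of x_0.
  absorb : ∀ {k} → Term k → Block → Vec Block k × ℕ → Vec Block k × ℕ
  absorb null    (a , b) (ws , e) = ws , suc a ℕ.+ b ℕ.+ e
  absorb (± s j) B       (ws , e) = updateAt ws j (join s B) , e

  total : ∀ N {k} → Vec Block k × ℕ → Vec (Index N) k → Monomial N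
  total N (ws , e) κ = blocks N ws κ *ᵐ (x[ index0 N ]^ e)

  total-absorb : ∀ N {k} τ B (W : Vec Block k × ℕ) κ → total N (absorb τ B W) κ ≡ block N B (interpret N κ τ) *ᵐ total N W κ
  total-absorb N null (a , b) (ws , e) κ = trans
    (cong (blocks N ws κ *ᵐ_) (trans (x^-+ (index0 N) (suc a ℕ.+ b) e) (cong (_*ᵐ (x[ index0 N ]^ e))
      (trans (x^-+ (index0 N) (suc a) b) (cong (λ d → (x[ index0 N ]^ suc a) *ᵐ (x[ d ]^ b)) (sym (opposite-index0 N)))))))
    (*ᵐ-swapˡ _ _ _)
  total-absorb N (± s j) B (ws , e) κ = trans (cong (_*ᵐ (x[ index0 N ]^ e)) (blocks-updateAt N ws κ j s B)) (*ᵐ-assoc _ _ _)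

  contract : ∀ {k} → Fin (suc k) → Term k → Vec Block (suc k) × ℕ → Vec Block k × ℕ
  contract i τ (ws , e) = absorb τ (lookup ws i) (removeAt ws i , e)

  total-contract : ∀ N {k} i τ (W : Vec Block (suc k) × ℕ) κ →
    total N W (insertAt κ i (interpret N κ τ)) ≡ total N (contract i τ W) κ
  total-contract N i τ (ws , e) κ = trans
    (cong (_*ᵐ (x[ index0 N ]^ e)) (blocks-insertAt N ws κ i _))
    (trans (*ᵐ-assoc _ _ _) (sym (total-absorb N τ (lookup ws i) (removeAt ws i , e) κ)))

  indices : ∀ N → List (Index N)
  indices N = allFin _

  Constraints : ℕ → ℕ → Set
  Constraints k m = Vec (Term k × Term k) m

  module Constrained (R : Ring≡) where
    open Ring≡ R
      renaming (_+_ to infixl 6 _⊕_; _*_ to infixl 7 _⊗_)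
      hiding (-_; _-_)
    open Sums R
    open FormalSums R

    ∑-insertAt : ∀ {A : Set} (xs : List A) {k} (i : Fin (suc k)) (F : Vec A (suc k) → Carrier) →
      ∑ (allVecs xs (suc k)) F ≡ ∑ (allVecs xs k) (λ κ → ∑ xs (λ c → F (insertAt κ i c)))
    ∑-insertAt xs {k} zero F = trans (∑-cartesianProductWith _∷_ xs (allVecs xs k) F) (∑-swap xs (allVecs xs k) _)
    ∑-insertAt xs {suc k} (suc i) F =
      trans (∑-cartesianProductWith _∷_ xs (allVecs xs (suc k)) F)
      (trans (∑-cong xs λ c → ∑-insertAt xs i (F ∘ (c ∷_)))
             (sym (∑-cartesianProductWith _∷_ xs (allVecs xs k) _)))

    satisfied : ∀ N {k m} → Constraints k m → Vec (Index N) k → Carrier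
    satisfied N []             κ = 1#
    satisfied N ((u , v) ∷ cs) κ = 𝟙 (¬? (interpret N κ u Fin.≟ interpret N κ v)) ⊗ satisfied N cs κ

    -- A generalisation of X that is closed under contraction: merged vertices become larger blocks,
    -- and vertices forced to the colour 0 move into the exponent of x_0.
    constrained : ∀ {k m} → Constraints k m → Vec Block k × ℕ → ∀ N → Monomial N → Carrier
    constrained {k} cs W N α = ∑ (allVecs (indices N) k) λ κ → satisfied N cs κ ⊗ δ (total N W κ) α

    𝟙-not : ∀ {P : Set} (P? : Dec P) x → 𝟙 (¬? P?) ⊗ x ≡ x ⊕ (Ring≡.-_ R 1# ⊗ (𝟙 P? ⊗ x))
    𝟙-not (yes _) x = trans (zeroˡ x) (sym (trans (cong (x ⊕_) (trans (sym (-‿distribˡ-* 1# _)) (cong (Ring≡.-_ R) (trans (*-identityˡ _) (*-identityˡ x))))) (-‿inverseʳ x)))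
    𝟙-not (no _)  x = trans (*-identityˡ x) (sym (trans (cong (x ⊕_) (trans (cong (Ring≡.-_ R 1# ⊗_) (zeroˡ x)) (zeroʳ _))) (+-identityʳ x)))

    violating : ∀ {k m} → Term k → Term k → Constraints k m → Vec Block k × ℕ → ∀ N → Monomial N → Carrier
    violating {k} u v cs W N α = ∑ (allVecs (indices N) k) λ κ →
      𝟙 (interpret N κ u Fin.≟ interpret N κ v) ⊗ (satisfied N cs κ ⊗ δ (total N W κ) α)

    -- Deletion: the inequality is dropped and the assignments that violate it are subtracted.
    constrained-∷ : ∀ {k m} (u v : Term k) (cs : Constraints k m) W N α →
      constrained ((u , v) ∷ cs) W N α ≡ constrained cs W N α ⊕ (Ring≡.-_ R 1# ⊗ violating u v cs W N α)
    constrained-∷ {k} u v cs W N α = trans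
      (∑-cong (allVecs (indices N) k) λ κ → trans (*-assoc _ _ _) (𝟙-not (interpret N κ u Fin.≟ interpret N κ v) _))
      (trans (∑-+ (allVecs (indices N) k) _ _) (cong (constrained cs W N α ⊕_) (∑-*ˡ (allVecs (indices N) k) _ _)))

    violating-always : ∀ {k m} {u v : Term k} (cs : Constraints k m) W N α →
      (∀ N κ → interpret N κ u ≡ interpret N κ v) → violating u v cs W N α ≡ constrained cs W N α
    violating-always {k} {u = u} {v} cs W N α h = ∑-cong (allVecs (indices N) k) λ κ →
      trans (cong (_⊗ (satisfied N cs κ ⊗ δ (total N W κ) α)) (𝟙-true (interpret N κ u Fin.≟ interpret N κ v) (h N κ))) (*-identityˡ _)

    substituteAll : ∀ {k m} → Fin (suc k) → Term k → Constraints (suc k) m → Constraints k m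
    substituteAll i τ = Vec.map λ (u , v) → substitute i τ u , substitute i τ v

    satisfied-substituteAll : ∀ N {k m} (κ : Vec (Index N) k) i τ (cs : Constraints (suc k) m) →
      satisfied N cs (insertAt κ i (interpret N κ τ)) ≡ satisfied N (substituteAll i τ cs) κ
    satisfied-substituteAll N κ i τ []             = refl
    satisfied-substituteAll N κ i τ ((u , v) ∷ cs) = cong₂ _⊗_
      (cong₂ (λ c d → 𝟙 (¬? (c Fin.≟ d))) (interpret-substitute N κ i τ u) (interpret-substitute N κ i τ v))
      (satisfied-substituteAll N κ i τ cs)

    -- The interval [-N , N] contains 0 and is closed under negation, so for each assignment of the
    -- other variables exactly one colour c in it solves the equation, and the sum over c reduces to
    -- that term.
    violating-eliminate : ∀ {k m} {u v : Term (suc k)} (cs : Constraints (suc k) m) W i τ N α →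
      (∀ κ c → interpret N (insertAt κ i c) u ≡ interpret N (insertAt κ i c) v → c ≡ interpret N κ τ) →
      (∀ κ c → c ≡ interpret N κ τ → interpret N (insertAt κ i c) u ≡ interpret N (insertAt κ i c) v) →
      violating u v cs W N α ≡ constrained (substituteAll i τ cs) (contract i τ W) N α
    violating-eliminate {k} {u = u} {v} cs W i τ N α to from = trans
      (∑-insertAt (indices N) i _)
      (∑-cong (allVecs (indices N) k) λ κ → trans
        (∑-cong (indices N) λ c → cong (_⊗ term (insertAt κ i c))
          (𝟙-⇔ (interpret N (insertAt κ i c) u Fin.≟ interpret N (insertAt κ i c) v) (c Fin.≟ interpret N κ τ) (to κ c) (from κ c)))
        (trans (∑-pick-∈ Fin._≟_ (λ c → term (insertAt κ i c)) (Unique.allFin⁺ _) (∈-allFin _))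
          (cong₂ _⊗_ (satisfied-substituteAll N κ i τ cs) (cong (λ β → δ β α) (total-contract N i τ W κ)))))
      where
      term : Vec (Index N) (suc k) → Carrier
      term κ = satisfied N cs κ ⊗ δ (total N W κ) α

    constrained-[]-zero : ∀ e N α → constrained [] ([] , e) N α ≡ δ (x[ index0 N ]^ e) α
    constrained-[]-zero e N α = trans (+-identityʳ _) (trans (*-identityˡ _) (cong (λ β → δ β α) (*ᵐ-identityˡ _)))

    δ-⋆-∑ : ∀ {n} {A : Set} {B : Set} (xs : List A) (ys : List B) (f : A → Vec ℕ n) (g : B → Vec ℕ n) α →
      ((λ β → ∑ xs (λ x → δ (f x) β)) ⋆ (λ β → ∑ ys (λ y → δ (g y) β))) α ≡ ∑ xs (λ x → ∑ ys (λ y → δ (f x *ᵐ g y) α))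
    δ-⋆-∑ xs ys f g α = begin
      ∑ (divisors α) (λ β → ∑ xs (λ x → δ (f x) β) ⊗ ∑ ys (λ y → δ (g y) (α /ᵐ β)))
        ≡⟨ ∑-cong (divisors α) (λ β → trans (sym (∑-*ʳ xs _ _)) (∑-cong xs λ x → sym (∑-*ˡ ys _ _))) ⟩
      ∑ (divisors α) (λ β → ∑ xs (λ x → ∑ ys (λ y → δ (f x) β ⊗ δ (g y) (α /ᵐ β))))
        ≡⟨ trans (∑-swap (divisors α) xs _) (∑-cong xs λ _ → ∑-swap (divisors α) ys _) ⟩
      ∑ xs (λ x → ∑ ys (λ y → ∑ (divisors α) (λ β → δ (f x) β ⊗ δ (g y) (α /ᵐ β))))
        ≡⟨ ∑-cong xs (λ x → ∑-cong ys λ y → δ-⋆ (f x) (g y) α) ⟩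
      ∑ xs (λ x → ∑ ys (λ y → δ (f x *ᵐ g y) α)) ∎
      where open ≡-Reasoning

    -- Without inequalities the colours of the blocks are independent. The block (a , b) splits off
    -- as the factor p_{a+1,b}.
    constrained-[]-suc : ∀ {k} w (ws : Vec Block k) e N α → constrained [] (w ∷ ws , e) N α ≡
      ((λ β → ∑ (indices N) (λ c → δ (block N w c) β)) ⋆ constrained [] (ws , e) N) α
    constrained-[]-suc {k} w ws e N α = begin
      ∑ (allVecs (indices N) (suc k)) (λ κ → 1# ⊗ δ (total N (w ∷ ws , e) κ) α)
        ≡⟨ trans (∑-cong (allVecs (indices N) (suc k)) λ κ → *-identityˡ _) (∑-cartesianProductWith _∷_ (indices N) (allVecs (indices N) k) _) ⟩
      ∑ (indices N) (λ c → ∑ (allVecs (indices N) k) (λ κ → δ ((block N w c *ᵐ blocks N ws κ) *ᵐ (x[ index0 N ]^ e)) α))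
        ≡⟨ ∑-cong (indices N) (λ c → ∑-cong (allVecs (indices N) k) λ κ → cong (λ β → δ β α) (*ᵐ-assoc _ _ _)) ⟩
      ∑ (indices N) (λ c → ∑ (allVecs (indices N) k) (λ κ → δ (block N w c *ᵐ total N (ws , e) κ) α))
        ≡⟨ sym (δ-⋆-∑ (indices N) (allVecs (indices N) k) (block N w) (total N (ws , e)) α) ⟩
      ((λ β → ∑ (indices N) (λ c → δ (block N w c) β)) ⋆ (λ β → ∑ (allVecs (indices N) k) (λ κ → δ (total N (ws , e) κ) β))) α
        ≡⟨ ∑-cong (divisors α) (λ β → cong (∑ (indices N) (λ c → δ (block N w c) β) ⊗_)
             (∑-cong (allVecs (indices N) k) λ κ → sym (*-identityˡ _))) ⟩
      ((λ β → ∑ (indices N) (λ c → δ (block N w c) β)) ⋆ constrained [] (ws , e) N) α ∎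
      where open ≡-Reasoning

-- X is a polynomial in the generators.

module Existence where

  open CommutativeRings
  open WeightedSums
  open Evaluation
  open SeriesValues
  open SinkCount
  open Contraction
  open import Data.Fin.Base as Fin using (Fin; zero; suc; opposite)
  import Data.Fin.Properties as Fin
  open import Data.Integer.Base as ℤ using (+_)
  open import Data.List.Base as List using (List; []; _∷_; map; upTo; _++_)
  open import Data.List.Membership.Propositional using (_∈_)
  open import Data.List.Membership.Propositional.Properties using (∈-upTo⁻)
  open import Data.List.Relation.Unary.Any using (here; there)
  open import Data.Nat.Base as ℕ using (ℕ; zero; suc)
  open import Data.Nat.Induction using (<-rec)
  open import Data.Nat.Combinatorics using (_C_; nCn≡1)
  open import Data.Product using (_×_; _,_; proj₁; proj₂; ∃-syntax; Σ-syntax)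
  open import Data.Rational.Base as ℚ using (ℚ; 0ℚ; 1ℚ; _+_; _*_; -_)
  import Data.Rational.Properties as ℚ
  open import Data.Sign.Base as Sign using (Sign)
  open import Data.Vec.Base as Vec using (Vec; []; _∷_; lookup; replicate)
  open import Function.Base using (_∘_)
  open import Relation.Binary.PropositionalEquality
  open import Relation.Nullary
  open import Defs using (_*ᵐ_; SignedGraph; fromℤ; allVecs; Index; value; index0; PowerSeries; _≈_; _/ᵐ_; x[_]^_; ∏x; divisors; Generator; ξ; q; z; series; p; Polynomial; ⟦_⟧; ⟦_⟧ᵐ; 1ˢ; _*ˢ_; X; Proper; proper?)

  open Ring≡ ℚ-ring using (-‿involutive)
  open Sums ℚ-ring
  open SubsetSums ℚ-ring
  open FormalSums ℚ-ring
  open Values ℚ-ring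
  open Constrained ℚ-ring

  IsPolynomial : PowerSeries → Set
  IsPolynomial f = ∃[ P ] ⟦ P ⟧ ≈ f

  IsPolynomial-cong : ∀ {f g : PowerSeries} → f ≈ g → IsPolynomial f → IsPolynomial g
  IsPolynomial-cong eq (P , h) = P , λ N α → trans (h N α) (eq N α)

  IsPolynomial-0 : IsPolynomial (λ _ _ → 0ℚ)
  IsPolynomial-0 = [] , λ _ _ → refl

  IsPolynomial-+ : ∀ {f g : PowerSeries} → IsPolynomial f → IsPolynomial g → IsPolynomial (λ N α → f N α + g N α)
  IsPolynomial-+ (P , h) (Q , k) = P ++ Q , λ N α →
    trans (∑-++ P Q (λ (c , gs) → c * ⟦ gs ⟧ᵐ N α)) (cong₂ _+_ (h N α) (k N α))

  IsPolynomial-scale : ∀ {f : PowerSeries} c → IsPolynomial f → IsPolynomial (λ N α → c * f N α)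
  IsPolynomial-scale c (P , h) = map (λ (d , gs) → c * d , gs) P , λ N α →
    trans (∑-map (λ (d , gs) → c * d , gs) P (λ (d , gs) → d * ⟦ gs ⟧ᵐ N α))
    (trans (∑-cong P (λ (d , gs) → ℚ.*-assoc c d (⟦ gs ⟧ᵐ N α)))
    (trans (∑-*ˡ P c (λ (d , gs) → d * ⟦ gs ⟧ᵐ N α)) (cong (c *_) (h N α))))

  ∑-⋆ : ∀ {n} {A : Set} (xs : List A) (s : Vec ℕ n → ℚ) (c : A → ℚ) (f : A → Vec ℕ n → ℚ) α →
    ∑ xs (λ x → c x * (s ⋆ f x) α) ≡ (s ⋆ (λ β → ∑ xs (λ x → c x * f x β))) α
  ∑-⋆ xs s c f α = begin
    ∑ xs (λ x → c x * ∑ (divisors α) (λ β → s β * f x (α /ᵐ β)))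
      ≡⟨ ∑-cong xs (λ x → sym (∑-*ˡ (divisors α) (c x) (λ β → s β * f x (α /ᵐ β)))) ⟩
    ∑ xs (λ x → ∑ (divisors α) (λ β → c x * (s β * f x (α /ᵐ β))))
      ≡⟨ ∑-swap xs (divisors α) (λ x β → c x * (s β * f x (α /ᵐ β))) ⟩
    ∑ (divisors α) (λ β → ∑ xs (λ x → c x * (s β * f x (α /ᵐ β))))
      ≡⟨ ∑-cong (divisors α) (λ β → trans
           (∑-cong xs λ x → trans (sym (ℚ.*-assoc (c x) (s β) (f x (α /ᵐ β))))
              (trans (cong (_* f x (α /ᵐ β)) (ℚ.*-comm (c x) (s β))) (ℚ.*-assoc (s β) (c x) (f x (α /ᵐ β)))))
           (∑-*ˡ xs (s β) (λ x → c x * f x (α /ᵐ β)))) ⟩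
    ∑ (divisors α) (λ β → s β * ∑ xs (λ x → c x * f x (α /ᵐ β))) ∎
    where open ≡-Reasoning

  IsPolynomial-generator : ∀ {f : PowerSeries} g → IsPolynomial f → IsPolynomial (series g *ˢ f)
  IsPolynomial-generator {f} g (P , h) = map (λ (c , gs) → c , g ∷ gs) P , λ N α →
    trans (∑-map (λ (c , gs) → c , g ∷ gs) P (λ (c , gs) → c * ⟦ gs ⟧ᵐ N α))
    (trans (∑-⋆ P (series g N) proj₁ (λ t → ⟦ proj₂ t ⟧ᵐ N) α)
           (∑-cong (divisors α) (λ β → cong (series g N β *_) (h N (α /ᵐ β)))))

  -- The factors that occur, x_0 and the p_{a,b} with a ≥ 1, are linear combinations of generators.
  -- Multiplying a polynomial by such a series reduces to prefixing one generator to each term.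
  IsLinear : PowerSeries → Set
  IsLinear f = Σ[ L ∈ List (ℚ × Generator) ] (∀ N α → f N α ≡ ∑ L (λ (c , g) → c * series g N α))

  IsLinear-cong : ∀ {f g : PowerSeries} → f ≈ g → IsLinear g → IsLinear f
  IsLinear-cong eq (L , h) = L , λ N α → trans (eq N α) (h N α)

  IsLinear-generator : ∀ c g → IsLinear (λ N α → c * series g N α)
  IsLinear-generator c g = (c , g) ∷ [] , λ N α → sym (ℚ.+-identityʳ (c * series g N α))

  IsLinear-+ : ∀ {f g : PowerSeries} → IsLinear f → IsLinear g → IsLinear (λ N α → f N α + g N α)
  IsLinear-+ (L , h) (M , k) = L ++ M , λ N α →
    trans (cong₂ _+_ (h N α) (k N α)) (sym (∑-++ L M (λ (c , g) → c * series g N α)))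

  IsLinear-scale : ∀ {f : PowerSeries} c → IsLinear f → IsLinear (λ N α → c * f N α)
  IsLinear-scale c (L , h) = map (λ (d , g) → c * d , g) L , λ N α →
    trans (cong (c *_) (h N α)) (sym
    (trans (∑-map (λ (d , g) → c * d , g) L (λ (d , g) → d * series g N α))
    (trans (∑-cong L (λ (d , g) → ℚ.*-assoc c d (series g N α)))
           (∑-*ˡ L c (λ (d , g) → d * series g N α)))))

  IsLinear-∑ : ∀ {A : Set} (xs : List A) {f : A → PowerSeries} → (∀ {x} → x ∈ xs → IsLinear (f x)) →
    IsLinear (λ N α → ∑ xs (λ x → f x N α))
  IsLinear-∑ []       h = [] , λ _ _ → refl
  IsLinear-∑ (x ∷ xs) {f} h = IsLinear-+ {f x} {λ N α → ∑ xs (λ x → f x N α)} (h (here refl)) (IsLinear-∑ xs {f} (h ∘ there))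

  IsPolynomial-linear : ∀ {f h : PowerSeries} → IsLinear f → IsPolynomial h → IsPolynomial (f *ˢ h)
  IsPolynomial-linear {f} {h} (L , eq) Ph = IsPolynomial-cong
    {λ N α → ∑ L (λ (c , g) → c * (series g *ˢ h) N α)} {f *ˢ h}
    (λ N α → begin
      ∑ L (λ (c , g) → c * (series g *ˢ h) N α)
        ≡⟨ ∑-cong L (λ (c , g) → sym (∑-*ˡ (divisors α) c (λ β → series g N β * h N (α /ᵐ β)))) ⟩
      ∑ L (λ (c , g) → ∑ (divisors α) (λ β → c * (series g N β * h N (α /ᵐ β))))
        ≡⟨ ∑-swap L (divisors α) (λ (c , g) β → c * (series g N β * h N (α /ᵐ β))) ⟩
      ∑ (divisors α) (λ β → ∑ L (λ (c , g) → c * (series g N β * h N (α /ᵐ β))))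
        ≡⟨ ∑-cong (divisors α) (λ β → trans
             (∑-cong L λ (c , g) → sym (ℚ.*-assoc c (series g N β) (h N (α /ᵐ β))))
             (trans (∑-*ʳ L (h N (α /ᵐ β)) (λ (c , g) → c * series g N β)) (cong (_* h N (α /ᵐ β)) (sym (eq N β))))) ⟩
      (f *ˢ h) N α ∎)
    (combination L)
    where
    open ≡-Reasoning
    combination : ∀ L → IsPolynomial (λ N α → ∑ L (λ (c , g) → c * (series g *ˢ h) N α))
    combination []            = IsPolynomial-0
    combination ((c , g) ∷ L) = IsPolynomial-+ {λ N α → c * (series g *ˢ h) N α} {λ N α → ∑ L (λ (c , g) → c * (series g *ˢ h) N α)}
      (IsPolynomial-scale {series g *ˢ h} c (IsPolynomial-generator {h} g Ph)) (combination L)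

  sign² : ∀ n x → x ≡ (- 1ℚ) ^ n * ((- 1ℚ) ^ n * x)
  sign² n x = sym (trans (sym (ℚ.*-assoc ((- 1ℚ) ^ n) ((- 1ℚ) ^ n) x))
    (trans (cong (_* x) (trans (sym (*-^ (- 1ℚ) (- 1ℚ) n)) (1^ n))) (ℚ.*-identityˡ x)))

  -- The top term of ξ_n is p_{n,0}, so p_{n,0} is obtained from ξ_n by recursion.
  p-linear₀ : ∀ n → IsLinear (p (suc n) 0)
  p-linear₀ = <-rec (λ n → IsLinear (p (suc n) 0)) λ n rec →
    IsLinear-cong {p (suc n) 0} {λ N α → 1ℚ * series (ξ (suc n)) N α + - 1ℚ * lower n N α}
      (λ N α → solveFor (p (suc n) 0 N α) (lower n N α) (series (ξ (suc n)) N α) (top n N α))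
      (IsLinear-+ {λ N α → 1ℚ * series (ξ (suc n)) N α} {λ N α → - 1ℚ * lower n N α}
        (IsLinear-generator 1ℚ (ξ (suc n)))
        (IsLinear-scale {lower n} (- 1ℚ) (IsLinear-∑ (upTo n) {λ a N α → fromℤ (+ (suc n C suc a)) * p (suc a) 0 N α}
          λ {a} a∈ → IsLinear-scale {p (suc a) 0} (fromℤ (+ (suc n C suc a))) (rec (∈-upTo⁻ a∈)))))
    where
    lower : ℕ → PowerSeries
    lower n N α = ∑ (upTo n) λ a → fromℤ (+ (suc n C suc a)) * p (suc a) 0 N α
    top : ∀ n N α → series (ξ (suc n)) N α ≡ lower n N α + p (suc n) 0 N α
    top n N α = trans (∑-map suc (upTo (suc n)) (λ a → fromℤ (+ (suc n C a)) * p a 0 N α))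
      (trans (∑-upTo-snoc n (λ a → fromℤ (+ (suc n C suc a)) * p (suc a) 0 N α))
        (cong (λ x → lower n N α + x) (trans (cong (λ c → fromℤ (+ c) * p (suc n) 0 N α) (nCn≡1 (suc n))) (ℚ.*-identityˡ (p (suc n) 0 N α)))))
    solveFor : ∀ x l s → s ≡ l + x → x ≡ 1ℚ * s + - 1ℚ * l
    solveFor x l s refl = sym (begin
      1ℚ * (l + x) + - 1ℚ * l   ≡⟨ cong₂ _+_ (trans (ℚ.*-identityˡ (l + x)) (ℚ.+-comm l x)) (trans (sym (ℚ.neg-distribˡ-* 1ℚ l)) (cong -_ (ℚ.*-identityˡ l))) ⟩
      (x + l) + - l             ≡⟨ ℚ.+-assoc x l (- l) ⟩
      x + (l + - l)             ≡⟨ cong (λ y → x + y) (ℚ.+-inverseʳ l) ⟩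
      x + 0ℚ                    ≡⟨ ℚ.+-identityʳ x ⟩
      x                         ∎)
      where open ≡-Reasoning

  p-linear : ∀ a b → IsLinear (p (suc a) b)
  p-linear a zero    = p-linear₀ a
  p-linear a (suc b) = IsLinear-cong {p (suc a) (suc b)} {λ N α → sign * series (q (suc a) (suc b)) N α}
    (λ N α → trans (sign² n (p (suc a) (suc b) N α))
      (cong (λ s → sign * (s * p (suc a) (suc b) N α)) (sym (fromℤ-sign n))))
    (IsLinear-generator sign (q (suc a) (suc b)))
    where
    n = suc a ℕ.+ suc b ℕ.+ 1
    sign = (- 1ℚ) ^ n

  x₀-power : ℕ → PowerSeries
  x₀-power e N α = δ (x[ index0 N ]^ e) α

  x₀-linear : IsLinear (x₀-power 1)
  x₀-linear = IsLinear-cong {x₀-power 1} {λ N α → - 1ℚ * series z N α}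
    (λ N α → sym (trans (sym (ℚ.neg-distribˡ-* 1ℚ (- x₀-power 1 N α)))
       (trans (cong -_ (ℚ.*-identityˡ (- x₀-power 1 N α))) (-‿involutive (x₀-power 1 N α)))))
    (IsLinear-generator (- 1ℚ) z)

  x₀-power-polynomial : ∀ e → IsPolynomial (x₀-power e)
  x₀-power-polynomial zero    = (1ℚ , []) ∷ [] , λ N α →
    trans (ℚ.+-identityʳ (1ℚ * 1ˢ N α)) (trans (ℚ.*-identityˡ (1ˢ N α)) (cong (λ β → δ β α) (sym (x^0 (index0 N)))))
  x₀-power-polynomial (suc e) = IsPolynomial-cong {x₀-power 1 *ˢ x₀-power e} {x₀-power (suc e)}
    (λ N α → trans (δ-⋆ (x[ index0 N ]^ 1) (x[ index0 N ]^ e) α) (cong (λ β → δ β α) (sym (x^-+ (index0 N) 1 e))))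
    (IsPolynomial-linear {x₀-power 1} {x₀-power e} x₀-linear (x₀-power-polynomial e))

  unconstrained-polynomial : ∀ {k} (ws : Vec Block k) e → IsPolynomial (constrained [] (ws , e))
  unconstrained-polynomial []             e = IsPolynomial-cong {x₀-power e} {constrained [] ([] , e)}
    (λ N α → sym (constrained-[]-zero e N α)) (x₀-power-polynomial e)
  unconstrained-polynomial ((a , b) ∷ ws) e = IsPolynomial-cong {p (suc a) b *ˢ constrained [] (ws , e)} {constrained [] ((a , b) ∷ ws , e)}
    (λ N α → sym (constrained-[]-suc (a , b) ws e N α))
    (IsPolynomial-linear {p (suc a) b} {constrained [] (ws , e)} (p-linear a b) (unconstrained-polynomial ws e))

  -- Deletion and contraction: a violated constraint eliminates a variable.
  constrained-polynomial : ∀ {k m} (cs : Constraints k m) W → IsPolynomial (constrained cs W)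
  constrained-polynomial []             (ws , e) = unconstrained-polynomial ws e
  constrained-polynomial ((u , v) ∷ cs) W        =
    IsPolynomial-cong {λ N α → constrained cs W N α + - 1ℚ * violating u v cs W N α} {constrained ((u , v) ∷ cs) W}
      (λ N α → sym (constrained-∷ u v cs W N α))
      (IsPolynomial-+ {constrained cs W} {λ N α → - 1ℚ * violating u v cs W N α}
        (constrained-polynomial cs W)
        (IsPolynomial-scale {violating u v cs W} (- 1ℚ) (violation (solveEquation u v) cs W (λ cs W → constrained-polynomial cs W))))
    where
    -- The recursion is on the number m of inequalities. Elimination changes the number k of
    -- variables, so the induction hypothesis is passed for all k.
    violation : ∀ {k m} {u v : Term k} → Solution u v → (cs : Constraints k m) (W : Vec Block k × ℕ) →
      (∀ {k} (cs : Constraints k m) W → IsPolynomial (constrained cs W)) → IsPolynomial (violating u v cs W)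
    violation {u = u} {v} (always eq) cs W ih = IsPolynomial-cong {constrained cs W} {violating u v cs W}
      (λ N α → sym (violating-always {u = u} {v} cs W N α eq)) (ih cs W)
    violation {u = u} {v} (eliminate i τ to from) cs W ih =
      IsPolynomial-cong {constrained (substituteAll i τ cs) (contract i τ W)} {violating u v cs W}
        (λ N α → sym (violating-eliminate {u = u} {v} cs W i τ N α (to N) (from N))) (ih (substituteAll i τ cs) (contract i τ W))

  module _ (G : SignedGraph) where
    open SignedGraph G

    edgeConstraints : Constraints #V #E
    edgeConstraints = Vec.tabulate λ e → ± Sign.+ (end e zero) , ± (sgn e) (end e (suc zero))

    satisfied-tabulate : ∀ N {k} m (f : Fin m → Term k × Term k) κ →
      satisfied N (Vec.tabulate f) κ ≡ ∏ m (λ e → 𝟙 (¬? (interpret N κ (proj₁ (f e)) Fin.≟ interpret N κ (proj₂ (f e)))))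
    satisfied-tabulate N zero    f κ = refl
    satisfied-tabulate N (suc m) f κ = cong (𝟙 (¬? (interpret N κ (proj₁ (f zero)) Fin.≟ interpret N κ (proj₂ (f zero)))) *_)
      (satisfied-tabulate N m (f ∘ suc) κ)

    blocks-singletons : ∀ N {k} (κ : Vec (Index N) k) → blocks N (replicate k (0 , 0)) κ ≡ ∏x κ
    blocks-singletons N []      = refl
    blocks-singletons N (c ∷ κ) = cong₂ _*ᵐ_
      (trans (cong ((x[ c ]^ 1) *ᵐ_) (x^0 (opposite c))) (*ᵐ-identityʳ (x[ c ]^ 1))) (blocks-singletons N κ)

    X-polynomial : IsPolynomial (X G)
    X-polynomial = IsPolynomial-cong {constrained edgeConstraints (replicate #V (0 , 0) , 0)} {X G} eq
      (constrained-polynomial edgeConstraints (replicate #V (0 , 0) , 0))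
      where
      eq : constrained edgeConstraints (replicate #V (0 , 0) , 0) ≈ X G
      eq N α = trans
        (∑-cong (allVecs (indices N) #V) λ κ → cong₂ _*_
          (trans (satisfied-tabulate N #E (λ e → ± Sign.+ (end e zero) , ± (sgn e) (end e (suc zero))) κ)
          (trans (∏-𝟙 (distinct? κ)) (𝟙-⇔ (Fin.all? (distinct? κ)) (good? κ)
            (λ h e eq → h e (value-injective N (trans eq (sym (value-flip N (sgn e) (lookup κ (end e (suc zero))))))))
            (λ h e eq → h e (trans (cong (value N) eq) (value-flip N (sgn e) (lookup κ (end e (suc zero)))))))))
          (cong (λ β → δ β α) (trans (cong₂ _*ᵐ_ (blocks-singletons N κ) (x^0 (index0 N))) (*ᵐ-identityʳ (∏x κ)))))
        (sym (∑-filter good? (allVecs (indices N) #V) (λ κ → δ (∏x κ) α)))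
        where
        good? : ∀ κ → Dec (Proper G (value N ∘ lookup κ))
        good? κ = proper? G (value N ∘ lookup κ)
        distinct? : ∀ κ e → Dec (¬ lookup κ (end e zero) ≡ flip (sgn e) (lookup κ (end e (suc zero))))
        distinct? κ e = ¬? (lookup κ (end e zero) Fin.≟ flip (sgn e) (lookup κ (end e (suc zero))))

open import Data.Nat.Base using (ℕ)
open import Data.Integer.Base using (+_)
open import Data.Product using (∃-syntax; _×_)
open import Relation.Binary.PropositionalEquality using (_≡_)
open import Defs

theorem3p4 : (G : SignedGraph) →
    (∃[ P ] ⟦ P ⟧ ≈ X G) ×
    (∀ (P : Polynomial) → ⟦ P ⟧ ≈ X G → ∀ (k : ℕ) →
    ∃[ c ] HasCardinality (AcyclicOrientationWithSinks G k) c × fromℤ (+ c) ≡ coefficientSum k P)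
theorem3p4 G = Existence.X-polynomial G , λ P eq k →
  length (filter (counted? k) orientations) , orientations-cardinality k , SinkCount.count G P eq k
  where
  open import Data.List.Base using (length; filter)
  open import Data.Product using (_,_)
  open Cycles.Walks G
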